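{- Let $k\ge 3$ and $g\ge 5$ and let $G$ be a $(k,g)$-graph with $|G|<2\,b_2(k,g,(k-2)g)$. Then $G$ is cyclically $(k-2)g$-edge-connected, and every cycle-separating edge-cut of $G$ consisting of $(k-2)g$ edges separates $G$ into two components one of which is a cycle of length $g$.
   Context: A $(k,g)$-graph is a $k$-regular (simple) graph of girth $g$. An edge-cut is cycle-separating if its removal leaves at least two components containing a cycle; a graph is cyclically $c$-edge-connected if it has no cycle-separating edge-cut with fewer than $c$ edges. Moore bound: $M(k,2d+1)=\frac{k(k-1)^d-2}{k-2}$, $M(k,2d+2)=\frac{2(k-1)^{d+1}-2}{k-2}$. For $g=2d+1$ define $P_{k,g,s}(n)=n^2-M(k,g)n+\frac{s(dk-2d-1)(k-1)^d+s}{(k-2)^2}$; for $g=2d+2$ define $P_{k,g,s}(n)=kn^2-(kM+s)n+Ms+2s\cdot\frac{(dk-2d-1)(k-1)^{d+1}+k-1}{(k-2)^2}$ with $M=M(k,g)$. Let $v(k,g,s)=\frac12M(k,g)$ for odd $g$ and $\frac12M(k,g)+\frac{s}{2k}$ for even $g$. If $P_{k,g,s}$ has real roots, $b_1(k,g,s)\le b_2(k,g,s)$ denote them; otherwise $b_1=b_2=v(k,g,s)$. -}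

module Defs where

open import Data.Nat as ℕ using (ℕ; zero; suc; _∸_; _≤_; _<ᵇ_)
open import Data.Nat.DivMod using (_%_; _/_; m%n<n)
open import Data.Integer as ℤ using (ℤ; +_)
open import Data.Rational as ℚ using (ℚ; 0ℚ)
open import Data.Fin using (Fin; zero; suc; toℕ; fromℕ<)
open import Data.Fin.Properties using ()
open import Data.Bool using (Bool; true; false; _∧_; not; if_then_else_)
open import Data.List using (List; map)
open import Data.Nat.ListAction using (sum)
open import Data.List.Base using (allFin)
open import Data.Product using (Σ; ∃; _×_; _,_)
open import Data.Sum using (_⊎_)
open import Relation.Binary.PropositionalEquality using (_≡_)
open import Relation.Nullary using (¬_)
open import Function.Definitions using (Injective)

-- rational p / q, with the (never used) convention p / 0 := 0
frac : ℤ → ℕ → ℚ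
frac p zero = 0ℚ
frac p (suc m) = p ℚ./ suc m

ι : ℤ → ℚ
ι z = frac z 1

-- g = 2d+1 (odd) or g = 2d+2 (even)
isOdd : ℕ → Bool
isOdd g = not (isZero (g % 2))
  where
  isZero : ℕ → Bool
  isZero zero = true
  isZero (suc _) = false

dOf : ℕ → ℕ
dOf g = if isOdd g then g / 2 else (g / 2) ∸ 1

Moore : ℕ → ℕ → ℚ
Moore k g with isOdd g
... | true  = frac (+ k ℤ.* (+ (k ∸ 1)) ℤ.^ d ℤ.- + 2) (k ∸ 2)
  where d = dOf g
... | false = frac (+ 2 ℤ.* (+ (k ∸ 1)) ℤ.^ (d ℕ.+ 1) ℤ.- + 2) (k ∸ 2)
  where d = dOf g

P : ℕ → ℕ → ℕ → ℚ → ℚ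
P k g s x with isOdd g
... | true  = x ℚ.* x ℚ.- M ℚ.* x
              ℚ.+ frac (S ℤ.* (D ℤ.* K ℤ.- + 2 ℤ.* D ℤ.- + 1) ℤ.* (K ℤ.- + 1) ℤ.^ d ℤ.+ S)
                       ((k ∸ 2) ℕ.* (k ∸ 2))
  where d = dOf g
        M = Moore k g
        K = + k
        D = + d
        S = + s
... | false = ι K ℚ.* x ℚ.* x ℚ.- (ι K ℚ.* M ℚ.+ ι S) ℚ.* x ℚ.+ M ℚ.* ι S
              ℚ.+ ι (+ 2 ℤ.* S) ℚ.*
                  frac ((D ℤ.* K ℤ.- + 2 ℤ.* D ℤ.- + 1) ℤ.* (K ℤ.- + 1) ℤ.^ (d ℕ.+ 1) ℤ.+ K ℤ.- + 1)
                       ((k ∸ 2) ℕ.* (k ∸ 2))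
  where d = dOf g
        M = Moore k g
        K = + k
        D = + d
        S = + s

v : ℕ → ℕ → ℕ → ℚ
v k g s with isOdd g
... | true  = Moore k g ℚ.* frac (+ 1) 2
... | false = Moore k g ℚ.* frac (+ 1) 2 ℚ.+ frac (+ s) (2 ℕ.* k)

-- "x < b₂(k,g,s)", as the lower Dedekind cut of b₂: since the leading
-- coefficient of P is positive, x < b₂ iff x < v or P(x) < 0
-- (this also covers the case of no real roots, where b₂ = v).
LtB₂ : ℕ → ℕ → ℕ → ℚ → Set
LtB₂ k g s x = (x ℚ.< v k g s) ⊎ (P k g s x ℚ.< 0ℚ)

record Graph (n : ℕ) : Set where
  field
    adj    : Fin n → Fin n → Bool
    sym    : ∀ i j → adj i j ≡ adj j i
    irrefl : ∀ i → adj i i ≡ false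
open Graph public

b2n : Bool → ℕ
b2n true = 1
b2n false = 0

degree : ∀ {n} → Graph n → Fin n → ℕ
degree {n} G i = sum (map (λ j → b2n (adj G i j)) (allFin n))

Regular : ∀ {n} → ℕ → Graph n → Set
Regular k G = ∀ i → degree G i ≡ k

next : ∀ {m} → Fin m → Fin m
next {suc m} i = fromℕ< (m%n<n (suc (toℕ i)) (suc m))

record Cycle (n : ℕ) (A : Fin n → Fin n → Bool) : Set where
  field
    m    : ℕ
  len : ℕ
  len = suc (suc (suc m))
  field
    vtx  : Fin len → Fin n
    inj  : Injective _≡_ _≡_ vtx
    edge : ∀ i → A (vtx i) (vtx (next i)) ≡ true
open Cycle public

data Reach {n : ℕ} (A : Fin n → Fin n → Bool) : Fin n → Fin n → Set where
  here : ∀ {u} → Reach A u u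
  step : ∀ {u w x} → A u w ≡ true → Reach A w x → Reach A u x

Girth : ∀ {n} → ℕ → Graph n → Set
Girth {n} g G = (Σ (Cycle n (adj G)) λ C → len C ≡ g)
              × (∀ (C : Cycle n (adj G)) → g ≤ len C)

record EdgeSet {n : ℕ} (G : Graph n) : Set where
  field
    mem : Fin n → Fin n → Bool
    sym : ∀ i j → mem i j ≡ mem j i
    sub : ∀ i j → mem i j ≡ true → adj G i j ≡ true
open EdgeSet public

size : ∀ {n} {G : Graph n} → EdgeSet G → ℕ
size {n} F = sum (map (λ i → sum (map (λ j → b2n (mem F i j ∧ (toℕ i <ᵇ toℕ j))) (allFin n))) (allFin n))

minus : ∀ {n} (G : Graph n) → EdgeSet G → Fin n → Fin n → Bool
minus G F i j = adj G i j ∧ not (mem F i j)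

CycleSeparating : ∀ {n} (G : Graph n) → EdgeSet G → Set
CycleSeparating {n} G F =
  Σ (Cycle n (minus G F)) λ C₁ → Σ (Cycle n (minus G F)) λ C₂ →
    ¬ Reach (minus G F) (vtx C₁ zero) (vtx C₂ zero)

CyclicallyEdgeConnected : ∀ {n} → ℕ → Graph n → Set
CyclicallyEdgeConnected c G = ∀ F → CycleSeparating G F → c ≤ size F

TwoComponents : ∀ {n} (G : Graph n) → EdgeSet G → Set
TwoComponents {n} G F = Σ (Fin n) λ u → Σ (Fin n) λ w →
  ¬ Reach (minus G F) u w × (∀ x → Reach (minus G F) x u ⊎ Reach (minus G F) x w)

HasCycleComponent : ∀ {n} (G : Graph n) → EdgeSet G → ℕ → Set
HasCycleComponent {n} G F g = Σ (Cycle n (minus G F)) λ C →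
    len C ≡ g
  × (∀ x → Reach (minus G F) x (vtx C zero) → ∃ λ i → vtx C i ≡ x)
  × (∀ i j → minus G F (vtx C i) (vtx C j) ≡ true → (j ≡ next i) ⊎ (i ≡ next j))

module Submission where

-- Write a = k - 2, b = k - 1, s = a g.  One of the two sides of a cyclic edge cut with at most s edges has at most |G| / 2
-- vertices, and deleting its vertices of degree at most 1 strictly shrinks the cut, so there remains a vertex set S with
-- induced minimum degree at least 2, h = |S| ≤ |G| / 2 and cut at most s.  Let Φ i be the number of non-backtracking
-- walks of length i + 1 in S, so that Φ 0 = 2 h + c with c = a h - |cut|.  Below half the girth such walks are determined
-- by their ends (for odd g their start is a vertex, for even g an edge), which bounds sums of the Φ i by h² or h Φ 0.
--  * Upper estimate of what the cut destroys: b Φ i ≤ Φ (i + 1) + |cut| b^(i + 1).  This gives P(h) ≥ 0.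
--  * Lower estimate around the 2-regular case: Φ i + 3 c ≤ Φ (i + 1).  This gives h = g and c = 0, or h ≥ L, where
--    L = a d (3 d - 1) / 2 for g = 2 d + 1 and L = a D (3 D - 1) / k for g = 2 D.
-- As P(L) < 0 apart from four small pairs (k, g), convexity excludes L ≤ h ≤ |G| / 2 < b₂.  So h = g, c = 0, nothing was
-- deleted, the cut has exactly s edges and S induces a g-cycle.

open import Defs hiding (sym; m; here)
open import Data.Nat hiding (_/_)
open import Data.Nat.Properties
open import Data.Nat.Tactic.RingSolver using (solve-∀)
open import Data.Empty using (⊥; ⊥-elim)
open import Data.Product using (Σ; ∃; _×_; _,_; proj₁; proj₂)
open import Data.Sum using (_⊎_; inj₁; inj₂)
open import Function using (_∘_)
open import Relation.Nullary using (¬_; Dec; yes; no; does)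
open import Relation.Binary.PropositionalEquality using (_≡_; _≢_; refl; sym; trans; cong; cong₂; subst; subst₂; module ≡-Reasoning)
import Data.Integer as ℤ
import Data.Integer.Properties as ℤ
import Data.Integer.Tactic.RingSolver as ℤSolver
import Data.Rational as ℚ
import Data.Rational.Properties as ℚ
import Data.Rational.Unnormalised as ℚᵘ
import Data.Rational.Unnormalised.Properties as ℚᵘ
open import Level using (0ℓ)
open import Tactic.RingSolver.Core.AlmostCommutativeRing using (AlmostCommutativeRing; fromCommutativeRing)
import Tactic.RingSolver as Solver
open import Data.Nat.DivMod using (_%_; m≡m%n+[m/n]*n; m<n⇒m%n≡m; n%n≡0; m%n<n) renaming (_/_ to _div_)
open import Data.Fin as Fin using (Fin; zero; suc; toℕ)
open import Data.Fin.Properties as Fin using (toℕ-fromℕ<; toℕ-injective; toℕ<n)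
open import Data.List using (List; []; _∷_; length; map; allFin; tabulate)
open import Data.List.Properties using (map-tabulate)
open import Data.List.Membership.Propositional using (_∈_)
open import Data.List.Relation.Unary.All using (All; []; _∷_)
open import Data.List.Relation.Unary.All.Properties using (¬Any⇒All¬)
open import Data.List.Relation.Unary.AllPairs using ([]; _∷_)
open import Data.List.Relation.Unary.Any using (here; there)
open import Data.List.Relation.Unary.Unique.Propositional using (Unique)
import Data.List.Membership.DecPropositional as DecMembership
import Data.List.Relation.Unary.Unique.DecPropositional as DecUnique
import Data.Nat.ListAction as List
open import Algebra.Properties.Semiring.Sum +-*-semiring using (sum; sum-cong-≗; sum-replicate-zero; ∑-distrib-+; ∑-comm; *-distribˡ-sum; *-distribʳ-sum)
import Data.Bool as Bool
open import Data.Bool using (Bool; true; false; _∧_; _∨_; not)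
open import Data.Fin.Induction using (<-weakInduction)
open import Relation.Nullary.Decidable using (_×-dec_; dec-true; dec-false; dec⇒maybe)
open import Relation.Binary.Definitions using (tri<; tri≈; tri>)

-- Quadratics and the Moore sums

-- P(h) ≥ 0 excludes only b₁ < h < b₂ and says nothing about small h; the lower estimate is there to
-- jump from h = g past b₁. Both estimates come from one recursion, `Φ-step`: prefixing an edge to a
-- walk gives a longer walk unless it backtracks, so Φ (i + 1) + Φ i is the sum over y of deg y
-- times the number of walks of length i + 1 from y. Writing deg y as 2 plus an excess, or as k
-- minus the cut degree, gives the two directions. At the four small pairs P(L) < 0 fails: for (3,5)
-- and (4,5) L is the larger root, for (3,6) there is no real root and L is the vertex 8, for (4,6)
-- L = 12 is the smaller root, so that h = 12 needs an argument of its own. That there are only two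
-- components is again an equality case: if the edge cut has exactly s edges, the components of both
-- cycles have cuts of size s, which leaves no cut edge for the remaining vertices. The counting,
-- applied to a set with empty cut, shows that G is connected, so no vertices remain.

σ : ℕ → ℕ → ℕ
σ b zero    = 0
σ b (suc d) = σ b d + b ^ d

-- `σ b d` is 1 + b + ... + b^(d-1), and `κ b d` is its weighted form 1 + 2 b + ... + d b^(d-1).
-- With b = k - 1 the Moore bound is 1 + k σ or 2 σ, and the constant term of P is s κ or 2 s κ,
-- taken at d for odd and at d + 1 for even girth.
κ : ℕ → ℕ → ℕ
κ b zero    = 0
κ b (suc d) = κ b d + suc d * b ^ d

-- Stated without subtraction or division, so that powers of b and the sums can be traded for each
-- other inside ℕ; likewise `κ-closed`.
σ-closed : ∀ a d → a * σ (suc a) d + 1 ≡ suc a ^ d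
σ-closed a zero = cong (_+ 1) (*-zeroʳ a)
σ-closed a (suc d) = trans (reassoc a (σ (suc a) d) (suc a ^ d)) (cong (_+ a * suc a ^ d) (σ-closed a d))
  where
  reassoc : ∀ a s q → a * (s + q) + 1 ≡ (a * s + 1) + a * q
  reassoc = solve-∀

κ-closed : ∀ a d → a * a * κ (suc a) d + suc a ^ d ≡ suc a ^ d * (d * a) + 1
κ-closed a zero = cong (_+ 1) (*-zeroʳ (a * a))
κ-closed a (suc d) = begin-equality
  a * a * (K + suc d * q) + suc a * q       ≡⟨ expand a K q d ⟩
  (a * a * K + q) + (a * a * suc d + a) * q ≡⟨ cong (_+ (a * a * suc d + a) * q) (κ-closed a d) ⟩
  q * (d * a) + 1 + (a * a * suc d + a) * q ≡⟨ collect a q d ⟩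
  suc a * q * (suc d * a) + 1               ∎
  where
  open ≤-Reasoning
  K = κ (suc a) d
  q = suc a ^ d
  expand : ∀ a K q d → a * a * (K + suc d * q) + suc a * q ≡ (a * a * K + q) + (a * a * suc d + a) * q
  expand = solve-∀
  collect : ∀ a q d → q * (d * a) + 1 + (a * a * suc d + a) * q ≡ suc a * q * (suc d * a) + 1
  collect = solve-∀

<-from-≡ : ∀ {x y} z → x ≡ y + (z + 1) → y < x
<-from-≡ {x} {y} z eq = subst (y <_) (sym eq) (m<m+n y (m≤n+m 1 z))

≤-from-≡ : ∀ {x y} z → x ≡ y + z → y ≤ x
≤-from-≡ {x} {y} z eq = subst (y ≤_) (sym eq) (m≤m+n y z)

module Quadratic (A B C : ℕ) where

  Negative : ℕ → Set
  Negative t = A * (t * t) + C < B * t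

  -- p(v) - p(u) = (v - u) (A (u + v) - B), and the slope condition makes the second factor
  -- nonpositive.
  negative-right : ∀ {u v} → u ≤ v → A * (u + v) ≤ B → Negative u → Negative v
  negative-right {u} {v} u≤v slope neg with m≤n⇒∃[o]m+o≡n u≤v
  ... | e , refl = begin-strict
    A * ((u + e) * (u + e)) + C           ≡⟨ expand A C u e ⟩
    A * (u * u) + C + A * (u + (u + e)) * e <⟨ +-mono-<-≤ neg (*-monoˡ-≤ e slope) ⟩
    B * u + B * e                         ≡⟨ sym (*-distribˡ-+ B u e) ⟩
    B * (u + e)                           ∎
    where
    open ≤-Reasoning
    expand : ∀ A C u e → A * ((u + e) * (u + e)) + C ≡ A * (u * u) + C + A * (u + (u + e)) * e
    expand = solve-∀

  negative-left : ∀ {v w} → v ≤ w → B ≤ A * (v + w) → Negative w → Negative v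
  negative-left {v} {w} v≤w slope neg with m≤n⇒∃[o]m+o≡n v≤w
  ... | f , refl = +-cancelʳ-< (A * (v + (v + f)) * f) _ _ (begin-strict
    A * (v * v) + C + A * (v + (v + f)) * f ≡⟨ sym (expand A C v f) ⟩
    A * ((v + f) * (v + f)) + C           <⟨ neg ⟩
    B * (v + f)                           ≡⟨ *-distribˡ-+ B v f ⟩
    B * v + B * f                         ≤⟨ +-monoʳ-≤ (B * v) (*-monoˡ-≤ f slope) ⟩
    B * v + A * (v + (v + f)) * f         ∎)
    where
    open ≤-Reasoning
    expand : ∀ A C v f → A * ((v + f) * (v + f)) + C ≡ A * (v * v) + C + A * (v + (v + f)) * f
    expand = solve-∀

  -- Convexity without real roots: the sign of the secant slope A (u + v) - B decides whether
  -- negativity is carried over from `u` or from `w`.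
  negative-between : ∀ {u v w} → u ≤ v → v ≤ w → Negative u → Negative w → Negative v
  negative-between {u} {v} {w} u≤v v≤w negu negw with ≤-total (A * (u + v)) B
  ... | inj₁ slope = negative-right u≤v slope negu
  ... | inj₂ slope = negative-left v≤w (≤-trans slope (*-monoʳ-≤ A (≤-trans (+-monoˡ-≤ v (≤-trans u≤v v≤w)) (≤-reflexive (+-comm w v))))) negw

-- The condition n / 2 < b₂ for the quadratic p(t) = A t² - B t + C, cleared of denominators.
BelowLargerRoot : ℕ → ℕ → ℕ → ℕ → Set
BelowLargerRoot A B C n = (A * n < B) ⊎ (A * (n * n) + 4 * C < 2 * B * n)

-- The rational number l / M with M = m + 1 is at most h and has p < 0. If n / 2 is left of the
-- vertex, p decreases from l / M to h; otherwise p(n / 2) < 0 as well, and h lies in between.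
-- Either way p(h) < 0.
root-gap : ∀ A B C m l h n → BelowLargerRoot A B C n → 2 * h ≤ n → B * h ≤ A * (h * h) + C →
           l ≤ suc m * h → A * (l * l) + C * (suc m * suc m) < B * suc m * l → ⊥
root-gap A B C m l h n (inj₁ n<) 2h≤n p[h]≥0 l≤ p[l]<0 = <⇒≱ neg (begin
  B * M * (M * h)                    ≡⟨ e₁ B M h ⟩
  M * M * (B * h)                    ≤⟨ *-monoʳ-≤ (M * M) p[h]≥0 ⟩
  M * M * (A * (h * h) + C)          ≡⟨ e₂ A C M h ⟩
  A * (M * h * (M * h)) + C * (M * M) ∎)
  where
  open ≤-Reasoning
  M = suc m
  e₁ : ∀ B M h → B * M * (M * h) ≡ M * M * (B * h)
  e₁ = solve-∀
  e₂ : ∀ A C M h → M * M * (A * (h * h) + C) ≡ A * (M * h * (M * h)) + C * (M * M)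
  e₂ = solve-∀
  e₃ : ∀ A M h → A * (M * h + M * h) ≡ M * (A * (2 * h))
  e₃ = solve-∀
  slope : A * (l + M * h) ≤ B * M
  slope = begin
    A * (l + M * h)     ≤⟨ *-monoʳ-≤ A (+-monoˡ-≤ (M * h) l≤) ⟩
    A * (M * h + M * h) ≡⟨ e₃ A M h ⟩
    M * (A * (2 * h))   ≤⟨ *-monoʳ-≤ M (≤-trans (*-monoʳ-≤ A 2h≤n) (<⇒≤ n<)) ⟩
    M * B               ≡⟨ *-comm M B ⟩
    B * M               ∎
  neg : A * (M * h * (M * h)) + C * (M * M) < B * M * (M * h)
  neg = Quadratic.negative-right A (B * M) (C * (M * M)) l≤ slope p[l]<0
root-gap A B C m l h n (inj₂ p[n]<0) 2h≤n p[h]≥0 l≤ p[l]<0 = <⇒≱ neg (begin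
  2 * B * M * (M * (2 * h))                  ≡⟨ e₁ B M h ⟩
  4 * (M * M) * (B * h)                      ≤⟨ *-monoʳ-≤ (4 * (M * M)) p[h]≥0 ⟩
  4 * (M * M) * (A * (h * h) + C)            ≡⟨ e₂ A C M h ⟩
  A * (M * (2 * h) * (M * (2 * h))) + 4 * C * (M * M) ∎)
  where
  open ≤-Reasoning
  M = suc m
  e₁ : ∀ B M h → 2 * B * M * (M * (2 * h)) ≡ 4 * (M * M) * (B * h)
  e₁ = solve-∀
  e₂ : ∀ A C M h → 4 * (M * M) * (A * (h * h) + C) ≡ A * (M * (2 * h) * (M * (2 * h))) + 4 * C * (M * M)
  e₂ = solve-∀
  e₃ : ∀ A C M l → A * (2 * l * (2 * l)) + 4 * C * (M * M) ≡ 4 * (A * (l * l) + C * (M * M))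
  e₃ = solve-∀
  e₄ : ∀ B M l → 4 * (B * M * l) ≡ 2 * B * M * (2 * l)
  e₄ = solve-∀
  e₅ : ∀ A C M n → A * (M * n * (M * n)) + 4 * C * (M * M) ≡ M * M * (A * (n * n) + 4 * C)
  e₅ = solve-∀
  e₆ : ∀ B M n → M * M * (2 * B * n) ≡ 2 * B * M * (M * n)
  e₆ = solve-∀
  e₇ : ∀ M h → 2 * (M * h) ≡ M * (2 * h)
  e₇ = solve-∀
  -- The points l / M, h and n / 2 are scaled by 2 M to become natural numbers, and the coefficients
  -- along with them.
  open Quadratic A (2 * B * M) (4 * C * (M * M))
  at-l : Negative (2 * l)
  at-l = begin-strict
    A * (2 * l * (2 * l)) + 4 * C * (M * M) ≡⟨ e₃ A C M l ⟩
    4 * (A * (l * l) + C * (M * M))         <⟨ *-monoʳ-< 4 p[l]<0 ⟩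
    4 * (B * M * l)                         ≡⟨ e₄ B M l ⟩
    2 * B * M * (2 * l)                     ∎
  at-n : Negative (M * n)
  at-n = begin-strict
    A * (M * n * (M * n)) + 4 * C * (M * M) ≡⟨ e₅ A C M n ⟩
    M * M * (A * (n * n) + 4 * C)           <⟨ *-monoʳ-< (M * M) p[n]<0 ⟩
    M * M * (2 * B * n)                     ≡⟨ e₆ B M n ⟩
    2 * B * M * (M * n)                     ∎
  neg : Negative (M * (2 * h))
  neg = negative-between (≤-trans (*-monoʳ-≤ 2 l≤) (≤-reflexive (e₇ M h))) (*-monoʳ-≤ M 2h≤n) at-l at-n

-- The inequalities behind P(L) < 0, with q = (a + 1)^d; here d = f + 2 for odd and d = e + 1 for even girth.
-- Numerals stand on the right of + and *, where they do not unfold when the solver's normal forms are compared.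
OddIneq : ℕ → ℕ → ℕ → Set
OddIneq a f q =
  a * a * a * (((f + 2) * (f * 3 + 5)) * ((f + 2) * (f * 3 + 5))) + (f * 2 + 5) * 4 + a * ((f + 2) * (f * 3 + 5)) * 4
  < q * (((f + 2) * (f * 3 + 5)) * (a * a) * 2 + (f + 2) * f * a * 4 + (f * 2 + 5) * 4)

EvenIneq : ℕ → ℕ → ℕ → Set
EvenIneq a e q =
  a * a * a * (e + 1) * e * (e * 3 + 2) * 3 + (a + 2) * 4 + (a + 2) * a * (e * 3 + 2) * 2
  < q * ((a + 2) * (a * e + 2) * 2)

-- After the shift a = x + 3 the difference of the two sides has only nonnegative coefficients and a
-- positive constant. The polynomial inequalities that follow are proved in the same way, each with
-- the shift that its case allows.
odd-ineq₂ : ∀ x → OddIneq (x + 3) 0 ((x + 3 + 1) * (x + 3 + 1))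
odd-ineq₂ x = <-from-≡ _ (identity x)
  where
  identity : ∀ x → ((x + 3 + 1) * (x + 3 + 1)) * (((0 + 2) * (0 * 3 + 5)) * ((x + 3) * (x + 3)) * 2 + (0 + 2) * 0 * (x + 3) * 4 + (0 * 2 + 5) * 4)
    ≡ (x + 3) * (x + 3) * (x + 3) * (((0 + 2) * (0 * 3 + 5)) * ((0 + 2) * (0 * 3 + 5))) + (0 * 2 + 5) * 4 + (x + 3) * ((0 + 2) * (0 * 3 + 5)) * 4
      + ((((x * 20 + 180) * x + 580) * x + 780) * x + 359 + 1)
  identity = solve-∀

odd-ineq₃ : ∀ x → OddIneq (x + 1) 1 ((x + 1 + 1) * (x + 1 + 1) * (x + 1 + 1))
odd-ineq₃ x = <-from-≡ _ (identity x)
  where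
  identity : ∀ x → ((x + 1 + 1) * (x + 1 + 1) * (x + 1 + 1)) * (((1 + 2) * (1 * 3 + 5)) * ((x + 1) * (x + 1)) * 2 + (1 + 2) * 1 * (x + 1) * 4 + (1 * 2 + 5) * 4)
    ≡ (x + 1) * (x + 1) * (x + 1) * (((1 + 2) * (1 * 3 + 5)) * ((1 + 2) * (1 * 3 + 5))) + (1 * 2 + 5) * 4 + (x + 1) * ((1 + 2) * (1 * 3 + 5)) * 4
      + (((((x * 48 + 396) * x + 736) * x + 480) * x + 96) * x + 3 + 1)
  identity = solve-∀

-- For d = y + 4 the power b^d is replaced by its lower bound a^2 d^2, which makes the inequality
-- polynomial in d as well.
odd-ineq : ∀ x y → OddIneq (x + 1) (y + 2) ((x + 1) * (x + 1) * ((y + 4) * (y + 4)))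
odd-ineq x y = <-from-≡ _ (identity x y)
  where
  identity : ∀ x y → ((x + 1) * (x + 1) * ((y + 4) * (y + 4))) * ((((y + 2) + 2) * ((y + 2) * 3 + 5)) * ((x + 1) * (x + 1)) * 2 + ((y + 2) + 2) * (y + 2) * (x + 1) * 4 + ((y + 2) * 2 + 5) * 4)
    ≡ (x + 1) * (x + 1) * (x + 1) * ((((y + 2) + 2) * ((y + 2) * 3 + 5)) * (((y + 2) + 2) * ((y + 2) * 3 + 5))) + ((y + 2) * 2 + 5) * 4 + (x + 1) * (((y + 2) + 2) * ((y + 2) * 3 + 5)) * 4
      + (((((((((y * 6 + 94) * y + 552) * y + 1440) * y + 1408)) * x + ((((y * 19 + 294) * y + 1703) * y + 4376) * y + 4208)) * x + ((((y * 21 + 326) * y + 1897) * y + 4904) * y + 4752)) * x + ((((y * 9 + 146) * y + 881) * y + 2348) * y + 2336)) * x + ((((y + 20) * y + 135) * y + 372) * y + 347) + 1)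
  identity = solve-∀

even-ineq₃ : ∀ x → EvenIneq (x + 3) 2 ((x + 3 + 1) * (x + 3 + 1) * (x + 3 + 1))
even-ineq₃ x = <-from-≡ _ (identity x)
  where
  identity : ∀ x → ((x + 3 + 1) * (x + 3 + 1) * (x + 3 + 1)) * (((x + 3) + 2) * ((x + 3) * 2 + 2) * 2)
    ≡ (x + 3) * (x + 3) * (x + 3) * (2 + 1) * 2 * (2 * 3 + 2) * 3 + ((x + 3) + 2) * 4 + ((x + 3) + 2) * (x + 3) * (2 * 3 + 2) * 2
      + (((((x * 4 + 84) * x + 560) * x + 1632) * x + 2124) * x + 971 + 1)
  identity = solve-∀

even-ineq₄ : ∀ x → EvenIneq (x + 1) 3 ((x + 1 + 1) * (x + 1 + 1) * (x + 1 + 1) * (x + 1 + 1))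
even-ineq₄ x = <-from-≡ _ (identity x)
  where
  identity : ∀ x → ((x + 1 + 1) * (x + 1 + 1) * (x + 1 + 1) * (x + 1 + 1)) * (((x + 1) + 2) * ((x + 1) * 3 + 2) * 2)
    ≡ (x + 1) * (x + 1) * (x + 1) * (3 + 1) * 3 * (3 * 3 + 2) * 3 + ((x + 1) + 2) * 4 + ((x + 1) + 2) * (x + 1) * (3 * 3 + 2) * 2
      + ((((((x * 6 + 76) * x + 398) * x + 708) * x + 502) * x + 128) * x + 5 + 1)
  identity = solve-∀

even-ineq₅ : ∀ x → EvenIneq (x + 1) 4 ((x + 1 + 1) * (x + 1 + 1) * (x + 1 + 1) * (x + 1 + 1) * (x + 1 + 1))
even-ineq₅ x = <-from-≡ _ (identity x)
  where
  identity : ∀ x → ((x + 1 + 1) * (x + 1 + 1) * (x + 1 + 1) * (x + 1 + 1) * (x + 1 + 1)) * (((x + 1) + 2) * ((x + 1) * 4 + 2) * 2)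
    ≡ (x + 1) * (x + 1) * (x + 1) * (4 + 1) * 4 * (4 * 3 + 2) * 3 + ((x + 1) + 2) * 4 + ((x + 1) + 2) * (x + 1) * (4 * 3 + 2) * 2
      + (((((((x * 8 + 116) * x + 716) * x + 2440) * x + 4120) * x + 3468) * x + 1396) * x + 215 + 1)
  identity = solve-∀

-- The bound b^D ≥ (3/2) a^2 D^2 with D = y + 6 enters doubled, to stay integral; a^2 D^2 alone is
-- too weak at a = 1, D = 6.
double-even-ineq : ∀ x y → ((x + 1) * (x + 1) * (x + 1) * ((y + 5) + 1) * (y + 5) * ((y + 5) * 3 + 2) * 3 + ((x + 1) + 2) * 4 + ((x + 1) + 2) * (x + 1) * ((y + 5) * 3 + 2) * 2) * 2
  < ((x + 1) * (x + 1) * ((y + 6) * (y + 6)) * 3) * (((x + 1) + 2) * ((x + 1) * (y + 5) + 2) * 2)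
double-even-ineq x y = <-from-≡ _ (identity x y)
  where
  identity : ∀ x y → ((x + 1) * (x + 1) * ((y + 6) * (y + 6)) * 3) * (((x + 1) + 2) * ((x + 1) * (y + 5) + 2) * 2)
    ≡ ((x + 1) * (x + 1) * (x + 1) * ((y + 5) + 1) * (y + 5) * ((y + 5) * 3 + 2) * 3 + ((x + 1) + 2) * 4 + ((x + 1) + 2) * (x + 1) * ((y + 5) * 3 + 2) * 2) * 2
      + ((((((((y * 6 + 102) * y + 576) * y + 1080)) * x + (((y * 18 + 324) * y + 1938) * y + 3852)) * x + (((y * 18 + 384) * y + 2634) * y + 5872)) * x + (((y * 6 + 204) * y + 1734) * y + 4364)) * x + ((y * 42 + 462) * y + 1247) + 1)
  identity = solve-∀
-- A step from i to i + 1 multiplies the right side by a + 1 ≥ 2 and the left side by (i + 1)^2 /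
-- i^2, which is at most 2 once i ≥ 3.
growth : ∀ a c e d → 1 ≤ a → 3 ≤ d → e * (a * a * (d * d)) ≤ c * suc a ^ d →
         ∀ y → e * (a * a * ((y + d) * (y + d))) ≤ c * suc a ^ (y + d)
growth a c e d 1≤a 3≤d base zero = base
growth a c e d 1≤a 3≤d base (suc y) = begin
  e * (a * a * (suc i * suc i))           ≤⟨ *-monoʳ-≤ e (*-monoʳ-≤ (a * a) square-step) ⟩
  e * (a * a * (2 * (i * i)))             ≡⟨ e₁ e a i ⟩
  2 * (e * (a * a * (i * i)))             ≤⟨ *-mono-≤ (s≤s 1≤a) (growth a c e d 1≤a 3≤d base y) ⟩
  suc a * (c * suc a ^ i)                 ≡⟨ e₂ (suc a) c (suc a ^ i) ⟩
  c * (suc a * suc a ^ i)                 ∎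
  where
  open ≤-Reasoning
  i = y + d
  e₁ : ∀ e a i → e * (a * a * (2 * (i * i))) ≡ 2 * (e * (a * a * (i * i)))
  e₁ = solve-∀
  e₂ : ∀ b c q → b * (c * q) ≡ c * (b * q)
  e₂ = solve-∀
  e₃ : ∀ j → 2 * ((3 + j) * (3 + j)) ≡ (4 + j) * (4 + j) + (2 + 4 * j + j * j)
  e₃ = solve-∀
  square-step : suc i * suc i ≤ 2 * (i * i)
  square-step with m≤n⇒∃[o]m+o≡n (≤-trans 3≤d (m≤n+m d y))
  ... | j , eq = subst (λ i → suc i * suc i ≤ 2 * (i * i)) eq (≤-from-≡ _ (e₃ j))

shift : ∀ {m n} → m ≤ n → ∃ λ o → o + m ≡ n
shift {m} {n} m≤n = n ∸ m , m∸n+n≡m m≤n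

odd-ineq-mono : ∀ a f {q r} → q ≤ r → OddIneq a f q → OddIneq a f r
odd-ineq-mono a f q≤r lt = <-≤-trans lt (*-monoˡ-≤ (((f + 2) * (f * 3 + 5)) * (a * a) * 2 + (f + 2) * f * a * 4 + (f * 2 + 5) * 4) q≤r)

even-ineq-mono : ∀ a e {q r} → q ≤ r → EvenIneq a e q → EvenIneq a e r
even-ineq-mono a e q≤r lt = <-≤-trans lt (*-monoˡ-≤ ((a + 2) * (a * e + 2) * 2) q≤r)

-- At a = 1 the bound b^d ≥ a^2 d^2 fails for d = 3, so it is used from d = 4 on, while d = 2 and d
-- = 3 leave polynomials in a. For d = 2 both sides are equal at a = 1 and at a = 2.
odd-poly : ∀ a f → 1 ≤ a → (f ≡ 0 → 3 ≤ a) → OddIneq a f (suc a ^ (f + 2))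
odd-poly a 0 _ 3≤a with shift (3≤a refl)
... | x , eq = subst (λ a → OddIneq a 0 (suc a ^ 2)) eq (odd-ineq-mono (x + 3) 0 (≤-reflexive (square (x + 3))) (odd-ineq₂ x))
  where
  square : ∀ a → (a + 1) * (a + 1) ≡ suc a * (suc a * 1)
  square = solve-∀
odd-poly a 1 1≤a _ with shift 1≤a
... | x , eq = subst (λ a → OddIneq a 1 (suc a ^ 3)) eq (odd-ineq-mono (x + 1) 1 (≤-reflexive (cube (x + 1))) (odd-ineq₃ x))
  where
  cube : ∀ a → (a + 1) * (a + 1) * (a + 1) ≡ suc a * (suc a * (suc a * 1))
  cube = solve-∀
odd-poly a (suc (suc y)) 1≤a _ with shift 1≤a
... | x , eq = subst (λ a → OddIneq a (2 + y) (suc a ^ (2 + y + 2))) eq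
                 (subst (λ f → OddIneq (x + 1) f (suc (x + 1) ^ (f + 2))) (+-comm y 2)
                   (odd-ineq-mono (x + 1) (y + 2) large (odd-ineq x y)))
  where
  -- The remainder comes from (a + 1)^4 - 16 a^2 = (a - 1)^2 (a^2 + 6 a + 1) at a = x + 1.
  base : ∀ x → 1 * (suc (x + 1) * (suc (x + 1) * (suc (x + 1) * (suc (x + 1) * 1)))) ≡ 1 * ((x + 1) * (x + 1) * 16) + ((x + 8) * x + 8) * x * x
  base = solve-∀
  large : (x + 1) * (x + 1) * ((y + 4) * (y + 4)) ≤ suc (x + 1) ^ (y + 2 + 2)
  large rewrite +-assoc y 2 2 =
    subst₂ _≤_ (*-identityˡ _) (*-identityˡ _) (growth (x + 1) 1 1 4 (m≤n+m 1 x) (s≤s (s≤s (s≤s z≤n))) (≤-from-≡ _ (base x)) y)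

even-poly : ∀ a e → 1 ≤ a → 2 ≤ e → (e ≡ 2 → 3 ≤ a) → EvenIneq a e (suc a ^ (1 + e))
even-poly a 1 _ (s≤s ()) _
even-poly a 2 _ _ 3≤a with shift (3≤a refl)
... | x , eq = subst (λ a → EvenIneq a 2 (suc a ^ 3)) eq (even-ineq-mono (x + 3) 2 (≤-reflexive (cube (x + 3))) (even-ineq₃ x))
  where
  cube : ∀ a → (a + 1) * (a + 1) * (a + 1) ≡ suc a * (suc a * (suc a * 1))
  cube = solve-∀
even-poly a 3 1≤a _ _ with shift 1≤a
... | x , eq = subst (λ a → EvenIneq a 3 (suc a ^ 4)) eq (even-ineq-mono (x + 1) 3 (≤-reflexive (fourth (x + 1))) (even-ineq₄ x))
  where
  fourth : ∀ a → (a + 1) * (a + 1) * (a + 1) * (a + 1) ≡ suc a * (suc a * (suc a * (suc a * 1)))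
  fourth = solve-∀
even-poly a 4 1≤a _ _ with shift 1≤a
... | x , eq = subst (λ a → EvenIneq a 4 (suc a ^ 5)) eq (even-ineq-mono (x + 1) 4 (≤-reflexive (fifth (x + 1))) (even-ineq₅ x))
  where
  fifth : ∀ a → (a + 1) * (a + 1) * (a + 1) * (a + 1) * (a + 1) ≡ suc a * (suc a * (suc a * (suc a * (suc a * 1))))
  fifth = solve-∀
even-poly a (suc (suc (suc (suc (suc y))))) 1≤a _ _ with shift 1≤a
... | x , eq = subst (λ a → EvenIneq a (5 + y) (suc a ^ (6 + y))) eq
                 (subst (λ e → EvenIneq (x + 1) e (suc (x + 1) ^ (1 + e))) (+-comm y 5) (*-cancelʳ-< _ _ _ (begin-strict
    L * 2                                      <⟨ double-even-ineq x y ⟩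
    (x + 1) * (x + 1) * ((y + 6) * (y + 6)) * 3 * R ≤⟨ *-monoˡ-≤ R large ⟩
    suc (x + 1) ^ (1 + (y + 5)) * 2 * R        ≡⟨ swap (suc (x + 1) ^ (1 + (y + 5))) R ⟩
    suc (x + 1) ^ (1 + (y + 5)) * R * 2        ∎)))
  where
  open ≤-Reasoning
  L = (x + 1) * (x + 1) * (x + 1) * ((y + 5) + 1) * (y + 5) * ((y + 5) * 3 + 2) * 3 + ((x + 1) + 2) * 4 + ((x + 1) + 2) * (x + 1) * ((y + 5) * 3 + 2) * 2
  R = ((x + 1) + 2) * ((x + 1) * (y + 5) + 2) * 2
  swap : ∀ q r → q * 2 * r ≡ q * r * 2
  swap = solve-∀
  base : ∀ x → 2 * (suc (x + 1) * (suc (x + 1) * (suc (x + 1) * (suc (x + 1) * (suc (x + 1) * (suc (x + 1) * 1))))))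
     ≡ 3 * ((x + 1) * (x + 1) * 36) + (((((x * 2 + 24) * x + 120) * x + 320) * x + 372) * x + 168) * x + 20
  base = solve-∀
  large : (x + 1) * (x + 1) * ((y + 6) * (y + 6)) * 3 ≤ suc (x + 1) ^ (1 + (y + 5)) * 2
  large = subst₂ _≤_ (*-comm 3 ((x + 1) * (x + 1) * ((y + 6) * (y + 6))))
            (trans (*-comm 2 (suc (x + 1) ^ (y + 6))) (cong (λ i → suc (x + 1) ^ i * 2) (+-suc y 5)))
            (growth (x + 1) 2 3 6 (m≤n+m 1 x) (s≤s (s≤s (s≤s z≤n))) (≤-from-≡ _ (trans (base x) (+-assoc (3 * ((x + 1) * (x + 1) * 36)) _ 20))) y)

-- l / 2 is the bound L = a d (3 d - 1) / 2 with d = f + 2.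
odd-negative : ∀ a f → 1 ≤ a → (f ≡ 0 → 3 ≤ a) →
  let d = f + 2
      l = a * ((f + 2) * (f * 3 + 5))
      s = a * (f * 2 + 5)
  in 1 * (l * l) + s * κ (suc a) d * 4 < (1 + (a + 2) * σ (suc a) d) * 2 * l
-- The factor a turns s κ into g a^2 κ; the terms added on both sides complete a σ + 1 and a^2 κ +
-- q, so that both closed forms apply without subtraction.
odd-negative a@(suc _) f 1≤a f≢0 = *-cancelˡ-< a _ _ (+-cancelʳ-< (a * w * 4 + g * q * 4) _ _ (begin-strict
  a * (1 * (l * l) + s * K * 4) + (a * w * 4 + g * q * 4)      ≡⟨ e₁ a w g K q ⟩
  a * a * a * (w * w) + (a * a * K + q) * g * 4 + a * w * 4    ≡⟨ cong (λ z → a * a * a * (w * w) + z * g * 4 + a * w * 4) (κ-closed a d) ⟩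
  a * a * a * (w * w) + (q * (d * a) + 1) * g * 4 + a * w * 4  ≡⟨ e₂ a w g q d ⟩
  a * a * a * (w * w) + g * 4 + a * w * 4 + q * d * a * g * 4  <⟨ +-monoˡ-< (q * d * a * g * 4) (odd-poly a f 1≤a f≢0) ⟩
  q * (w * (a * a) * 2 + d * f * a * 4 + g * 4) + q * d * a * g * 4 ≡⟨ e₃ q a f ⟩
  q * (a + 2) * w * a * 2 + g * q * 4                          ≡⟨ cong (λ z → z * (a + 2) * w * a * 2 + g * q * 4) (sym (σ-closed a d)) ⟩
  (a * S + 1) * (a + 2) * w * a * 2 + g * q * 4                ≡⟨ e₄ a S w g q ⟩
  a * ((1 + (a + 2) * S) * 2 * l) + (a * w * 4 + g * q * 4)    ∎))
  where
  open ≤-Reasoning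
  d = f + 2
  w = (f + 2) * (f * 3 + 5)
  g = f * 2 + 5
  l = a * w
  s = a * g
  q = suc a ^ d
  K = κ (suc a) d
  S = σ (suc a) d
  e₁ : ∀ a w g K q → a * (1 * (a * w * (a * w)) + a * g * K * 4) + (a * w * 4 + g * q * 4)
     ≡ a * a * a * (w * w) + (a * a * K + q) * g * 4 + a * w * 4
  e₁ = solve-∀
  e₂ : ∀ a w g q d → a * a * a * (w * w) + (q * (d * a) + 1) * g * 4 + a * w * 4
     ≡ a * a * a * (w * w) + g * 4 + a * w * 4 + q * d * a * g * 4
  e₂ = solve-∀
  e₃ : ∀ q a f → q * ((f + 2) * (f * 3 + 5) * (a * a) * 2 + (f + 2) * f * a * 4 + (f * 2 + 5) * 4) + q * (f + 2) * a * (f * 2 + 5) * 4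
     ≡ q * (a + 2) * ((f + 2) * (f * 3 + 5)) * a * 2 + (f * 2 + 5) * q * 4
  e₃ = solve-∀
  e₄ : ∀ a S w g q → (a * S + 1) * (a + 2) * w * a * 2 + g * q * 4
     ≡ a * ((1 + (a + 2) * S) * 2 * (a * w)) + (a * w * 4 + g * q * 4)
  e₄ = solve-∀

-- l / k is the bound L = a D (3 D - 1) / k with D = e + 1.
even-negative : ∀ a e → 1 ≤ a → 2 ≤ e → (e ≡ 2 → 3 ≤ a) →
  let D = suc e
      k = a + 2
      l = a * (suc e * (e * 3 + 2))
      s = a * (2 * suc e)
  in k * (l * l) + 2 * (s * κ (suc a) D) * (k * k) < (2 * (k * σ (suc a) D) + s) * k * l
-- The factor a^2 and the padding `Z` prepare the closed forms; the common factor `M` = k a D is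
-- split off before the polynomial inequality applies.
even-negative a@(suc _) e 1≤a 2≤e e≢2 = *-cancelˡ-< (a * a) _ _ (+-cancelʳ-< Z _ _ (begin-strict
  a * a * (k * (l * l) + 2 * (s * K) * (k * k)) + Z                      ≡⟨ e₁ a e w k K q ⟩
  M * (a * a * a * D * (w * w) + (a * a * K + q) * k * 4 + k * a * w * 2)           ≡⟨ cong (λ z → M * (a * a * a * D * (w * w) + z * k * 4 + k * a * w * 2)) (κ-closed a D) ⟩
  M * (a * a * a * D * (w * w) + (q * (D * a) + 1) * k * 4 + k * a * w * 2)         ≡⟨ e₂ M a e q ⟩
  M * (X + (q * D * a * k * 4 + a * a * a * D * w * 2))                             <⟨ *-monoʳ-< M (+-monoˡ-< (q * D * a * k * 4 + a * a * a * D * w * 2) (even-poly a e 1≤a 2≤e e≢2)) ⟩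
  M * (q * (k * (a * e + 2) * 2) + (q * D * a * k * 4 + a * a * a * D * w * 2))     ≡⟨ e₃ M a e q ⟩
  M * (q * k * 4 + q * k * a * w * 2 + a * a * a * D * w * 2)                       ≡⟨ cong (λ z → M * (q * k * 4 + z * k * a * w * 2 + a * a * a * D * w * 2)) (sym (σ-closed a D)) ⟩
  M * (q * k * 4 + (a * S + 1) * k * a * w * 2 + a * a * a * D * w * 2)             ≡⟨ e₄ a e w k S q ⟩
  a * a * ((2 * (k * S) + s) * k * l) + Z                                ∎))
  where
  open ≤-Reasoning
  D = suc e
  k = a + 2
  w = e * 3 + 2
  l = a * (suc e * w)
  s = a * (2 * suc e)
  q = suc a ^ D
  K = κ (suc a) D
  S = σ (suc a) D
  M = k * (a * D)
  Z = M * (q * k * 4 + k * a * w * 2)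
  X = a * a * a * (e + 1) * e * (e * 3 + 2) * 3 + (a + 2) * 4 + (a + 2) * a * (e * 3 + 2) * 2
  e₁ : ∀ a e w k K q → a * a * (k * (a * (suc e * w) * (a * (suc e * w))) + 2 * (a * (2 * suc e) * K) * (k * k))
       + k * (a * suc e) * (q * k * 4 + k * a * w * 2)
     ≡ k * (a * suc e) * (a * a * a * suc e * (w * w) + (a * a * K + q) * k * 4 + k * a * w * 2)
  e₁ = solve-∀
  e₂ : ∀ M a e q → M * (a * a * a * suc e * ((e * 3 + 2) * (e * 3 + 2)) + (q * (suc e * a) + 1) * (a + 2) * 4 + (a + 2) * a * (e * 3 + 2) * 2)
     ≡ M * (a * a * a * (e + 1) * e * (e * 3 + 2) * 3 + (a + 2) * 4 + (a + 2) * a * (e * 3 + 2) * 2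
            + (q * suc e * a * (a + 2) * 4 + a * a * a * suc e * (e * 3 + 2) * 2))
  e₂ = solve-∀
  e₃ : ∀ M a e q → M * (q * ((a + 2) * (a * e + 2) * 2) + (q * suc e * a * (a + 2) * 4 + a * a * a * suc e * (e * 3 + 2) * 2))
     ≡ M * (q * (a + 2) * 4 + q * (a + 2) * a * (e * 3 + 2) * 2 + a * a * a * suc e * (e * 3 + 2) * 2)
  e₃ = solve-∀
  e₄ : ∀ a e w k S q → k * (a * suc e) * (q * k * 4 + (a * S + 1) * k * a * w * 2 + a * a * a * suc e * w * 2)
     ≡ a * a * ((2 * (k * S) + a * (2 * suc e)) * k * (a * (suc e * w))) + k * (a * suc e) * (q * k * 4 + k * a * w * 2)
  e₄ = solve-∀

-- From the two estimates to the order of the small side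

above-root : ∀ A B C N n → N ≤ n → B ≤ A * N → (∀ e → 2 * B * (e + N) ≤ A * ((e + N) * (e + N)) + 4 * C) →
             ¬ BelowLargerRoot A B C n
above-root A B C N n N≤n B≤AN _ (inj₁ An<B) = <⇒≱ An<B (≤-trans B≤AN (*-monoʳ-≤ A N≤n))
above-root A B C N n N≤n _ p≥0 (inj₂ p[n]<0) with shift N≤n
... | e , refl = <⇒≱ p[n]<0 (p≥0 e)

-- With h = g + r, a cut of at most a g edges leaves at least a r for the excess a h - s.
excess-bound : ∀ a r g c s → c + s ≡ a * (r + g) → s ≤ a * g → a * r ≤ c
excess-bound a r g c s eq s≤ = +-cancelʳ-≤ (a * g) _ _ (begin
  a * r + a * g ≡⟨ sym (*-distribˡ-+ a r g) ⟩
  a * (r + g)   ≡⟨ sym eq ⟩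
  c + s         ≤⟨ +-monoʳ-≤ c s≤ ⟩
  c + a * g     ∎)
  where open ≤-Reasoning

-- Put h = g + r. The lower estimate reads c w ≤ 2 h r, and c ≥ a r turns it into a w r ≤ 2 h r.
-- Either r = 0, and then c = 0, or r cancels and h ≥ a w / 2, which `root-gap` refutes outside the
-- two small cases.
odd-order : ∀ a f h n c s → 1 ≤ a → 0 < h →
  let d = f + 2
      g = f * 2 + 5
      w = (f + 2) * (f * 3 + 5)
  in c + s ≡ a * h → s ≤ a * g →
     2 * (g * h) + c * w ≤ 2 * (h * h) →
     (1 + (a + 2) * σ (suc a) d) * h ≤ h * h + s * κ (suc a) d →
     BelowLargerRoot 1 (1 + (a + 2) * σ (suc a) d) (a * g * κ (suc a) d) n → 2 * h ≤ n → h ≡ g × c ≡ 0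
odd-order a f h@(suc _) n c s 1≤a _ eq s≤ lower upper below 2h≤n = result
  where
  open ≤-Reasoning
  d = f + 2
  g = f * 2 + 5
  w = (f + 2) * (f * 3 + 5)
  B = 1 + (a + 2) * σ (suc a) d
  C = a * g * κ (suc a) d
  g≤h : g ≤ h
  g≤h = *-cancelʳ-≤ g h h (*-cancelˡ-≤ 2 (≤-trans (m≤m+n _ (c * w)) lower))
  upper′ : B * h ≤ 1 * (h * h) + C
  upper′ = ≤-trans upper (+-mono-≤ (≤-reflexive (sym (*-identityˡ (h * h)))) (*-monoˡ-≤ (κ (suc a) d) s≤))
  impossible : a * w ≤ 2 * h → ⊥
  impossible l≤2h with f ≟ 0 | 3 ≤? a
  ... | no f≢0  | _       = root-gap 1 B C 1 (a * w) h n below 2h≤n upper′ l≤2h (odd-negative a f 1≤a (λ eq → ⊥-elim (f≢0 eq)))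
  ... | yes refl | yes 3≤a = root-gap 1 B C 1 (a * w) h n below 2h≤n upper′ l≤2h (odd-negative a f 1≤a (λ _ → 3≤a))
  ... | yes refl | no 3≰a = small a 1≤a (≰⇒> 3≰a) (≤-trans l≤2h 2h≤n) below
    where
    -- Here a w / 2 is the larger root of the quadratic.
    small : ∀ a → 1 ≤ a → a < 3 → a * 10 ≤ n → ¬ BelowLargerRoot 1 (1 + (a + 2) * σ (suc a) 2) (a * 5 * κ (suc a) 2) n
    small 1 _ _ 10≤n = above-root 1 10 25 10 n 10≤n ≤-refl (λ e → ≤-from-≡ _ (identity e))
      where
      identity : ∀ e → 1 * ((e + 10) * (e + 10)) + 4 * 25 ≡ 20 * (e + 10) + e * e
      identity = solve-∀
    small 2 _ _ 20≤n = above-root 1 17 70 20 n 20≤n (m≤m+n 17 3) (λ e → ≤-from-≡ _ (identity e))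
      where
      identity : ∀ e → 1 * ((e + 20) * (e + 20)) + 4 * 70 ≡ 34 * (e + 20) + (e * e + 6 * e)
      identity = solve-∀
    small (suc (suc (suc _))) _ (s≤s (s≤s (s≤s ())))
  result : h ≡ g × c ≡ 0
  result with shift g≤h
  ... | zero , g≡h = sym g≡h , no-excess (m*n≡0⇒m≡0∨n≡0 c (n≤0⇒n≡0 (+-cancelˡ-≤ (2 * (g * h)) _ _ (begin
      2 * (g * h) + c * w ≤⟨ lower ⟩
      2 * (h * h)         ≡⟨ cong (λ x → 2 * (x * h)) (sym g≡h) ⟩
      2 * (g * h)         ≡⟨ sym (+-identityʳ _) ⟩
      2 * (g * h) + 0     ∎))))
    where
    no-excess : c ≡ 0 ⊎ w ≡ 0 → c ≡ 0
    no-excess (inj₁ c≡0) = c≡0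
    no-excess (inj₂ w≡0) with m*n≡0⇒m≡0∨n≡0 (f + 2) w≡0
    ... | inj₁ z with () ← m+n≡0⇒n≡0 f z
    ... | inj₂ z with () ← m+n≡0⇒n≡0 (f * 3) z
  ... | r@(suc _) , r+g≡h = ⊥-elim (impossible (*-cancelʳ-≤ (a * w) (2 * h) r (+-cancelˡ-≤ (2 * (g * h)) _ _ (begin
      2 * (g * h) + a * w * r   ≡⟨ cong (2 * (g * h) +_) (swap a w r) ⟩
      2 * (g * h) + a * r * w   ≤⟨ +-monoʳ-≤ (2 * (g * h)) (*-monoˡ-≤ w (excess-bound a r g c s (trans eq (cong (a *_) (sym r+g≡h))) s≤)) ⟩
      2 * (g * h) + c * w       ≤⟨ lower ⟩
      2 * (h * h)               ≡⟨ cong (λ x → 2 * (x * h)) (sym r+g≡h) ⟩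
      2 * ((r + g) * h)         ≡⟨ split r g h ⟩
      2 * (g * h) + 2 * h * r   ∎))))
    where
    swap : ∀ a w r → a * w * r ≡ a * r * w
    swap = solve-∀
    split : ∀ r g h → 2 * ((r + g) * h) ≡ 2 * (g * h) + 2 * h * r
    split = solve-∀

-- The counting argument gives the bound with the actual cut size t; it is monotone only through the factor h - 2σ, whose sign decides how t is replaced by s.
pad-cut : ∀ k h Φ t s S R → Φ + t ≡ k * h → t ≤ s → s ≤ k * h → 2 * (S * Φ) ≤ Φ * h + 2 * (s * R) →
          (2 * (k * S) + s) * h ≤ k * (h * h) + 2 * (s * (S + R))
pad-cut k h Φ t s S R eq t≤s s≤kh upper with ≤-total h (2 * S)
-- With e = 2 S - h the estimate bounds e Φ, and Φ = k h - t with t ≤ s brings in the larger cut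
-- size.
... | inj₁ h≤2S with shift h≤2S
...   | e , e+h≡2S = begin
    (2 * (k * S) + s) * h             ≡⟨ i₁ k S s h ⟩
    k * h * (2 * S) + s * h           ≡⟨ cong (λ x → k * h * x + s * h) (sym e+h≡2S) ⟩
    k * h * (e + h) + s * h           ≡⟨ i₂ k h e s ⟩
    k * (h * h) + (e * (k * h) + s * h) ≤⟨ +-monoʳ-≤ (k * (h * h)) (+-monoˡ-≤ (s * h) padded) ⟩
    k * (h * h) + (2 * (s * R) + e * s + s * h) ≡⟨ i₃ (k * (h * h)) s R e h ⟩
    k * (h * h) + (s * (e + h) + 2 * (s * R)) ≡⟨ cong (λ x → k * (h * h) + (s * x + 2 * (s * R))) e+h≡2S ⟩
    k * (h * h) + (s * (2 * S) + 2 * (s * R)) ≡⟨ i₄ (k * (h * h)) s S R ⟩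
    k * (h * h) + 2 * (s * (S + R))   ∎
  where
  open ≤-Reasoning
  i₁ : ∀ k S s h → (2 * (k * S) + s) * h ≡ k * h * (2 * S) + s * h
  i₁ = solve-∀
  i₂ : ∀ k h e s → k * h * (e + h) + s * h ≡ k * (h * h) + (e * (k * h) + s * h)
  i₂ = solve-∀
  i₃ : ∀ x s R e h → x + (2 * (s * R) + e * s + s * h) ≡ x + (s * (e + h) + 2 * (s * R))
  i₃ = solve-∀
  i₄ : ∀ x s S R → x + (s * (2 * S) + 2 * (s * R)) ≡ x + 2 * (s * (S + R))
  i₄ = solve-∀
  i₅ : ∀ e Φ h → (e + h) * Φ ≡ Φ * h + e * Φ
  i₅ = solve-∀
  eΦ≤ : e * Φ ≤ 2 * (s * R)
  eΦ≤ = +-cancelˡ-≤ (Φ * h) _ _ (begin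
    Φ * h + e * Φ         ≡⟨ sym (i₅ e Φ h) ⟩
    (e + h) * Φ           ≡⟨ cong (_* Φ) e+h≡2S ⟩
    2 * S * Φ             ≡⟨ *-assoc 2 S Φ ⟩
    2 * (S * Φ)           ≤⟨ upper ⟩
    Φ * h + 2 * (s * R)   ∎)
  padded : e * (k * h) ≤ 2 * (s * R) + e * s
  padded = begin
    e * (k * h)         ≡⟨ cong (e *_) (sym eq) ⟩
    e * (Φ + t)         ≡⟨ *-distribˡ-+ e Φ t ⟩
    e * Φ + e * t       ≤⟨ +-mono-≤ eΦ≤ (*-monoʳ-≤ e t≤s) ⟩
    2 * (s * R) + e * s ∎
pad-cut k h Φ t s S R eq t≤s s≤kh upper | inj₂ 2S≤h with shift 2S≤h
...   | e , refl = begin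
    (2 * (k * S) + s) * h             ≡⟨ i₁ k S s e ⟩
    2 * (k * S) * h + s * (2 * S) + e * s ≤⟨ +-monoʳ-≤ (2 * (k * S) * h + s * (2 * S)) (*-monoʳ-≤ e s≤kh) ⟩
    2 * (k * S) * h + s * (2 * S) + e * (k * h) ≤⟨ m≤m+n _ (2 * (s * R)) ⟩
    2 * (k * S) * h + s * (2 * S) + e * (k * h) + 2 * (s * R) ≡⟨ i₂ k S s e R ⟩
    k * (h * h) + 2 * (s * (S + R))   ∎
  where
  open ≤-Reasoning
  i₁ : ∀ k S s e → (2 * (k * S) + s) * (e + 2 * S) ≡ 2 * (k * S) * (e + 2 * S) + s * (2 * S) + e * s
  i₁ = solve-∀
  i₂ : ∀ k S s e R → 2 * (k * S) * (e + 2 * S) + s * (2 * S) + e * (k * (e + 2 * S)) + 2 * (s * R) ≡ k * ((e + 2 * S) * (e + 2 * S)) + 2 * (s * (S + R))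
  i₂ = solve-∀

-- The lower estimate now reads c (w - h) ≤ 2 h (h - g). At h = g it gives c = 0, because g < w. For
-- g < h < w the bound c ≥ a (h - g) turns it into a (w - h) ≤ 2 h, that is a w ≤ k h, which is
-- immediate for h ≥ w.
even-order : ∀ a e h n c s R → 1 ≤ a → 2 ≤ e → 0 < h →
  let D = suc e
      g = 2 * suc e
      k = a + 2
      w = suc e * (e * 3 + 2)
      S = σ (suc a) D
  in c + s ≡ a * h → s ≤ a * g → κ (suc a) D ≡ S + R →
     2 * (g * h) + c * w ≤ 2 * (h * h) + c * h →
     2 * (S * (2 * h + c)) ≤ (2 * h + c) * h + 2 * (a * g * R) →
     (a ≡ 2 → e ≡ 2 → h ≢ 12) →
     BelowLargerRoot k (2 * (k * S) + a * g) (2 * (a * g * κ (suc a) D)) n → 2 * h ≤ n → h ≡ g × c ≡ 0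
even-order a@(suc _) e h@(suc _) n c s R 1≤a 2≤e _ eq s≤ κ≡ lower upper extra below 2h≤n = result
  where
  open ≤-Reasoning
  D = suc e
  g = 2 * suc e
  k = a + 2
  w = suc e * (e * 3 + 2)
  S = σ (suc a) D
  B = 2 * (k * S) + a * g
  C = 2 * (a * g * κ (suc a) D)
  g≤w : g ≤ w
  g≤w = ≤-trans (≤-reflexive (*-comm 2 (suc e))) (*-monoʳ-≤ (suc e) (m≤n+m 2 (e * 3)))
  g<w : g < w
  g<w = ≤-<-trans (≤-reflexive (*-comm 2 (suc e))) (*-monoʳ-< (suc e) (m<n+m 2 (*-monoˡ-< 3 (≤-trans (s≤s z≤n) 2≤e))))
  g≤h : g ≤ h
  g≤h = ≮⇒≥ λ h<g → <⇒≱ (+-mono-<-≤ (*-monoʳ-< 2 (*-monoˡ-< h h<g)) (*-monoʳ-≤ c (≤-trans (<⇒≤ h<g) g≤w))) lower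
  degree-sum : 2 * h + c + s ≡ k * h
  degree-sum = trans (+-assoc (2 * h) c s) (trans (cong (2 * h +_) eq) (collect h a))
    where
    collect : ∀ h a → 2 * h + a * h ≡ (a + 2) * h
    collect = solve-∀
  upper′ : B * h ≤ k * (h * h) + C
  upper′ = subst (λ x → B * h ≤ k * (h * h) + 2 * (a * g * x)) (sym κ≡)
             (pad-cut k h (2 * h + c) s (a * g) S R degree-sum s≤ (*-mono-≤ (m≤m+n a 2) g≤h) upper)
  module _ (r : ℕ) (r+g≡h : suc r + g ≡ h) where
    ar≤c : a * suc r ≤ c
    ar≤c = excess-bound a (suc r) g c s (trans eq (cong (a *_) (sym r+g≡h))) s≤
    long : a * w ≤ k * h
    long with ≤-total w h
    ... | inj₁ w≤h = *-mono-≤ (m≤m+n a 2) w≤h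
    ... | inj₂ h≤w with shift h≤w
    ...   | u , u+h≡w = begin
        a * w             ≡⟨ cong (a *_) (sym u+h≡w) ⟩
        a * (u + h)       ≡⟨ *-distribˡ-+ a u h ⟩
        a * u + a * h     ≤⟨ +-monoˡ-≤ (a * h) (*-cancelʳ-≤ (a * u) (2 * h) (suc r) au≤) ⟩
        2 * h + a * h     ≡⟨ collect h a ⟩
        k * h             ∎
      where
      collect : ∀ h a → 2 * h + a * h ≡ (a + 2) * h
      collect = solve-∀
      i₁ : ∀ g h c u → 2 * (g * h) + c * (u + h) ≡ 2 * (g * h) + c * h + c * u
      i₁ = solve-∀
      i₂ : ∀ g h c r → 2 * ((suc r + g) * h) + c * h ≡ 2 * (g * h) + c * h + 2 * h * suc r
      i₂ = solve-∀
      i₃ : ∀ a u r → a * u * suc r ≡ a * suc r * u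
      i₃ = solve-∀
      au≤ : a * u * suc r ≤ 2 * h * suc r
      au≤ = ≤-trans (≤-reflexive (i₃ a u r)) (≤-trans (*-monoˡ-≤ u ar≤c) (+-cancelˡ-≤ (2 * (g * h) + c * h) _ _ (begin
        2 * (g * h) + c * h + c * u         ≡⟨ sym (i₁ g h c u) ⟩
        2 * (g * h) + c * (u + h)           ≡⟨ cong (λ x → 2 * (g * h) + c * x) u+h≡w ⟩
        2 * (g * h) + c * w                 ≤⟨ lower ⟩
        2 * (h * h) + c * h                 ≡⟨ cong (λ x → 2 * (x * h) + c * h) (sym r+g≡h) ⟩
        2 * ((suc r + g) * h) + c * h       ≡⟨ i₂ g h c r ⟩
        2 * (g * h) + c * h + 2 * h * suc r ∎)))
    generic : (e ≡ 2 → 3 ≤ a) → ⊥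
    generic e≢2 = root-gap k B C (suc (pred a + 1)) (a * w) h n below 2h≤n upper′ (≤-trans long (≤-reflexive (cong (_* h) k≡)))
                    (subst (λ z → k * (a * w * (a * w)) + C * (z * z) < B * z * (a * w)) k≡ (even-negative a e 1≤a 2≤e e≢2))
      where
      k≡ : k ≡ suc (suc (pred a + 1))
      k≡ = cong suc (+-suc (pred a) 1)
  -- For a = 1 the quadratic has no real root and its vertex is 8; for a = 2 its smaller root is 12.
  small : ∀ a → 1 ≤ a → a < 3 → a * 24 ≤ (a + 2) * h → (a ≡ 2 → h ≢ 12) →
          (2 * ((a + 2) * σ (suc a) 3) + a * 6) * h ≤ (a + 2) * (h * h) + 2 * (a * 6 * κ (suc a) 3) →
          ¬ BelowLargerRoot (a + 2) (2 * ((a + 2) * σ (suc a) 3) + a * 6) (2 * (a * 6 * κ (suc a) 3)) n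
  small 1 _ _ 24≤3h _ _ = above-root 3 48 204 16 n (≤-trans (*-monoʳ-≤ 2 (*-cancelˡ-≤ {8} {h} 3 24≤3h)) 2h≤n) ≤-refl (λ e → ≤-from-≡ _ (identity e))
    where
    identity : ∀ e → 3 * ((e + 16) * (e + 16)) + 4 * 204 ≡ 96 * (e + 16) + (3 * (e * e) + 48)
    identity = solve-∀
  small 2 _ _ 48≤4h h≢12 upper below = root-gap 4 116 816 0 13 h n below 2h≤n upper
    (subst (13 ≤_) (sym (*-identityˡ h)) (≤∧≢⇒< (*-cancelˡ-≤ {12} {h} 4 48≤4h) (h≢12 refl ∘ sym))) (m≤m+n 1493 15)
  small (suc (suc (suc _))) _ (s≤s (s≤s (s≤s ())))
  result : h ≡ g × c ≡ 0
  result with shift g≤h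
  ... | zero , g≡h = sym g≡h , no-excess c (+-cancelˡ-≤ (2 * (g * h)) _ _ (begin
      2 * (g * h) + c * w ≤⟨ lower ⟩
      2 * (h * h) + c * h ≡⟨ cong₂ (λ x y → 2 * (x * h) + c * y) (sym g≡h) (sym g≡h) ⟩
      2 * (g * h) + c * g ∎))
    where
    no-excess : ∀ c → c * w ≤ c * g → c ≡ 0
    no-excess zero _ = refl
    no-excess c@(suc _) cw≤cg = ⊥-elim (<⇒≱ (*-monoʳ-< c g<w) cw≤cg)
  ... | suc r , r+g≡h with e ≟ 2 | 3 ≤? a
  ...   | no e≢2   | _       = ⊥-elim (generic r r+g≡h (λ eq → ⊥-elim (e≢2 eq)))
  ...   | yes _    | yes 3≤a = ⊥-elim (generic r r+g≡h (λ _ → 3≤a))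
  ...   | yes refl | no 3≰a  = ⊥-elim (small a 1≤a (≰⇒> 3≰a) (long r r+g≡h) (λ a≡2 → extra a≡2 refl) upper′ below)

-- The bound b₂ cleared of denominators

ℚ-ring : AlmostCommutativeRing 0ℓ 0ℓ
ℚ-ring = fromCommutativeRing ℚ.+-*-commutativeRing (λ x → dec⇒maybe (ℚ.0ℚ ℚ.≟ x))

-- Normalisation blocks computation in `ℚ`. Equations between fractions are therefore proved by
-- cross-multiplication in `ℚᵘ` and transported along `fromℚᵘ`.
fromℚᵘ-+ : ∀ p q → ℚ.fromℚᵘ (p ℚᵘ.+ q) ≡ ℚ.fromℚᵘ p ℚ.+ ℚ.fromℚᵘ q
fromℚᵘ-+ p q = ℚ.toℚᵘ-injective (begin-equality
  ℚ.toℚᵘ (ℚ.fromℚᵘ (p ℚᵘ.+ q))                    ≃⟨ ℚ.toℚᵘ-fromℚᵘ (p ℚᵘ.+ q) ⟩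
  p ℚᵘ.+ q                                        ≃⟨ ℚᵘ.+-cong (ℚᵘ.≃-sym (ℚ.toℚᵘ-fromℚᵘ p)) (ℚᵘ.≃-sym (ℚ.toℚᵘ-fromℚᵘ q)) ⟩
  ℚ.toℚᵘ (ℚ.fromℚᵘ p) ℚᵘ.+ ℚ.toℚᵘ (ℚ.fromℚᵘ q)    ≃⟨ ℚᵘ.≃-sym (ℚ.toℚᵘ-homo-+ (ℚ.fromℚᵘ p) (ℚ.fromℚᵘ q)) ⟩
  ℚ.toℚᵘ (ℚ.fromℚᵘ p ℚ.+ ℚ.fromℚᵘ q)              ∎)
  where open ℚᵘ.≤-Reasoning

fromℚᵘ-* : ∀ p q → ℚ.fromℚᵘ (p ℚᵘ.* q) ≡ ℚ.fromℚᵘ p ℚ.* ℚ.fromℚᵘ q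
fromℚᵘ-* p q = ℚ.toℚᵘ-injective (begin-equality
  ℚ.toℚᵘ (ℚ.fromℚᵘ (p ℚᵘ.* q))                    ≃⟨ ℚ.toℚᵘ-fromℚᵘ (p ℚᵘ.* q) ⟩
  p ℚᵘ.* q                                        ≃⟨ ℚᵘ.*-cong (ℚᵘ.≃-sym (ℚ.toℚᵘ-fromℚᵘ p)) (ℚᵘ.≃-sym (ℚ.toℚᵘ-fromℚᵘ q)) ⟩
  ℚ.toℚᵘ (ℚ.fromℚᵘ p) ℚᵘ.* ℚ.toℚᵘ (ℚ.fromℚᵘ q)    ≃⟨ ℚᵘ.≃-sym (ℚ.toℚᵘ-homo-* (ℚ.fromℚᵘ p) (ℚ.fromℚᵘ q)) ⟩
  ℚ.toℚᵘ (ℚ.fromℚᵘ p ℚ.* ℚ.fromℚᵘ q)              ∎)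
  where open ℚᵘ.≤-Reasoning

fromℕ : ℕ → ℚ.ℚ
fromℕ n = ι (ℤ.+ n)

fromℕ-+ : ∀ m n → fromℕ (m + n) ≡ fromℕ m ℚ.+ fromℕ n
fromℕ-+ m n = trans (ℚ.fromℚᵘ-cong {ℚᵘ.mkℚᵘ (ℤ.+ (m + n)) 0} {ℚᵘ.mkℚᵘ (ℤ.+ m) 0 ℚᵘ.+ ℚᵘ.mkℚᵘ (ℤ.+ n) 0} (ℚᵘ.*≡* eq)) (fromℚᵘ-+ (ℚᵘ.mkℚᵘ (ℤ.+ m) 0) (ℚᵘ.mkℚᵘ (ℤ.+ n) 0))
  where
  eq : ℤ.+ (m + n) ℤ.* ℤ.+ 1 ≡ (ℤ.+ m ℤ.* ℤ.+ 1 ℤ.+ ℤ.+ n ℤ.* ℤ.+ 1) ℤ.* ℤ.+ 1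
  eq = cong (ℤ._* ℤ.+ 1) (trans (ℤ.pos-+ m n) (cong₂ ℤ._+_ (sym (ℤ.*-identityʳ (ℤ.+ m))) (sym (ℤ.*-identityʳ (ℤ.+ n)))))

fromℕ-* : ∀ m n → fromℕ (m * n) ≡ fromℕ m ℚ.* fromℕ n
fromℕ-* m n = trans (ℚ.fromℚᵘ-cong {ℚᵘ.mkℚᵘ (ℤ.+ (m * n)) 0} {ℚᵘ.mkℚᵘ (ℤ.+ m) 0 ℚᵘ.* ℚᵘ.mkℚᵘ (ℤ.+ n) 0} (ℚᵘ.*≡* (cong (ℤ._* ℤ.+ 1) (ℤ.pos-* m n))))
                (fromℚᵘ-* (ℚᵘ.mkℚᵘ (ℤ.+ m) 0) (ℚᵘ.mkℚᵘ (ℤ.+ n) 0))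

fromℕ-cancel-< : ∀ {m n} → fromℕ m ℚ.< fromℕ n → m < n
fromℕ-cancel-< {m} {n} lt = ℤ.drop‿+<+ (subst₂ ℤ._<_ (ℤ.*-identityʳ (ℤ.+ m)) (ℤ.*-identityʳ (ℤ.+ n)) (ℚᵘ.drop-*<*
  (ℚᵘ.<-respˡ-≃ (ℚ.toℚᵘ-fromℚᵘ (ℚᵘ.mkℚᵘ (ℤ.+ m) 0)) (ℚᵘ.<-respʳ-≃ (ℚ.toℚᵘ-fromℚᵘ (ℚᵘ.mkℚᵘ (ℤ.+ n) 0)) (ℚ.toℚᵘ-mono-< lt)))))

frac-cancel : ∀ z m → frac (ℤ.+ z ℤ.* ℤ.+ suc m) (suc m) ≡ fromℕ z
frac-cancel z m = ℚ.fromℚᵘ-cong {ℚᵘ.mkℚᵘ (ℤ.+ z ℤ.* ℤ.+ suc m) m} {ℚᵘ.mkℚᵘ (ℤ.+ z) 0} (ℚᵘ.*≡* (ℤ.*-identityʳ (ℤ.+ z ℤ.* ℤ.+ suc m)))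

*-frac : ∀ p m → fromℕ (suc m) ℚ.* frac (ℤ.+ p) (suc m) ≡ fromℕ p
*-frac p m = trans (sym (fromℚᵘ-* (ℚᵘ.mkℚᵘ (ℤ.+ suc m) 0) (ℚᵘ.mkℚᵘ (ℤ.+ p) m)))
               (ℚ.fromℚᵘ-cong {ℚᵘ.mkℚᵘ (ℤ.+ suc m) 0 ℚᵘ.* ℚᵘ.mkℚᵘ (ℤ.+ p) m} {ℚᵘ.mkℚᵘ (ℤ.+ p) 0} (ℚᵘ.*≡* eq))
  where
  eq : ℤ.+ suc m ℤ.* ℤ.+ p ℤ.* ℤ.+ 1 ≡ ℤ.+ p ℤ.* ℤ.+ (suc (m + 0))
  eq = trans (ℤ.*-identityʳ _) (trans (ℤ.*-comm (ℤ.+ suc m) (ℤ.+ p)) (cong (λ i → ℤ.+ p ℤ.* ℤ.+ suc i) (sym (+-identityʳ m))))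

double-half : ∀ n → frac (ℤ.+ n) 2 ℚ.+ frac (ℤ.+ n) 2 ≡ fromℕ n
double-half n = trans (cong₂ ℚ._+_ (sym (ℚ.*-identityˡ x)) (sym (ℚ.*-identityˡ x))) (trans (sym (ℚ.*-distribʳ-+ x ℚ.1ℚ ℚ.1ℚ)) (*-frac n 1))
  where x = frac (ℤ.+ n) 2

double-mono-< : ∀ {x y} → x ℚ.< y → x ℚ.+ x ℚ.< y ℚ.+ y
double-mono-< lt = ℚ.+-mono-< lt lt

-- Doubling twice clears both halves of x = n / 2 without numerals in ℚ.
negative-at-half : ∀ A B C n → let x = frac (ℤ.+ n) 2 in
  fromℕ A ℚ.* x ℚ.* x ℚ.- fromℕ B ℚ.* x ℚ.+ fromℕ C ℚ.< ℚ.0ℚ → A * (n * n) + 4 * C < 2 * B * n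
negative-at-half A B C n lt = fromℕ-cancel-< (subst₂ ℚ._<_ left right (ℚ.+-monoˡ-< y (double-mono-< (double-mono-< lt))))
  where
  open ℚ.≤-Reasoning
  x = frac (ℤ.+ n) 2
  y = (fromℕ B ℚ.+ fromℕ B) ℚ.* (x ℚ.+ x)
  identity : ∀ a b c x →
    (a ℚ.* x ℚ.* x ℚ.- b ℚ.* x ℚ.+ c ℚ.+ (a ℚ.* x ℚ.* x ℚ.- b ℚ.* x ℚ.+ c))
    ℚ.+ (a ℚ.* x ℚ.* x ℚ.- b ℚ.* x ℚ.+ c ℚ.+ (a ℚ.* x ℚ.* x ℚ.- b ℚ.* x ℚ.+ c))
    ℚ.+ (b ℚ.+ b) ℚ.* (x ℚ.+ x)
    ≡ a ℚ.* ((x ℚ.+ x) ℚ.* (x ℚ.+ x)) ℚ.+ (c ℚ.+ c ℚ.+ (c ℚ.+ c))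
  identity = Solver.solve-∀ ℚ-ring
  fourfold : ∀ C → C + C + (C + C) ≡ 4 * C
  fourfold = solve-∀
  twofold : ∀ B → B + B ≡ 2 * B
  twofold = solve-∀
  left = begin-equality
    _                                                                     ≡⟨ identity (fromℕ A) (fromℕ B) (fromℕ C) x ⟩
    fromℕ A ℚ.* ((x ℚ.+ x) ℚ.* (x ℚ.+ x)) ℚ.+ (fromℕ C ℚ.+ fromℕ C ℚ.+ (fromℕ C ℚ.+ fromℕ C))
                                                                          ≡⟨ cong₂ (λ u w → fromℕ A ℚ.* (u ℚ.* u) ℚ.+ (w ℚ.+ w)) (double-half n) (sym (fromℕ-+ C C)) ⟩
    fromℕ A ℚ.* (fromℕ n ℚ.* fromℕ n) ℚ.+ (fromℕ (C + C) ℚ.+ fromℕ (C + C)) ≡⟨ cong₂ (λ u w → fromℕ A ℚ.* u ℚ.+ w) (sym (fromℕ-* n n)) (sym (fromℕ-+ (C + C) (C + C))) ⟩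
    fromℕ A ℚ.* fromℕ (n * n) ℚ.+ fromℕ (C + C + (C + C))                 ≡⟨ cong₂ ℚ._+_ (sym (fromℕ-* A (n * n))) (cong fromℕ (fourfold C)) ⟩
    fromℕ (A * (n * n)) ℚ.+ fromℕ (4 * C)                                 ≡⟨ sym (fromℕ-+ (A * (n * n)) (4 * C)) ⟩
    fromℕ (A * (n * n) + 4 * C)                                           ∎
  right = begin-equality
    _                               ≡⟨ ℚ.+-identityˡ y ⟩
    y                               ≡⟨ cong₂ ℚ._*_ (trans (sym (fromℕ-+ B B)) (cong fromℕ (twofold B))) (double-half n) ⟩
    fromℕ (2 * B) ℚ.* fromℕ n       ≡⟨ sym (fromℕ-* (2 * B) n) ⟩
    fromℕ (2 * B * n)               ∎

-- The sum of i b^i over i < d. At d + 1 it is the fraction in the even-girth polynomial; it is also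
-- what each cut edge costs in the count of walks.
ρ : ℕ → ℕ → ℕ
ρ b zero    = 0
ρ b (suc d) = ρ b d + d * b ^ d

κ≡σ+ρ : ∀ b d → κ b d ≡ σ b d + ρ b d
κ≡σ+ρ b zero = refl
κ≡σ+ρ b (suc d) = trans (cong (_+ suc d * b ^ d) (κ≡σ+ρ b d)) (regroup (σ b d) (ρ b d) (b ^ d) d)
  where
  regroup : ∀ s r q d → s + r + suc d * q ≡ s + q + (r + d * q)
  regroup = solve-∀

pos-^ : ∀ b d → (ℤ.+ b) ℤ.^ d ≡ ℤ.+ (b ^ d)
pos-^ b zero = refl
pos-^ b (suc d) = trans (cong (ℤ.+ b ℤ.*_) (pos-^ b d)) (sym (ℤ.pos-* b (b ^ d)))

σ-closedℤ : ∀ a d → (ℤ.+ suc a) ℤ.^ d ≡ ℤ.+ a ℤ.* ℤ.+ σ (suc a) d ℤ.+ ℤ.+ 1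
σ-closedℤ a d = trans (pos-^ (suc a) d) (trans (cong ℤ.+_ (sym (σ-closed a d)))
                  (trans (ℤ.pos-+ (a * σ (suc a) d) 1) (cong (ℤ._+ ℤ.+ 1) (ℤ.pos-* a (σ (suc a) d)))))

κ-closedℤ : ∀ a d → ℤ.+ a ℤ.* ℤ.+ a ℤ.* ℤ.+ κ (suc a) d ℤ.+ (ℤ.+ suc a) ℤ.^ d ≡ (ℤ.+ suc a) ℤ.^ d ℤ.* (ℤ.+ d ℤ.* ℤ.+ a) ℤ.+ ℤ.+ 1
κ-closedℤ a d rewrite pos-^ (suc a) d = begin
  ℤ.+ a ℤ.* ℤ.+ a ℤ.* ℤ.+ K ℤ.+ ℤ.+ q       ≡⟨ cong (λ z → z ℤ.* ℤ.+ K ℤ.+ ℤ.+ q) (sym (ℤ.pos-* a a)) ⟩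
  ℤ.+ (a * a) ℤ.* ℤ.+ K ℤ.+ ℤ.+ q           ≡⟨ cong (ℤ._+ ℤ.+ q) (sym (ℤ.pos-* (a * a) K)) ⟩
  ℤ.+ (a * a * K) ℤ.+ ℤ.+ q                 ≡⟨ sym (ℤ.pos-+ (a * a * K) q) ⟩
  ℤ.+ (a * a * K + q)                       ≡⟨ cong ℤ.+_ (κ-closed a d) ⟩
  ℤ.+ (q * (d * a) + 1)                     ≡⟨ ℤ.pos-+ (q * (d * a)) 1 ⟩
  ℤ.+ (q * (d * a)) ℤ.+ ℤ.+ 1               ≡⟨ cong (ℤ._+ ℤ.+ 1) (trans (ℤ.pos-* q (d * a)) (cong (ℤ.+ q ℤ.*_) (ℤ.pos-* d a))) ⟩
  ℤ.+ q ℤ.* (ℤ.+ d ℤ.* ℤ.+ a) ℤ.+ ℤ.+ 1     ∎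
  where
  open ≡-Reasoning
  K = κ (suc a) d
  q = suc a ^ d

k≡a+2 : ∀ a → ℤ.+ suc (suc a) ≡ ℤ.+ a ℤ.+ ℤ.+ 2
k≡a+2 a = cong ℤ.+_ (+-comm 2 a)

moore-odd : ∀ k g → isOdd g ≡ true → Moore k g ≡ frac (ℤ.+ k ℤ.* (ℤ.+ (k ∸ 1)) ℤ.^ dOf g ℤ.- ℤ.+ 2) (k ∸ 2)
moore-odd k g odd rewrite odd | odd = refl

moore-even : ∀ k g → isOdd g ≡ false → Moore k g ≡ frac (ℤ.+ 2 ℤ.* (ℤ.+ (k ∸ 1)) ℤ.^ (dOf g + 1) ℤ.- ℤ.+ 2) (k ∸ 2)
moore-even k g even rewrite even | even = refl

v-odd : ∀ k g s → isOdd g ≡ true → v k g s ≡ Moore k g ℚ.* frac (ℤ.+ 1) 2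
v-odd k g s odd rewrite odd | odd | odd = refl

v-even : ∀ k g s → isOdd g ≡ false → v k g s ≡ Moore k g ℚ.* frac (ℤ.+ 1) 2 ℚ.+ frac (ℤ.+ s) (2 * k)
v-even k g s even rewrite even | even | even = refl

P-odd : ∀ k g s x → isOdd g ≡ true → P k g s x ≡ x ℚ.* x ℚ.- Moore k g ℚ.* x ℚ.+
  frac (ℤ.+ s ℤ.* (ℤ.+ dOf g ℤ.* ℤ.+ k ℤ.- ℤ.+ 2 ℤ.* ℤ.+ dOf g ℤ.- ℤ.+ 1) ℤ.* (ℤ.+ k ℤ.- ℤ.+ 1) ℤ.^ dOf g ℤ.+ ℤ.+ s) ((k ∸ 2) * (k ∸ 2))
P-odd k g s x odd rewrite odd | odd | odd = refl

P-even : ∀ k g s x → isOdd g ≡ false → P k g s x ≡ ι (ℤ.+ k) ℚ.* x ℚ.* x ℚ.- (ι (ℤ.+ k) ℚ.* Moore k g ℚ.+ ι (ℤ.+ s)) ℚ.* x ℚ.+ Moore k g ℚ.* ι (ℤ.+ s)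
  ℚ.+ ι (ℤ.+ 2 ℤ.* ℤ.+ s) ℚ.* frac ((ℤ.+ dOf g ℤ.* ℤ.+ k ℤ.- ℤ.+ 2 ℤ.* ℤ.+ dOf g ℤ.- ℤ.+ 1) ℤ.* (ℤ.+ k ℤ.- ℤ.+ 1) ℤ.^ (dOf g + 1) ℤ.+ ℤ.+ k ℤ.- ℤ.+ 1) ((k ∸ 2) * (k ∸ 2))
P-even k g s x even rewrite even | even | even = refl

module _ (a′ : ℕ) where
  private
    a b k : ℕ
    a = suc a′
    b = suc a
    k = suc b
    A : ℤ.ℤ
    A = ℤ.+ a

  odd-moore : ∀ d → frac (ℤ.+ k ℤ.* (ℤ.+ b) ℤ.^ d ℤ.- ℤ.+ 2) a ≡ fromℕ (1 + k * σ b d)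
  odd-moore d = trans (cong (λ z → frac z a) numerator) (frac-cancel (1 + k * σ b d) a′)
    where
    S = ℤ.+ σ b d
    identity : ∀ A S → (A ℤ.+ ℤ.+ 2) ℤ.* (A ℤ.* S ℤ.+ ℤ.+ 1) ℤ.- ℤ.+ 2 ≡ (ℤ.+ 1 ℤ.+ (A ℤ.+ ℤ.+ 2) ℤ.* S) ℤ.* A
    identity = ℤSolver.solve-∀
    numerator : ℤ.+ k ℤ.* (ℤ.+ b) ℤ.^ d ℤ.- ℤ.+ 2 ≡ ℤ.+ (1 + k * σ b d) ℤ.* A
    numerator = trans (cong₂ (λ u w → u ℤ.* w ℤ.- ℤ.+ 2) (k≡a+2 a) (σ-closedℤ a d)) (trans (identity A S)
      (cong (ℤ._* A) (sym (trans (ℤ.pos-+ 1 (k * σ b d)) (cong (λ z → ℤ.+ 1 ℤ.+ z) (trans (ℤ.pos-* k (σ b d)) (cong (ℤ._* S) (k≡a+2 a))))))))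

  even-moore : ∀ d → frac (ℤ.+ 2 ℤ.* (ℤ.+ b) ℤ.^ d ℤ.- ℤ.+ 2) a ≡ fromℕ (2 * σ b d)
  even-moore d = trans (cong (λ z → frac z a) numerator) (frac-cancel (2 * σ b d) a′)
    where
    S = ℤ.+ σ b d
    identity : ∀ A S → ℤ.+ 2 ℤ.* (A ℤ.* S ℤ.+ ℤ.+ 1) ℤ.- ℤ.+ 2 ≡ (ℤ.+ 2 ℤ.* S) ℤ.* A
    identity = ℤSolver.solve-∀
    numerator : ℤ.+ 2 ℤ.* (ℤ.+ b) ℤ.^ d ℤ.- ℤ.+ 2 ≡ ℤ.+ (2 * σ b d) ℤ.* A
    numerator = trans (cong (λ w → ℤ.+ 2 ℤ.* w ℤ.- ℤ.+ 2) (σ-closedℤ a d)) (trans (identity A S)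
      (cong (ℤ._* A) (sym (ℤ.pos-* 2 (σ b d)))))

  odd-constant : ∀ s d → frac (ℤ.+ s ℤ.* (ℤ.+ d ℤ.* ℤ.+ k ℤ.- ℤ.+ 2 ℤ.* ℤ.+ d ℤ.- ℤ.+ 1) ℤ.* (ℤ.+ b) ℤ.^ d ℤ.+ ℤ.+ s) (a * a) ≡ fromℕ (s * κ b d)
  odd-constant s d = trans (cong (λ z → frac z (a * a)) numerator) (frac-cancel (s * κ b d) (a′ + a′ * a))
    where
    K = ℤ.+ κ b d
    Q = (ℤ.+ b) ℤ.^ d
    i₁ : ∀ S D A Q → S ℤ.* (D ℤ.* (A ℤ.+ ℤ.+ 2) ℤ.- ℤ.+ 2 ℤ.* D ℤ.- ℤ.+ 1) ℤ.* Q ℤ.+ S ≡ S ℤ.* ((Q ℤ.* (D ℤ.* A) ℤ.+ ℤ.+ 1) ℤ.- Q)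
    i₁ = ℤSolver.solve-∀
    i₂ : ∀ S A K Q → S ℤ.* ((A ℤ.* A ℤ.* K ℤ.+ Q) ℤ.- Q) ≡ S ℤ.* K ℤ.* (A ℤ.* A)
    i₂ = ℤSolver.solve-∀
    numerator : ℤ.+ s ℤ.* (ℤ.+ d ℤ.* ℤ.+ k ℤ.- ℤ.+ 2 ℤ.* ℤ.+ d ℤ.- ℤ.+ 1) ℤ.* Q ℤ.+ ℤ.+ s ≡ ℤ.+ (s * κ b d) ℤ.* ℤ.+ (a * a)
    numerator = begin
      ℤ.+ s ℤ.* (ℤ.+ d ℤ.* ℤ.+ k ℤ.- ℤ.+ 2 ℤ.* ℤ.+ d ℤ.- ℤ.+ 1) ℤ.* Q ℤ.+ ℤ.+ s
        ≡⟨ cong (λ z → ℤ.+ s ℤ.* (ℤ.+ d ℤ.* z ℤ.- ℤ.+ 2 ℤ.* ℤ.+ d ℤ.- ℤ.+ 1) ℤ.* Q ℤ.+ ℤ.+ s) (k≡a+2 a) ⟩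
      ℤ.+ s ℤ.* (ℤ.+ d ℤ.* (A ℤ.+ ℤ.+ 2) ℤ.- ℤ.+ 2 ℤ.* ℤ.+ d ℤ.- ℤ.+ 1) ℤ.* Q ℤ.+ ℤ.+ s ≡⟨ i₁ (ℤ.+ s) (ℤ.+ d) A Q ⟩
      ℤ.+ s ℤ.* ((Q ℤ.* (ℤ.+ d ℤ.* A) ℤ.+ ℤ.+ 1) ℤ.- Q)                    ≡⟨ cong (λ z → ℤ.+ s ℤ.* (z ℤ.- Q)) (sym (κ-closedℤ a d)) ⟩
      ℤ.+ s ℤ.* ((A ℤ.* A ℤ.* K ℤ.+ Q) ℤ.- Q)                             ≡⟨ i₂ (ℤ.+ s) A K Q ⟩
      ℤ.+ s ℤ.* K ℤ.* (A ℤ.* A)                                           ≡⟨ cong₂ ℤ._*_ (sym (ℤ.pos-* s (κ b d))) (sym (ℤ.pos-* a a)) ⟩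
      ℤ.+ (s * κ b d) ℤ.* ℤ.+ (a * a)                                     ∎
      where open ≡-Reasoning

  even-constant : ∀ d → frac ((ℤ.+ d ℤ.* ℤ.+ k ℤ.- ℤ.+ 2 ℤ.* ℤ.+ d ℤ.- ℤ.+ 1) ℤ.* (ℤ.+ b) ℤ.^ suc d ℤ.+ ℤ.+ k ℤ.- ℤ.+ 1) (a * a) ≡ fromℕ (ρ b (suc d))
  even-constant d = trans (cong (λ z → frac z (a * a)) numerator) (frac-cancel (ρ b (suc d)) (a′ + a′ * a))
    where
    open ≡-Reasoning
    D = ℤ.+ d
    R = ℤ.+ ρ b (suc d)
    S = ℤ.+ σ b (suc d)
    K = ℤ.+ κ b (suc d)
    Q = (ℤ.+ b) ℤ.^ suc d
    -- The numerator is a^2 κ - a (a σ), both terms in closed form, and ρ = κ - σ.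
    i₁ : ∀ D A Q → (D ℤ.* (A ℤ.+ ℤ.+ 2) ℤ.- ℤ.+ 2 ℤ.* D ℤ.- ℤ.+ 1) ℤ.* Q ℤ.+ (A ℤ.+ ℤ.+ 2) ℤ.- ℤ.+ 1
       ≡ (Q ℤ.* ((ℤ.+ 1 ℤ.+ D) ℤ.* A) ℤ.+ ℤ.+ 1) ℤ.- Q ℤ.- A ℤ.* (Q ℤ.- ℤ.+ 1)
    i₁ = ℤSolver.solve-∀
    i₂ : ∀ A S R Q → (A ℤ.* A ℤ.* (S ℤ.+ R) ℤ.+ Q) ℤ.- Q ℤ.- A ℤ.* (A ℤ.* S ℤ.+ ℤ.+ 1 ℤ.- ℤ.+ 1) ≡ R ℤ.* (A ℤ.* A)
    i₂ = ℤSolver.solve-∀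
    numerator : (D ℤ.* ℤ.+ k ℤ.- ℤ.+ 2 ℤ.* D ℤ.- ℤ.+ 1) ℤ.* Q ℤ.+ ℤ.+ k ℤ.- ℤ.+ 1 ≡ R ℤ.* ℤ.+ (a * a)
    numerator = begin
      (D ℤ.* ℤ.+ k ℤ.- ℤ.+ 2 ℤ.* D ℤ.- ℤ.+ 1) ℤ.* Q ℤ.+ ℤ.+ k ℤ.- ℤ.+ 1
        ≡⟨ cong (λ z → (D ℤ.* z ℤ.- ℤ.+ 2 ℤ.* D ℤ.- ℤ.+ 1) ℤ.* Q ℤ.+ z ℤ.- ℤ.+ 1) (k≡a+2 a) ⟩
      (D ℤ.* (A ℤ.+ ℤ.+ 2) ℤ.- ℤ.+ 2 ℤ.* D ℤ.- ℤ.+ 1) ℤ.* Q ℤ.+ (A ℤ.+ ℤ.+ 2) ℤ.- ℤ.+ 1 ≡⟨ i₁ D A Q ⟩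
      (Q ℤ.* ((ℤ.+ 1 ℤ.+ D) ℤ.* A) ℤ.+ ℤ.+ 1) ℤ.- Q ℤ.- A ℤ.* (Q ℤ.- ℤ.+ 1)   ≡⟨ cong (λ z → z ℤ.- Q ℤ.- A ℤ.* (Q ℤ.- ℤ.+ 1)) (sym (κ-closedℤ a (suc d))) ⟩
      (A ℤ.* A ℤ.* K ℤ.+ Q) ℤ.- Q ℤ.- A ℤ.* (Q ℤ.- ℤ.+ 1)
        ≡⟨ cong₂ (λ u w → (A ℤ.* A ℤ.* u ℤ.+ Q) ℤ.- Q ℤ.- A ℤ.* (w ℤ.- ℤ.+ 1)) (trans (cong ℤ.+_ (κ≡σ+ρ b (suc d))) (ℤ.pos-+ (σ b (suc d)) (ρ b (suc d)))) (σ-closedℤ a (suc d)) ⟩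
      (A ℤ.* A ℤ.* (S ℤ.+ R) ℤ.+ Q) ℤ.- Q ℤ.- A ℤ.* (A ℤ.* S ℤ.+ ℤ.+ 1 ℤ.- ℤ.+ 1) ≡⟨ i₂ A S R Q ⟩
      R ℤ.* (A ℤ.* A)                                                          ≡⟨ cong (R ℤ.*_) (sym (ℤ.pos-* a a)) ⟩
      R ℤ.* ℤ.+ (a * a)                                                        ∎

  odd-below : ∀ g s n → isOdd g ≡ true → LtB₂ k g s (ℤ.+ n ℚ./ 2) → BelowLargerRoot 1 (1 + k * σ b (dOf g)) (s * κ b (dOf g)) n
  odd-below g s n odd (inj₁ x<v) = inj₁ (subst (_< 1 + k * σ b (dOf g)) (sym (*-identityˡ n))
    (fromℕ-cancel-< (subst₂ ℚ._<_ (double-half n) double-v (double-mono-< (subst (frac (ℤ.+ n) 2 ℚ.<_) v≡ x<v)))))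
    where
    M = fromℕ (1 + k * σ b (dOf g))
    v≡ : v k g s ≡ M ℚ.* frac (ℤ.+ 1) 2
    v≡ = trans (v-odd k g s odd) (cong (ℚ._* frac (ℤ.+ 1) 2) (trans (moore-odd k g odd) (odd-moore (dOf g))))
    double-v : M ℚ.* frac (ℤ.+ 1) 2 ℚ.+ M ℚ.* frac (ℤ.+ 1) 2 ≡ M
    double-v = trans (sym (ℚ.*-distribˡ-+ M _ _)) (trans (cong (M ℚ.*_) (double-half 1)) (ℚ.*-identityʳ M))
  odd-below g s n odd (inj₂ p<0) = inj₂ (negative-at-half 1 (1 + k * σ b d) (s * κ b d) n (subst (ℚ._< ℚ.0ℚ) p≡ p<0))
    where
    d = dOf g
    x = frac (ℤ.+ n) 2
    M = fromℕ (1 + k * σ b d)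
    C = fromℕ (s * κ b d)
    p≡ : P k g s x ≡ ℚ.1ℚ ℚ.* x ℚ.* x ℚ.- M ℚ.* x ℚ.+ C
    p≡ = trans (P-odd k g s x odd) (trans
           (cong₂ (λ u w → x ℚ.* x ℚ.- u ℚ.* x ℚ.+ w) (trans (moore-odd k g odd) (odd-moore d)) (odd-constant s d))
           (cong (λ z → z ℚ.* x ℚ.- M ℚ.* x ℚ.+ C) (sym (ℚ.*-identityˡ x))))

  -- For even girth M = 2 σ, so B = k M + s, the vertex B / (2 k) is v = M / 2 + s / (2 k), and the
  -- two constant terms M s and 2 s ρ add up to 2 s κ.
  even-below : ∀ g s n → isOdd g ≡ false → let D = suc (dOf g) in
               LtB₂ k g s (ℤ.+ n ℚ./ 2) → BelowLargerRoot k (2 * (k * σ b D) + s) (2 * (s * κ b D)) n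
  even-below g s n even = below
    where
    open ≡-Reasoning
    D = suc (dOf g)
    S = σ b D
    R = ρ b D
    M = fromℕ (2 * S)
    f = frac (ℤ.+ s) (2 * k)
    half = frac (ℤ.+ 1) 2
    x = frac (ℤ.+ n) 2
    lead = fromℕ k ℚ.* x ℚ.* x
    moore≡ : Moore k g ≡ M
    moore≡ = trans (moore-even k g even) (trans (cong (λ i → frac (ℤ.+ 2 ℤ.* (ℤ.+ b) ℤ.^ i ℤ.- ℤ.+ 2) a) (+-comm (dOf g) 1)) (even-moore D))
    left : fromℕ k ℚ.* (x ℚ.+ x) ≡ fromℕ (k * n)
    left = trans (cong (fromℕ k ℚ.*_) (double-half n)) (sym (fromℕ-* k n))
    identity : ∀ k m h f → k ℚ.* ((m ℚ.* h ℚ.+ f) ℚ.+ (m ℚ.* h ℚ.+ f)) ≡ k ℚ.* (m ℚ.* (h ℚ.+ h)) ℚ.+ (k ℚ.+ k) ℚ.* f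
    identity = Solver.solve-∀ ℚ-ring
    doubled-frac : (fromℕ k ℚ.+ fromℕ k) ℚ.* f ≡ fromℕ s
    doubled-frac = trans (cong (ℚ._* f) (trans (sym (fromℕ-+ k k)) (cong (λ i → fromℕ (k + i)) (sym (+-identityʳ k))))) (*-frac s (suc a + (k + 0)))
    swap : ∀ k S → k * (2 * S) ≡ 2 * (k * S)
    swap = solve-∀
    linear : fromℕ k ℚ.* M ℚ.+ fromℕ s ≡ fromℕ (2 * (k * S) + s)
    linear = trans (cong (ℚ._+ fromℕ s) (trans (sym (fromℕ-* k (2 * S))) (cong fromℕ (swap k S)))) (sym (fromℕ-+ (2 * (k * S)) s))
    right : fromℕ k ℚ.* ((M ℚ.* half ℚ.+ f) ℚ.+ (M ℚ.* half ℚ.+ f)) ≡ fromℕ (2 * (k * S) + s)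
    right = begin
      fromℕ k ℚ.* ((M ℚ.* half ℚ.+ f) ℚ.+ (M ℚ.* half ℚ.+ f))                  ≡⟨ identity (fromℕ k) M half f ⟩
      fromℕ k ℚ.* (M ℚ.* (half ℚ.+ half)) ℚ.+ (fromℕ k ℚ.+ fromℕ k) ℚ.* f      ≡⟨ cong₂ (λ u w → fromℕ k ℚ.* u ℚ.+ w) (trans (cong (M ℚ.*_) (double-half 1)) (ℚ.*-identityʳ M)) doubled-frac ⟩
      fromℕ k ℚ.* M ℚ.+ fromℕ s                                                ≡⟨ linear ⟩
      fromℕ (2 * (k * S) + s)                                                  ∎
    collect : ∀ S s R → 2 * S * s + 2 * s * R ≡ 2 * (s * (S + R))
    collect = solve-∀
    constant : M ℚ.* fromℕ s ℚ.+ ι (ℤ.+ 2 ℤ.* ℤ.+ s) ℚ.* fromℕ R ≡ fromℕ (2 * (s * κ b D))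
    constant = begin
      M ℚ.* fromℕ s ℚ.+ ι (ℤ.+ 2 ℤ.* ℤ.+ s) ℚ.* fromℕ R             ≡⟨ cong (λ z → M ℚ.* fromℕ s ℚ.+ ι z ℚ.* fromℕ R) (sym (ℤ.pos-* 2 s)) ⟩
      M ℚ.* fromℕ s ℚ.+ fromℕ (2 * s) ℚ.* fromℕ R                   ≡⟨ cong₂ ℚ._+_ (sym (fromℕ-* (2 * S) s)) (sym (fromℕ-* (2 * s) R)) ⟩
      fromℕ (2 * S * s) ℚ.+ fromℕ (2 * s * R)                       ≡⟨ sym (fromℕ-+ (2 * S * s) (2 * s * R)) ⟩
      fromℕ (2 * S * s + 2 * s * R)                                 ≡⟨ cong fromℕ (trans (collect S s R) (cong (λ z → 2 * (s * z)) (sym (κ≡σ+ρ b D)))) ⟩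
      fromℕ (2 * (s * κ b D))                                       ∎
    constant≡ : frac ((ℤ.+ dOf g ℤ.* ℤ.+ k ℤ.- ℤ.+ 2 ℤ.* ℤ.+ dOf g ℤ.- ℤ.+ 1) ℤ.* (ℤ.+ b) ℤ.^ (dOf g + 1) ℤ.+ ℤ.+ k ℤ.- ℤ.+ 1) (a * a) ≡ fromℕ R
    constant≡ = trans (cong (λ i → frac ((ℤ.+ dOf g ℤ.* ℤ.+ k ℤ.- ℤ.+ 2 ℤ.* ℤ.+ dOf g ℤ.- ℤ.+ 1) ℤ.* (ℤ.+ b) ℤ.^ i ℤ.+ ℤ.+ k ℤ.- ℤ.+ 1) (a * a)) (+-comm (dOf g) 1)) (even-constant (dOf g))
    p≡ : P k g s x ≡ lead ℚ.- fromℕ (2 * (k * S) + s) ℚ.* x ℚ.+ fromℕ (2 * (s * κ b D))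
    p≡ = begin
      P k g s x
        ≡⟨ P-even k g s x even ⟩
      _ ≡⟨ cong₂ (λ u w → lead ℚ.- (fromℕ k ℚ.* u ℚ.+ fromℕ s) ℚ.* x ℚ.+ u ℚ.* fromℕ s ℚ.+ ι (ℤ.+ 2 ℤ.* ℤ.+ s) ℚ.* w) moore≡ constant≡ ⟩
      lead ℚ.- (fromℕ k ℚ.* M ℚ.+ fromℕ s) ℚ.* x ℚ.+ M ℚ.* fromℕ s ℚ.+ ι (ℤ.+ 2 ℤ.* ℤ.+ s) ℚ.* fromℕ R
        ≡⟨ ℚ.+-assoc (lead ℚ.- (fromℕ k ℚ.* M ℚ.+ fromℕ s) ℚ.* x) (M ℚ.* fromℕ s) (ι (ℤ.+ 2 ℤ.* ℤ.+ s) ℚ.* fromℕ R) ⟩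
      lead ℚ.- (fromℕ k ℚ.* M ℚ.+ fromℕ s) ℚ.* x ℚ.+ (M ℚ.* fromℕ s ℚ.+ ι (ℤ.+ 2 ℤ.* ℤ.+ s) ℚ.* fromℕ R)
        ≡⟨ cong₂ (λ u w → lead ℚ.- u ℚ.* x ℚ.+ w) linear constant ⟩
      lead ℚ.- fromℕ (2 * (k * S) + s) ℚ.* x ℚ.+ fromℕ (2 * (s * κ b D)) ∎
    v≡ : v k g s ≡ M ℚ.* half ℚ.+ f
    v≡ = trans (v-even k g s even) (cong (λ u → u ℚ.* half ℚ.+ f) moore≡)
    below : LtB₂ k g s x → BelowLargerRoot k (2 * (k * S) + s) (2 * (s * κ b D)) n
    -- Doubling and multiplying by k clears the denominator 2 of x and the denominator 2 k in v.
    below (inj₁ x<v) = inj₁ (fromℕ-cancel-< (subst₂ ℚ._<_ left right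
      (ℚ.*-monoʳ-<-pos (fromℕ k) {{ℚ.normalize-pos k 1}} (double-mono-< (subst (x ℚ.<_) v≡ x<v)))))
    below (inj₂ p<0) = inj₂ (negative-at-half k (2 * (k * S) + s) (2 * (s * κ b D)) n (subst (ℚ._< ℚ.0ℚ) p≡ p<0))

-- Non-backtracking walks and cycles

toℕ-next : ∀ {m} (i : Fin (suc m)) → (suc (toℕ i) < suc m × toℕ (next i) ≡ suc (toℕ i)) ⊎ (suc (toℕ i) ≡ suc m × toℕ (next i) ≡ 0)
toℕ-next {m} i with m≤n⇒m<n∨m≡n (toℕ<n i)
... | inj₁ lt = inj₁ (lt , trans (toℕ-fromℕ< (m%n<n (suc (toℕ i)) (suc m))) (m<n⇒m%n≡m lt))
... | inj₂ eq = inj₂ (eq , trans (toℕ-fromℕ< (m%n<n (suc (toℕ i)) (suc m))) (trans (cong (_% suc m) eq) (n%n≡0 (suc m))))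

module Walks {n : ℕ} (A : Fin n → Fin n → Bool) (A-sym : ∀ i j → A i j ≡ A j i) (A-irrefl : ∀ i → A i i ≡ false) where

  open DecMembership {A = Fin n} Fin._≟_ using (_∈?_)
  open DecUnique {A = Fin n} Fin._≟_ using (unique?)

  not-loop : ∀ {x y} → A x y ≡ true → x ≢ y
  not-loop {x} xy refl with A x x | A-irrefl x
  not-loop () refl | .false | refl

  reverse-edge : ∀ {x y} → A x y ≡ true → A y x ≡ true
  reverse-edge {x} {y} xy = trans (A-sym y x) xy

  -- NonBacktracking p x L: the vertices L visited from x, when x was entered from p.
  data NonBacktracking : Fin n → Fin n → List (Fin n) → Set where
    stop : ∀ {p x} → NonBacktracking p x []
    move : ∀ {p x y L} → A x y ≡ true → y ≢ p → NonBacktracking x y L → NonBacktracking p x (y ∷ L)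

  end : Fin n → List (Fin n) → Fin n
  end x []      = x
  end x (y ∷ L) = end y L

  -- `L` is reversed edge by edge: each step moves the base edge ab one place along `L` and puts a
  -- in front of `R`. The result starts at `end b L`, entered from that vertex itself, which forbids
  -- only a loop and so leaves the first step free.
  join : ∀ {a b} L R → A a b ≡ true → NonBacktracking a b L → NonBacktracking b a R →
         ∃ λ W → NonBacktracking (end b L) (end b L) W × end (end b L) W ≡ end a R × length W ≡ suc (length L + length R)
  join {a} {b} [] R ab _ r = a ∷ R , move (reverse-edge ab) (not-loop ab) r , refl , refl
  join {a} {b} (c ∷ L) R ab (move bc c≢a l) r with join L (a ∷ R) bc l (move (reverse-edge ab) (c≢a ∘ sym) r)
  ... | W , walk , end≡ , length≡ = W , walk , end≡ , trans length≡ (cong suc (+-suc (length L) (length R)))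

  private
    nth : Fin n → List (Fin n) → ℕ → Fin n
    nth d []       i       = d
    nth d (y ∷ ys) zero    = y
    nth d (y ∷ ys) (suc i) = nth d ys i

    nth-∈ : ∀ d L i → i < length L → nth d L i ∈ L
    nth-∈ d (y ∷ L) zero    _        = here refl
    nth-∈ d (y ∷ L) (suc i) (s<s lt) = there (nth-∈ d L i lt)

    ∈-≢ : ∀ {y z : Fin n} {L} → All (y ≢_) L → z ∈ L → y ≢ z
    ∈-≢ (y≢ ∷ _)  (here refl) = y≢
    ∈-≢ (_  ∷ ys) (there z∈)  = ∈-≢ ys z∈

    nth-injective : ∀ d L → Unique L → ∀ i j → i < length L → j < length L → nth d L i ≡ nth d L j → i ≡ j
    nth-injective d (y ∷ L) _        zero    zero    _        _        _  = refl
    nth-injective d (y ∷ L) (y∉ ∷ u) zero    (suc j) _        (s<s lj) eq = ⊥-elim (∈-≢ y∉ (nth-∈ d L j lj) eq)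
    nth-injective d (y ∷ L) (y∉ ∷ u) (suc i) zero    (s<s li) _        eq = ⊥-elim (∈-≢ y∉ (nth-∈ d L i li) (sym eq))
    nth-injective d (y ∷ L) (y∉ ∷ u) (suc i) (suc j) (s<s li) (s<s lj) eq = cong suc (nth-injective d L u i j li lj eq)

    nth-edge : ∀ {p x} d L → NonBacktracking p x L → ∀ i → suc i < length L → A (nth d L i) (nth d L (suc i)) ≡ true
    nth-edge d (y ∷ [])    (move _ _ stop)          _       (s≤s ())
    nth-edge d (y ∷ z ∷ L) (move _ _ (move yz _ _)) zero    _        = yz
    nth-edge d (y ∷ z ∷ L) (move _ _ w)             (suc i) (s<s lt) = nth-edge d (z ∷ L) w i lt

    position : ∀ {x : Fin n} {L} → x ∈ L → ∃ λ i → i < length L × (∀ d → nth d L i ≡ x)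
    position (here refl) = 0 , z<s , λ _ → refl
    position (there x∈)  with position x∈
    ... | i , lt , eq = suc i , s<s lt , eq

    -- The return to x closes a cycle. Its position in `L` cannot be 0, because there are no loops,
    -- nor 1, because the walk does not backtrack. The cycle starts at the successor of x and ends
    -- in x, so that its indices are positions in `L`.
    closing : ∀ {p x} L → NonBacktracking p x L → Unique L → x ∈ L → Σ (Cycle n A) λ C → len C ≤ length L
    closing {p} {x} L w u x∈L with position x∈L
    closing {p} {x} (y ∷ L) (move xy _ _) u _ | zero , _ , eq = ⊥-elim (not-loop xy (sym (eq x)))
    closing {p} {x} (y ∷ []) _ u _ | suc _ , s≤s () , _
    closing {p} {x} (y ∷ z ∷ L) (move _ _ (move _ z≢x _)) u _ | suc zero , _ , eq = ⊥-elim (z≢x (eq x))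
    closing {p} {x} ws@(y ∷ z ∷ L) w@(move xy _ _) u _ | suc (suc i) , lt , eq =
      record { m = i ; vtx = vertex ; inj = λ {j} {k} e → toℕ-injective (nth-injective x ws u (toℕ j) (toℕ k) (within j) (within k) e) ; edge = edge′ } , lt
      where
      vertex : Fin (3 + i) → Fin n
      vertex j = nth x ws (toℕ j)
      within : (j : Fin (3 + i)) → toℕ j < length ws
      within j = <-≤-trans (toℕ<n j) lt
      edge′ : ∀ j → A (vertex j) (vertex (next j)) ≡ true
      edge′ j with toℕ-next j
      ... | inj₁ (below , e) = trans (cong (A (vertex j) ∘ nth x ws) e) (nth-edge x ws w (toℕ j) (<-≤-trans below lt))
      ... | inj₂ (last , e)  = trans (cong₂ A (trans (cong (nth x ws) (suc-injective last)) (eq x)) (cong (nth x ws) e)) xy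

  -- Passing to the tail as long as the tail still repeats a vertex leaves a walk whose start recurs
  -- and whose tail is free of repetitions, as `closing` requires.
  repeat-cycle : ∀ {p x} L → NonBacktracking p x L → ¬ Unique (x ∷ L) → Σ (Cycle n A) λ C → len C ≤ length L
  repeat-cycle [] _ dup = ⊥-elim (dup ([] ∷ []))
  repeat-cycle {p} {x} (y ∷ L) w@(move xy _ w′) dup with unique? (y ∷ L) | x ∈? (y ∷ L)
  ... | no dup′ | _      = let C , short = repeat-cycle L w′ dup′ in C , m≤n⇒m≤1+n short
  ... | yes u   | yes x∈ = closing (y ∷ L) w u x∈
  ... | yes u   | no x∉  = ⊥-elim (dup (¬Any⇒All¬ (y ∷ L) x∉ ∷ u))

  end-∈ : ∀ x y L → end x (y ∷ L) ∈ (y ∷ L)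
  end-∈ x y []      = here refl
  end-∈ x y (z ∷ L) = there (end-∈ y z L)

  closed-cycle : ∀ {p x} L → NonBacktracking p x L → 0 < length L → end x L ≡ x → Σ (Cycle n A) λ C → len C ≤ length L
  closed-cycle {p} {x} (y ∷ L) w _ eq = repeat-cycle (y ∷ L) w λ { (x∉ ∷ _) → ∈-≢ x∉ (end-∈ x y L) (sym eq) }

  -- `L` backwards, then the edge ba, then `R` form a closed non-backtracking walk, which contains a
  -- cycle no longer than itself.
  two-walks-cycle : ∀ {a b} L R → A a b ≡ true → NonBacktracking a b L → NonBacktracking b a R → end b L ≡ end a R →
                    Σ (Cycle n A) λ C → len C ≤ suc (length L + length R)
  two-walks-cycle L R ab l r eq with join L R ab l r
  ... | W , walk , end≡ , length≡ with closed-cycle W walk (subst (0 <_) (sym length≡) z<s) (trans end≡ (sym eq))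
  ...   | C , short = C , subst (len C ≤_) length≡ short

-- Counting non-backtracking walks

sum-mono-≤ : ∀ {n} {f g : Fin n → ℕ} → (∀ i → f i ≤ g i) → sum f ≤ sum g
sum-mono-≤ {zero}  f≤g = z≤n
sum-mono-≤ {suc n} f≤g = +-mono-≤ (f≤g zero) (sum-mono-≤ (f≤g ∘ suc))

-- The source of all rigidity below: cubic degrees, a spanning cycle and an exact cut are each read
-- off from an equality of sums.
sum-≡⇒≗ : ∀ {n} {f g : Fin n → ℕ} → (∀ i → f i ≤ g i) → sum g ≤ sum f → ∀ i → f i ≡ g i
sum-≡⇒≗ {suc n} {f} {g} f≤g sum≥ zero = ≤-antisym (f≤g zero) (+-cancelʳ-≤ (sum (g ∘ suc)) _ _ (≤-trans sum≥ (+-monoʳ-≤ (f zero) (sum-mono-≤ (f≤g ∘ suc)))))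
sum-≡⇒≗ {suc n} {f} {g} f≤g sum≥ (suc i) = sum-≡⇒≗ (f≤g ∘ suc) (+-cancelˡ-≤ (g zero) _ _ (≤-trans sum≥ (+-monoˡ-≤ (sum (f ∘ suc)) (f≤g zero)))) i

term-≤-sum : ∀ {n} (f : Fin n → ℕ) i → f i ≤ sum f
term-≤-sum f zero    = m≤m+n (f zero) (sum (f ∘ suc))
term-≤-sum f (suc i) = ≤-trans (term-≤-sum (f ∘ suc) i) (m≤n+m (sum (f ∘ suc)) (f zero))

sum-positive : ∀ {n} (f : Fin n → ℕ) → 0 < sum f → ∃ λ i → 0 < f i
sum-positive {suc n} f pos with f zero in eq
... | suc _ = zero , subst (0 <_) (sym eq) z<s
... | zero with sum-positive (f ∘ suc) pos
...   | i , fi = suc i , fi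

sum-zero : ∀ {n} (f : Fin n → ℕ) → (∀ i → f i ≡ 0) → sum f ≡ 0
sum-zero {n} f f≡0 = trans (sum-cong-≗ f≡0) (sum-replicate-zero n)

sum-≤1 : ∀ {n} (f : Fin n → ℕ) → (∀ i → f i ≤ 1) → (∀ i j → 0 < f i → 0 < f j → i ≡ j) → sum f ≤ 1
sum-≤1 {zero}  f _ _ = z≤n
sum-≤1 {suc n} f f≤1 unique with f zero in eq
... | zero  = sum-≤1 (f ∘ suc) (f≤1 ∘ suc) (λ i j fi fj → Fin.suc-injective (unique (suc i) (suc j) fi fj))
... | suc a = subst (_≤ 1) (sym (trans (cong (suc a +_) rest≡0) (trans (+-identityʳ (suc a)) (sym eq)))) (f≤1 zero)
  where
  vanish : ∀ i → f (suc i) ≡ 0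
  vanish i with f (suc i) in eqi
  ... | zero  = refl
  ... | suc _ with () ← unique zero (suc i) (subst (0 <_) (sym eq) z<s) (subst (0 <_) (sym eqi) z<s)
  rest≡0 : sum (f ∘ suc) ≡ 0
  rest≡0 = sum-zero (f ∘ suc) vanish

𝟙 : ∀ {n} → Fin n → Fin n → ℕ
𝟙 x y = b2n (does (x Fin.≟ y))

sum-𝟙 : ∀ {n} (f : Fin n → ℕ) p → sum (λ y → f y * 𝟙 y p) ≡ f p
sum-𝟙 {suc n} f zero    = trans (cong₂ _+_ (*-identityʳ (f zero)) (sum-zero _ (λ y → *-zeroʳ (f (suc y))))) (+-identityʳ (f zero))
sum-𝟙 {suc n} f (suc p) = trans (cong (_+ sum (λ y → f (suc y) * 𝟙 y p)) (*-zeroʳ (f zero))) (sum-𝟙 (f ∘ suc) p)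

𝟙-sym : ∀ {n} (x y : Fin n) → 𝟙 x y ≡ 𝟙 y x
𝟙-sym x y with x Fin.≟ y | y Fin.≟ x
... | yes _  | yes _  = refl
... | no _   | no _   = refl
... | yes eq | no ne  = ⊥-elim (ne (sym eq))
... | no ne  | yes eq = ⊥-elim (ne (sym eq))

b2n-≤1 : ∀ c → b2n c ≤ 1
b2n-≤1 true  = ≤-refl
b2n-≤1 false = z≤n

b2n-positive : ∀ {c} → 0 < b2n c → c ≡ true
b2n-positive {true} _ = refl

≤-b2n : ∀ {m c} → m ≤ 1 → (0 < m → c ≡ true) → m ≤ b2n c
≤-b2n {zero}  _    _ = z≤n
≤-b2n {suc m} m≤1 c≡ = subst (λ c → suc m ≤ b2n c) (sym (c≡ z<s)) m≤1

*-positive : ∀ {a b} → 0 < a * b → 0 < a × 0 < b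
*-positive {suc a} {suc b} _ = z<s , z<s
*-positive {suc a} {zero} pos with () ← subst (0 <_) (*-zeroʳ a) pos

-- The induced subgraph stays on `Fin n`, with `A` vanishing outside `S`, so that a side of the cut
-- need not be renumbered.
module Counting {n : ℕ} (A : Fin n → Fin n → Bool) (A-sym : ∀ i j → A i j ≡ A j i) (A-irrefl : ∀ i → A i i ≡ false)
                (S : Fin n → Bool) (A⊆S : ∀ {i j} → A i j ≡ true → S i ≡ true)
                (g : ℕ) (girth : (C : Cycle n A) → g ≤ len C) where

  open Walks A A-sym A-irrefl

  α : Fin n → Fin n → ℕ
  α x y = b2n (A x y)

  χ : Fin n → ℕ
  χ x = b2n (S x)

  h : ℕ
  h = sum χ

  deg : Fin n → ℕ
  deg x = sum (α x)

  β : Fin n → Fin n → Fin n → ℕ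
  β p x y = b2n (A x y ∧ not (does (y Fin.≟ p)))

  -- T j p x and t j p x count the non-backtracking walks of length at most j, resp. exactly j, from x entered from p;
  -- reach j p x z counts those of length at most j that end at z.
  t T : ℕ → Fin n → Fin n → ℕ
  t zero    p x = 1
  t (suc j) p x = sum (λ y → β p x y * t j x y)
  T zero    p x = 1
  T (suc j) p x = 1 + sum (λ y → β p x y * T j x y)

  reach : ℕ → Fin n → Fin n → Fin n → ℕ
  reach zero    p x z = 𝟙 x z
  reach (suc j) p x z = 𝟙 x z + sum (λ y → β p x y * reach j x y z)

  β-positive : ∀ {p x y} → 0 < β p x y → A x y ≡ true × y ≢ p
  β-positive {p} {x} {y} pos with A x y | y Fin.≟ p
  ... | true | no ne = refl , ne

  omit-sum : ∀ p x (f : Fin n → ℕ) → sum (λ y → β p x y * f y) + α x p * f p ≡ sum (λ y → α x y * f y)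
  omit-sum p x f = begin
    sum (λ y → β p x y * f y) + α x p * f p                              ≡⟨ cong (sum (λ y → β p x y * f y) +_) (sym (sum-𝟙 (λ y → α x y * f y) p)) ⟩
    sum (λ y → β p x y * f y) + sum (λ y → α x y * f y * 𝟙 y p)          ≡⟨ sym (∑-distrib-+ (λ y → β p x y * f y) (λ y → α x y * f y * 𝟙 y p)) ⟩
    sum (λ y → β p x y * f y + α x y * f y * 𝟙 y p)                      ≡⟨ sum-cong-≗ split ⟩
    sum (λ y → α x y * f y)                                              ∎
    where
    open ≡-Reasoning
    split : ∀ y → β p x y * f y + α x y * f y * 𝟙 y p ≡ α x y * f y
    split y with A x y | does (y Fin.≟ p)
    ... | true  | true  = *-identityʳ (1 * f y)
    ... | true  | false = trans (cong (1 * f y +_) (*-zeroʳ (1 * f y))) (+-identityʳ (1 * f y))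
    ... | false | _     = refl

  T-step : ∀ j p x → T (suc j) p x ≡ T j p x + t (suc j) p x
  T-step zero    p x = refl
  T-step (suc j) p x = cong suc (begin
    sum (λ y → β p x y * T (suc j) x y)                                  ≡⟨ sum-cong-≗ (λ y → trans (cong (β p x y *_) (T-step j x y)) (*-distribˡ-+ (β p x y) (T j x y) (t (suc j) x y))) ⟩
    sum (λ y → β p x y * T j x y + β p x y * t (suc j) x y)              ≡⟨ ∑-distrib-+ (λ y → β p x y * T j x y) _ ⟩
    sum (λ y → β p x y * T j x y) + sum (λ y → β p x y * t (suc j) x y)  ∎)
    where open ≡-Reasoning

  sum-𝟙ˡ : ∀ (x : Fin n) → sum (𝟙 x) ≡ 1
  sum-𝟙ˡ x = trans (sum-cong-≗ (λ z → trans (𝟙-sym x z) (sym (*-identityˡ (𝟙 z x))))) (sum-𝟙 (λ _ → 1) x)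

  sum-reach : ∀ j p x → sum (reach j p x) ≡ T j p x
  sum-reach zero    p x = sum-𝟙ˡ x
  sum-reach (suc j) p x = begin
    sum (λ z → 𝟙 x z + sum (λ y → β p x y * reach j x y z))       ≡⟨ ∑-distrib-+ (𝟙 x) _ ⟩
    sum (𝟙 x) + sum (λ z → sum (λ y → β p x y * reach j x y z))   ≡⟨ cong₂ _+_ (sum-𝟙ˡ x) (∑-comm (λ z y → β p x y * reach j x y z)) ⟩
    1 + sum (λ y → sum (λ z → β p x y * reach j x y z))           ≡⟨ cong suc (sum-cong-≗ (λ y → trans (sym (*-distribˡ-sum (β p x y) (reach j x y))) (cong (β p x y *_) (sum-reach j x y)))) ⟩
    1 + sum (λ y → β p x y * T j x y)                             ∎
    where open ≡-Reasoning

  reach-walk : ∀ j p x z → 0 < reach j p x z → ∃ λ L → NonBacktracking p x L × length L ≤ j × end x L ≡ z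
  reach-walk zero p x z pos with x Fin.≟ z
  ... | yes x≡z = [] , stop , z≤n , x≡z
  reach-walk (suc j) p x z pos with x Fin.≟ z
  ... | yes x≡z = [] , stop , z≤n , x≡z
  ... | no _ with sum-positive (λ y → β p x y * reach j x y z) pos
  ...   | y , term>0 with *-positive {β p x y} term>0
  ...     | β>0 , r>0 with β-positive {p} β>0 | reach-walk j x y z r>0
  ...       | xy , y≢p | L , w , short , e = y ∷ L , move xy y≢p w , s≤s short , e

  no-short-cycle : ∀ {l} → l < g → ¬ (Σ (Cycle n A) λ C → len C ≤ l)
  no-short-cycle l<g (C , short) = <⇒≱ l<g (≤-trans (girth C) short)

  -- Two walks of length at most j from x to z part somewhere and then close a cycle of length at
  -- most 2 j < g. The recursion finds the place: either z = x and a nonempty walk returns, or two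
  -- first steps differ.
  reach-≤1 : ∀ j p x z → 2 * j < g → reach j p x z ≤ 1
  reach-≤1 zero    p x z _ = b2n-≤1 (does (x Fin.≟ z))
  reach-≤1 (suc j) p x z 2j<g with x Fin.≟ z
  ... | yes refl = ≤-reflexive (cong suc (n≤0⇒n≡0 (≮⇒≥ λ pos → closed (sum-positive (λ y → β p x y * reach j x y x) pos))))
    where
    closed : (∃ λ y → 0 < β p x y * reach j x y x) → ⊥
    closed (y , term>0) with *-positive {β p x y} term>0
    ... | β>0 , r>0 with β-positive {p} β>0 | reach-walk j x y x r>0
    ...   | xy , y≢p | L , w , short , e = no-short-cycle 2j<g (let C , le = closed-cycle (y ∷ L) (move xy y≢p w) z<s e
                                                              in C , ≤-trans le (≤-trans (s≤s short) (m≤m+n (suc j) _)))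
  ... | no _ = sum-≤1 _ each unique
    where
    2j<g′ : 2 * j < g
    2j<g′ = ≤-<-trans (*-monoʳ-≤ 2 (n≤1+n j)) 2j<g
    each : ∀ y → β p x y * reach j x y z ≤ 1
    each y = *-mono-≤ (b2n-≤1 (A x y ∧ not (does (y Fin.≟ p)))) (reach-≤1 j x y z 2j<g′)
    unique : ∀ y y′ → 0 < β p x y * reach j x y z → 0 < β p x y′ * reach j x y′ z → y ≡ y′
    unique y y′ pos pos′ with y Fin.≟ y′
    ... | yes eq = eq
    ... | no ne with *-positive {β p x y} pos | *-positive {β p x y′} pos′
    ...   | β>0 , r>0 | β′>0 , r′>0 with β-positive {p} β>0 | reach-walk j x y z r>0 | β-positive {p} β′>0 | reach-walk j x y′ z r′>0
    ...     | xy , _ | L , w , short , e | xy′ , _ | L′ , w′ , short′ , e′ = ⊥-elim (no-short-cycle 2j<g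
              (let C , le = two-walks-cycle L (y′ ∷ L′) xy w (move xy′ (ne ∘ sym) w′) (trans e (sym e′))
               in C , ≤-trans le (≤-trans (s≤s (+-mono-≤ short (s≤s short′))) (≤-reflexive (cong (λ i → suc (j + i)) (sym (+-identityʳ (suc j))))))))

  -- If walks leading away from the edge uv at both of its ends reached z, they would close a cycle
  -- of length at most 2 j + 1 through that edge.
  reach-pair-≤1 : ∀ j u v z → A u v ≡ true → suc (2 * j) < g → reach j u v z + reach j v u z ≤ 1
  reach-pair-≤1 j u v z uv 2j+1<g with reach j u v z in eq | reach j v u z in eq′ | reach-≤1 j u v z (<-trans (n<1+n _) 2j+1<g) | reach-≤1 j v u z (<-trans (n<1+n _) 2j+1<g)
  ... | zero  | _     | _   | le′ = le′
  ... | suc a | zero  | le  | _   = subst (_≤ 1) (sym (+-identityʳ (suc a))) le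
  ... | suc _ | suc _ | _   | _ with reach-walk j u v z (subst (0 <_) (sym eq) z<s) | reach-walk j v u z (subst (0 <_) (sym eq′) z<s)
  ...   | L , w , short , e | R , r , short′ , e′ = ⊥-elim (no-short-cycle 2j+1<g
            (let C , le = two-walks-cycle L R uv w r (trans e (sym e′))
             in C , ≤-trans le (s≤s (≤-trans (+-mono-≤ short short′) (≤-reflexive (cong (j +_) (sym (+-identityʳ j))))))))

  walk-in-S : ∀ {p x} L → S x ≡ true → NonBacktracking p x L → S (end x L) ≡ true
  walk-in-S []      x∈S stop          = x∈S
  walk-in-S (y ∷ L) x∈S (move xy _ w) = walk-in-S L (A⊆S (reverse-edge xy)) w

  reach-in-S : ∀ j p x z → S x ≡ true → 0 < reach j p x z → S z ≡ true
  reach-in-S j p x z x∈S pos with reach-walk j p x z pos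
  ... | L , w , _ , e = subst (λ z → S z ≡ true) e (walk-in-S L x∈S w)

  T-≤-order : ∀ j p x → S x ≡ true → 2 * j < g → T j p x ≤ h
  T-≤-order j p x x∈S 2j<g = subst (_≤ h) (sum-reach j p x) (sum-mono-≤ (λ z → ≤-b2n (reach-≤1 j p x z 2j<g) (reach-in-S j p x z x∈S)))

  T-pair-≤-order : ∀ j u v → A u v ≡ true → suc (2 * j) < g → T j u v + T j v u ≤ h
  T-pair-≤-order j u v uv 2j+1<g = subst (_≤ h) (trans (∑-distrib-+ (reach j u v) (reach j v u)) (cong₂ _+_ (sum-reach j u v) (sum-reach j v u)))
    (sum-mono-≤ (λ z → ≤-b2n (reach-pair-≤1 j u v z uv 2j+1<g) (in-S z)))
    where
    in-S : ∀ z → 0 < reach j u v z + reach j v u z → S z ≡ true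
    in-S z pos with reach j u v z in eq
    ... | suc _ = reach-in-S j u v z (A⊆S (reverse-edge uv)) (subst (0 <_) (sym eq) z<s)
    ... | zero  = reach-in-S j v u z (A⊆S uv) pos

  τ : ℕ → Fin n → ℕ
  τ i y = sum (λ z → α y z * t i y z)

  -- `Θ j` is Φ 0 + ... + Φ j, written with `T` because the ball bounds control all lengths at once.
  Φ Θ : ℕ → ℕ
  Φ i = sum (τ i)
  Θ j = sum (λ x → sum (λ y → α x y * T j x y))

  Θ-suc : ∀ j → Θ (suc j) ≡ Θ j + Φ (suc j)
  Θ-suc j = trans (sum-cong-≗ (λ x → trans (sum-cong-≗ (λ y → trans (cong (α x y *_) (T-step j x y)) (*-distribˡ-+ (α x y) (T j x y) (t (suc j) x y)))) (∑-distrib-+ (λ y → α x y * T j x y) _)))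
                  (∑-distrib-+ (λ x → sum (λ y → α x y * T j x y)) (τ (suc j)))

  -- A start has no predecessor, so it is entered from itself: `β x x` forbids only the loop, and
  -- `T (suc j) x x` counts all walks of length at most j + 1 from x, whose ends are distinct
  -- vertices of S.
  vertex-ball-bound : ∀ j → 2 * suc j < g → h + Θ j ≤ h * h
  vertex-ball-bound j 2j<g = begin
    h + Θ j                                                      ≡⟨ sym (∑-distrib-+ χ _) ⟩
    sum (λ x → χ x + sum (λ y → α x y * T j x y))                ≤⟨ sum-mono-≤ ball ⟩
    sum (λ x → χ x * h)                                          ≡⟨ sym (*-distribʳ-sum h χ) ⟩
    h * h                                                        ∎
    where
    open ≤-Reasoning
    ball : ∀ x → χ x + sum (λ y → α x y * T j x y) ≤ χ x * h
    ball x with S x in eq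
    ... | true = subst₂ _≤_ (cong suc (trans (sym (+-identityʳ _)) (trans (cong (sum (λ y → β x x y * T j x y) +_) (sym loop)) (omit-sum x x (T j x))))) (sym (+-identityʳ h)) (T-≤-order (suc j) x x eq 2j<g)
      where
      loop : α x x * T j x x ≡ 0
      loop = cong (λ c → b2n c * T j x x) (A-irrefl x)
    ... | false = ≤-reflexive (sum-zero _ outside)
      where
      outside : ∀ y → α x y * T j x y ≡ 0
      outside y with A x y in xy
      ... | false = refl
      ... | true with () ← trans (sym eq) (A⊆S xy)

  -- Walks leading away from an edge at its two ends reach disjoint parts of S. Summed over all
  -- arcs, of which there are `Φ 0`, this counts every walk twice, once for each orientation.
  edge-ball-bound : ∀ j → suc (2 * j) < g → 2 * Θ j ≤ Φ 0 * h
  edge-ball-bound j 2j+1<g = begin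
    2 * Θ j                                                                       ≡⟨ cong (Θ j +_) (+-identityʳ (Θ j)) ⟩
    Θ j + Θ j                                                                     ≡⟨ cong (Θ j +_) (∑-comm (λ x y → α x y * T j x y)) ⟩
    Θ j + sum (λ x → sum (λ y → α y x * T j y x))                                 ≡⟨ sym (∑-distrib-+ (λ x → sum (λ y → α x y * T j x y)) _) ⟩
    sum (λ x → sum (λ y → α x y * T j x y) + sum (λ y → α y x * T j y x))         ≡⟨ sum-cong-≗ (λ x → sym (∑-distrib-+ (λ y → α x y * T j x y) _)) ⟩
    sum (λ x → sum (λ y → α x y * T j x y + α y x * T j y x))                     ≤⟨ sum-mono-≤ (λ x → sum-mono-≤ (pair x)) ⟩
    sum (λ x → sum (λ y → α x y * 1 * h))                                         ≡⟨ sum-cong-≗ (λ x → sym (*-distribʳ-sum h (λ y → α x y * 1))) ⟩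
    sum (λ x → τ 0 x * h)                                                         ≡⟨ sym (*-distribʳ-sum h (τ 0)) ⟩
    Φ 0 * h                                                                       ∎
    where
    open ≤-Reasoning
    pair : ∀ x y → α x y * T j x y + α y x * T j y x ≤ α x y * 1 * h
    pair x y rewrite A-sym y x with A x y in xy
    ... | false = z≤n
    ... | true  = subst₂ _≤_ (sym (cong₂ _+_ (+-identityʳ (T j x y)) (+-identityʳ (T j y x)))) (sym (+-identityʳ h)) (T-pair-≤-order j x y xy 2j+1<g)

-- Growth of the walk counts

module Growth {n : ℕ} (A : Fin n → Fin n → Bool) (A-sym : ∀ i j → A i j ≡ A j i) (A-irrefl : ∀ i → A i i ≡ false)
              (S : Fin n → Bool) (A⊆S : ∀ {i j} → A i j ≡ true → S i ≡ true)
              (g : ℕ) (girth : (C : Cycle n A) → g ≤ len C)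
              (2≤deg : ∀ x → S x ≡ true → 2 ≤ sum (λ y → b2n (A x y)))
              (b : ℕ) (δ : Fin n → ℕ) (deg+δ : ∀ x → sum (λ y → b2n (A x y)) + δ x ≡ suc b * b2n (S x)) where

  open Counting A A-sym A-irrefl S A⊆S g girth public

  -- An edge xy followed by a walk from y is non-backtracking unless the walk starts towards x. Each
  -- walk from y has deg y such prefixes, exactly one of which backtracks.
  Φ-step : ∀ i → Φ (suc i) + Φ i ≡ sum (λ y → deg y * τ i y)
  Φ-step i = begin
    Φ (suc i) + Φ i                                                          ≡⟨ cong (_+ Φ i) (∑-comm (λ x y → α x y * t (suc i) x y)) ⟩
    sum (λ y → sum (λ x → α x y * t (suc i) x y)) + Φ i                      ≡⟨ sym (∑-distrib-+ (λ y → sum (λ x → α x y * t (suc i) x y)) (τ i)) ⟩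
    sum (λ y → sum (λ x → α x y * t (suc i) x y) + τ i y)                    ≡⟨ sum-cong-≗ (λ y → sym (∑-distrib-+ (λ x → α x y * t (suc i) x y) (λ x → α y x * t i y x))) ⟩
    sum (λ y → sum (λ x → α x y * t (suc i) x y + α y x * t i y x))          ≡⟨ sum-cong-≗ (λ y → sum-cong-≗ (λ x → extend x y)) ⟩
    sum (λ y → sum (λ x → α y x * τ i y))                                    ≡⟨ sum-cong-≗ (λ y → sym (*-distribʳ-sum (τ i y) (α y))) ⟩
    sum (λ y → deg y * τ i y)                                                ∎
    where
    open ≡-Reasoning
    extend : ∀ x y → α x y * t (suc i) x y + α y x * t i y x ≡ α y x * τ i y
    extend x y with omit-sum x y (t i y)
    ... | eq rewrite A-sym x y with A y x
    ...   | false = refl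
    ...   | true  = trans (cong₂ _+_ (+-identityʳ (t (suc i) x y)) refl) (trans eq (sym (+-identityʳ (τ i y))))

  outside-α : ∀ {x} y → S x ≡ false → α x y ≡ 0
  outside-α {x} y x∉S with A x y in xy
  ... | false = refl
  ... | true with () ← trans (sym x∉S) (A⊆S xy)

  outside-deg : ∀ {x} → S x ≡ false → deg x ≡ 0
  outside-deg {x} x∉S = sum-zero (α x) (λ y → outside-α y x∉S)

  outside-τ : ∀ i {x} → S x ≡ false → τ i x ≡ 0
  outside-τ i {x} x∉S = sum-zero _ (λ y → cong (_* t i x y) (outside-α y x∉S))

  deg-pred : ∀ y z → A y z ≡ true → sum (β y z) + 1 ≡ deg z
  deg-pred y z yz = begin
    sum (β y z) + 1                              ≡⟨ cong₂ _+_ (sum-cong-≗ (λ w → sym (*-identityʳ (β y z w)))) (sym (cong (λ c → b2n c * 1) (reverse-edge yz))) ⟩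
    sum (λ w → β y z w * 1) + α z y * 1          ≡⟨ omit-sum y z (λ _ → 1) ⟩
    sum (λ w → α z w * 1)                        ≡⟨ sum-cong-≗ (λ w → *-identityʳ (α z w)) ⟩
    deg z                                        ∎
    where
    open ≡-Reasoning
    open Walks A A-sym A-irrefl using (reverse-edge)

  open Walks A A-sym A-irrefl using (reverse-edge)

  -- Minimum degree 2 leaves at every vertex a way out other than the way in, so a walk never gets
  -- stuck.
  t-positive : ∀ i y z → A y z ≡ true → 1 ≤ t i y z
  t-positive zero    y z yz = ≤-refl
  t-positive (suc i) y z yz = ≤-trans (+-cancelʳ-≤ 1 1 (sum (β y z)) (≤-trans (2≤deg z (A⊆S (reverse-edge yz))) (≤-reflexive (sym (deg-pred y z yz)))))
                                      (sum-mono-≤ term)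
    where
    term : ∀ w → β y z w ≤ β y z w * t i z w
    term w with 0 <? β y z w
    ... | no  β≡0 = ≤-trans (≮⇒≥ β≡0) z≤n
    ... | yes β>0 = ≤-trans (≤-reflexive (sym (*-identityʳ (β y z w)))) (*-monoʳ-≤ (β y z w) (t-positive i z w (proj₁ (β-positive {y} β>0))))

  deg≤τ : ∀ i y → deg y ≤ τ i y
  deg≤τ i y = sum-mono-≤ term
    where
    term : ∀ z → α y z ≤ α y z * t i y z
    term z with A y z in yz
    ... | false = z≤n
    ... | true  = ≤-trans (t-positive i y z yz) (m≤m+n _ 0)

  excess : Fin n → ℕ
  excess y = deg y ∸ 2

  -- `c` counts the arcs beyond those of a 2-regular graph on S; `E` is the guaranteed gain from
  -- `Φ i` to `Φ (suc i)`.
  c E s : ℕ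
  c = sum excess
  E = sum (λ y → excess y * deg y)
  s = sum δ

  deg≡ : ∀ y → 2 * χ y + excess y ≡ deg y
  deg≡ y with S y in eq
  ... | true  = m+[n∸m]≡n (2≤deg y eq)
  ... | false = trans (cong (_∸ 2) (outside-deg eq)) (sym (outside-deg eq))

  sum-deg : sum deg ≡ 2 * h + c
  sum-deg = begin
    sum deg                                ≡⟨ sum-cong-≗ (λ y → sym (deg≡ y)) ⟩
    sum (λ y → 2 * χ y + excess y)         ≡⟨ ∑-distrib-+ (λ y → 2 * χ y) excess ⟩
    sum (λ y → 2 * χ y) + c                ≡⟨ cong (_+ c) (sym (*-distribˡ-sum 2 χ)) ⟩
    2 * h + c                              ∎
    where open ≡-Reasoning

  Φ₀≡ : Φ 0 ≡ 2 * h + c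
  Φ₀≡ = trans (sum-cong-≗ (λ y → sum-cong-≗ (λ z → *-identityʳ (α y z)))) sum-deg

  sum-deg+cut : sum deg + s ≡ suc b * h
  sum-deg+cut = begin
    sum deg + s                       ≡⟨ sym (∑-distrib-+ deg δ) ⟩
    sum (λ x → deg x + δ x)           ≡⟨ sum-cong-≗ deg+δ ⟩
    sum (λ x → suc b * χ x)           ≡⟨ sym (*-distribˡ-sum (suc b) χ) ⟩
    suc b * h                         ∎
    where open ≡-Reasoning

  -- A vertex with positive excess has degree at least 3.
  3c≤E : 3 * c ≤ E
  3c≤E = ≤-trans (≤-reflexive (*-distribˡ-sum 3 excess)) (sum-mono-≤ term)
    where
    term : ∀ y → 3 * excess y ≤ excess y * deg y
    term y with deg y
    ... | zero              = z≤n
    ... | suc zero          = z≤n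
    ... | suc (suc zero)    = z≤n
    ... | suc (suc (suc d)) = ≤-trans (≤-reflexive (*-comm 3 (suc d))) (*-monoʳ-≤ (suc d) (s≤s (s≤s (s≤s z≤n))))

  -- At least deg y non-backtracking walks of each length end at y, so at least (deg y - 2) deg y more of them extend than are lost.
  Φ-growth : ∀ i → Φ i + E ≤ Φ (suc i)
  Φ-growth i = +-cancelʳ-≤ (Φ i) _ _ (begin
    Φ i + E + Φ i                                          ≡⟨ rotate (Φ i) E ⟩
    2 * Φ i + E                                            ≡⟨ cong (_+ E) (*-distribˡ-sum 2 (τ i)) ⟩
    sum (λ y → 2 * τ i y) + E                              ≡⟨ sym (∑-distrib-+ (λ y → 2 * τ i y) _) ⟩
    sum (λ y → 2 * τ i y + excess y * deg y)               ≤⟨ sum-mono-≤ term ⟩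
    sum (λ y → deg y * τ i y)                              ≡⟨ sym (Φ-step i) ⟩
    Φ (suc i) + Φ i                                        ∎)
    where
    open ≤-Reasoning
    rotate : ∀ x y → x + y + x ≡ 2 * x + y
    rotate = solve-∀
    term : ∀ y → 2 * τ i y + excess y * deg y ≤ deg y * τ i y
    term y with S y in eq
    ... | true  = begin
      2 * τ i y + excess y * deg y    ≤⟨ +-monoʳ-≤ (2 * τ i y) (*-monoʳ-≤ (excess y) (deg≤τ i y)) ⟩
      2 * τ i y + excess y * τ i y    ≡⟨ sym (*-distribʳ-+ (τ i y) 2 (excess y)) ⟩
      (2 + excess y) * τ i y          ≡⟨ cong (_* τ i y) (m+[n∸m]≡n (2≤deg y eq)) ⟩
      deg y * τ i y                   ∎
    ... | false rewrite outside-τ i eq | outside-deg eq = z≤n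

  Φ-linear : ∀ i → Φ 0 + i * E ≤ Φ i
  Φ-linear zero    = ≤-reflexive (+-identityʳ (Φ 0))
  Φ-linear (suc i) = ≤-trans (≤-reflexive (rotate (Φ 0) i E)) (≤-trans (+-monoˡ-≤ E (Φ-linear i)) (Φ-growth i))
    where
    rotate : ∀ x i e → x + suc i * e ≡ x + i * e + e
    rotate = solve-∀

  -- The sum of the progression Φ 0 + i E over i ≤ j, doubled so that j (j + 1) / 2 stays integral.
  Θ-lower : ∀ j → 2 * (suc j * Φ 0) + suc j * j * E ≤ 2 * Θ j
  Θ-lower zero    = ≤-reflexive (trans (+-identityʳ _) (cong (2 *_) (*-identityˡ (Φ 0))))
  Θ-lower (suc j) = begin
    2 * (suc (suc j) * Φ 0) + suc (suc j) * suc j * E                            ≡⟨ rotate j (Φ 0) E ⟩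
    2 * (suc j * Φ 0) + suc j * j * E + 2 * (Φ 0 + suc j * E)                    ≤⟨ +-mono-≤ (Θ-lower j) (*-monoʳ-≤ 2 (Φ-linear (suc j))) ⟩
    2 * Θ j + 2 * Φ (suc j)                                                      ≡⟨ sym (*-distribˡ-+ 2 (Θ j) (Φ (suc j))) ⟩
    2 * (Θ j + Φ (suc j))                                                        ≡⟨ cong (2 *_) (sym (Θ-suc j)) ⟩
    2 * Θ (suc j)                                                                ∎
    where
    open ≤-Reasoning
    rotate : ∀ j x e → 2 * (suc (suc j) * x) + suc (suc j) * suc j * e ≡ 2 * (suc j * x) + suc j * j * e + 2 * (x + suc j * e)
    rotate = solve-∀

  deg≤ : ∀ x → deg x ≤ suc b
  deg≤ x = ≤-trans (m≤m+n (deg x) (δ x)) (≤-trans (≤-reflexive (deg+δ x)) (≤-trans (*-monoʳ-≤ (suc b) (b2n-≤1 (S x))) (≤-reflexive (*-identityʳ (suc b)))))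

  t-upper : ∀ i y z → A y z ≡ true → t i y z ≤ b ^ i
  t-upper zero    y z yz = ≤-refl
  t-upper (suc i) y z yz = begin
    sum (λ w → β y z w * t i z w)   ≤⟨ sum-mono-≤ term ⟩
    sum (λ w → β y z w * b ^ i)     ≡⟨ sym (*-distribʳ-sum (b ^ i) (β y z)) ⟩
    sum (β y z) * b ^ i             ≤⟨ *-monoˡ-≤ (b ^ i) (+-cancelʳ-≤ 1 (sum (β y z)) b (≤-trans (≤-reflexive (deg-pred y z yz)) (≤-trans (deg≤ z) (≤-reflexive (+-comm 1 b))))) ⟩
    b * b ^ i                       ∎
    where
    open ≤-Reasoning
    term : ∀ w → β y z w * t i z w ≤ β y z w * b ^ i
    term w with 0 <? β y z w
    ... | no  β≡0 rewrite n≤0⇒n≡0 (≮⇒≥ β≡0) = z≤n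
    ... | yes β>0 = *-monoʳ-≤ (β y z w) (t-upper i z w (proj₁ (β-positive {y} β>0)))

  τ-upper : ∀ i y → τ i y ≤ deg y * b ^ i
  τ-upper i y = ≤-trans (sum-mono-≤ term) (≤-reflexive (sym (*-distribʳ-sum (b ^ i) (α y))))
    where
    term : ∀ z → α y z * t i y z ≤ α y z * b ^ i
    term z with A y z in yz
    ... | false = z≤n
    ... | true  = *-monoʳ-≤ 1 (t-upper i y z yz)

  -- A vertex incident with the cut has at most b neighbours in S; this is where k b^(i-1) improves to b^i.
  Φ-upper : ∀ i → b * Φ i ≤ Φ (suc i) + s * b ^ suc i
  Φ-upper i = +-cancelʳ-≤ (Φ i) _ _ (begin
    b * Φ i + Φ i                                               ≡⟨ +-comm (b * Φ i) (Φ i) ⟩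
    suc b * Φ i                                                 ≡⟨ *-distribˡ-sum (suc b) (τ i) ⟩
    sum (λ y → suc b * τ i y)                                   ≤⟨ sum-mono-≤ term ⟩
    sum (λ y → deg y * τ i y + δ y * b ^ suc i)                 ≡⟨ ∑-distrib-+ (λ y → deg y * τ i y) _ ⟩
    sum (λ y → deg y * τ i y) + sum (λ y → δ y * b ^ suc i)     ≡⟨ cong₂ _+_ (sym (Φ-step i)) (sym (*-distribʳ-sum (b ^ suc i) δ)) ⟩
    Φ (suc i) + Φ i + s * b ^ suc i                             ≡⟨ rotate (Φ (suc i)) (Φ i) (s * b ^ suc i) ⟩
    Φ (suc i) + s * b ^ suc i + Φ i                             ∎)
    where
    open ≤-Reasoning
    rotate : ∀ x y z → x + y + z ≡ x + z + y
    rotate = solve-∀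
    cut-term : ∀ y → S y ≡ true → δ y * τ i y ≤ δ y * (b * b ^ i)
    cut-term y y∈S with δ y | deg+δ y
    ... | zero  | _  = z≤n
    ... | suc e | eq = *-monoʳ-≤ (suc e) (≤-trans (τ-upper i y) (*-monoˡ-≤ (b ^ i) (s≤s⁻¹ deg<)))
      where
      deg< : suc (deg y) ≤ suc b
      deg< = begin
        suc (deg y)      ≤⟨ s≤s (m≤m+n (deg y) e) ⟩
        suc (deg y + e)  ≡⟨ sym (+-suc (deg y) e) ⟩
        deg y + suc e    ≡⟨ eq ⟩
        suc b * χ y      ≡⟨ cong (λ q → suc b * b2n q) y∈S ⟩
        suc b * 1        ≡⟨ *-identityʳ (suc b) ⟩
        suc b            ∎
    term : ∀ y → suc b * τ i y ≤ deg y * τ i y + δ y * b ^ suc i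
    term y with S y in eq
    ... | true  = begin
      suc b * τ i y                       ≡⟨ cong (_* τ i y) (sym (trans (deg+δ y) (trans (cong (λ q → suc b * b2n q) eq) (*-identityʳ (suc b))))) ⟩
      (deg y + δ y) * τ i y               ≡⟨ *-distribʳ-+ (τ i y) (deg y) (δ y) ⟩
      deg y * τ i y + δ y * τ i y         ≤⟨ +-monoʳ-≤ (deg y * τ i y) (cut-term y eq) ⟩
      deg y * τ i y + δ y * b ^ suc i     ∎
    ... | false rewrite outside-τ i eq | *-zeroʳ b = z≤n

  -- The loss s b^m at step m is multiplied by b in each of the i - m later steps, so each of the i
  -- steps contributes s b^i.
  Φ-closed-upper : ∀ i → b ^ i * Φ 0 ≤ Φ i + s * (i * b ^ i)
  Φ-closed-upper zero    = ≤-reflexive (trans (*-identityˡ (Φ 0)) (sym (trans (cong (Φ 0 +_) (*-zeroʳ s)) (+-identityʳ (Φ 0)))))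
  Φ-closed-upper (suc i) = begin
    b * b ^ i * Φ 0                                   ≡⟨ *-assoc b (b ^ i) (Φ 0) ⟩
    b * (b ^ i * Φ 0)                                 ≤⟨ *-monoʳ-≤ b (Φ-closed-upper i) ⟩
    b * (Φ i + s * (i * b ^ i))                       ≡⟨ *-distribˡ-+ b (Φ i) (s * (i * b ^ i)) ⟩
    b * Φ i + b * (s * (i * b ^ i))                   ≤⟨ +-monoˡ-≤ (b * (s * (i * b ^ i))) (Φ-upper i) ⟩
    Φ (suc i) + s * (b * b ^ i) + b * (s * (i * b ^ i)) ≡⟨ rotate (Φ (suc i)) s b (b ^ i) i ⟩
    Φ (suc i) + s * (suc i * (b * b ^ i))             ∎
    where
    open ≤-Reasoning
    rotate : ∀ x s b q i → x + s * (b * q) + b * (s * (i * q)) ≡ x + s * (suc i * (b * q))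
    rotate = solve-∀

  Θ-upper : ∀ j → σ b (suc j) * Φ 0 ≤ Θ j + s * ρ b (suc j)
  Θ-upper zero    = ≤-reflexive (trans (*-identityˡ (Φ 0)) (sym (trans (cong (Φ 0 +_) (*-zeroʳ s)) (+-identityʳ (Φ 0)))))
  Θ-upper (suc j) = begin
    (σ b (suc j) + b ^ suc j) * Φ 0                                              ≡⟨ *-distribʳ-+ (Φ 0) (σ b (suc j)) (b ^ suc j) ⟩
    σ b (suc j) * Φ 0 + b ^ suc j * Φ 0                                          ≤⟨ +-mono-≤ (Θ-upper j) (Φ-closed-upper (suc j)) ⟩
    Θ j + s * ρ b (suc j) + (Φ (suc j) + s * (suc j * b ^ suc j))                ≡⟨ rotate (Θ j) s (ρ b (suc j)) (Φ (suc j)) (suc j * b ^ suc j) ⟩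
    Θ j + Φ (suc j) + s * (ρ b (suc j) + suc j * b ^ suc j)                      ≡⟨ cong (_+ s * ρ b (suc (suc j))) (sym (Θ-suc j)) ⟩
    Θ (suc j) + s * ρ b (suc (suc j))                                            ∎
    where
    open ≤-Reasoning
    rotate : ∀ x s r y q → x + s * r + (y + s * q) ≡ x + y + s * (r + q)
    rotate = solve-∀

  Φ-cubic : (∀ y → S y ≡ true → deg y ≡ 3) → ∀ i → Φ (suc i) ≡ 2 * Φ i
  Φ-cubic cubic i = +-cancelʳ-≡ (Φ i) _ _ (begin
    Φ (suc i) + Φ i              ≡⟨ Φ-step i ⟩
    sum (λ y → deg y * τ i y)    ≡⟨ sum-cong-≗ term ⟩
    sum (λ y → 3 * τ i y)        ≡⟨ sym (*-distribˡ-sum 3 (τ i)) ⟩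
    3 * Φ i                      ≡⟨ rotate (Φ i) ⟩
    2 * Φ i + Φ i                ∎)
    where
    open ≡-Reasoning
    rotate : ∀ x → 3 * x ≡ 2 * x + x
    rotate = solve-∀
    term : ∀ y → deg y * τ i y ≡ 3 * τ i y
    term y with S y in eq
    ... | true  = cong (_* τ i y) (cubic y eq)
    ... | false rewrite outside-τ i eq = *-zeroʳ (deg y)

-- Parity of the girth and the order of the small side

data GirthParity (g : ℕ) : Set where
  odd-girth  : ∀ f → g ≡ f * 2 + 5 → isOdd g ≡ true → dOf g ≡ f + 2 → GirthParity g
  even-girth : ∀ e → g ≡ 2 * suc e → 2 ≤ e → isOdd g ≡ false → dOf g ≡ e → GirthParity g

girth-parity : ∀ g → 5 ≤ g → GirthParity g
girth-parity g 5≤g with g % 2 in rem | g div 2 in quot | m≡m%n+[m/n]*n g 2 | m%n<n g 2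
... | suc (suc _) | _ | _  | lt = ⊥-elim (<⇒≱ lt (s≤s (s≤s z≤n)))
... | suc zero    | q | eq | _  = odd-girth f (trans eq (trans (cong (λ q → suc (q * 2)) (sym f+2≡q)) (rearrange f))) isOdd≡ dOf≡
  where
  2≤q : 2 ≤ q
  2≤q = *-cancelʳ-≤ 2 q 2 (s≤s⁻¹ (≤-trans 5≤g (≤-reflexive eq)))
  f = proj₁ (shift 2≤q)
  f+2≡q : f + 2 ≡ q
  f+2≡q = proj₂ (shift 2≤q)
  rearrange : ∀ f → suc ((f + 2) * 2) ≡ f * 2 + 5
  rearrange = solve-∀
  isOdd≡ : isOdd g ≡ true
  isOdd≡ rewrite rem = refl
  dOf≡ : dOf g ≡ f + 2
  dOf≡ rewrite rem = trans quot (sym f+2≡q)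
... | zero        | q | eq | _  with q | quot | eq
...   | 0               | _    | eq = ⊥-elim (<⇒≱ (≤-trans (m≤m+n 1 4) 5≤g) (≤-reflexive eq))
...   | 1               | _    | eq = ⊥-elim (<⇒≱ (≤-trans (m≤m+n 3 2) 5≤g) (≤-reflexive eq))
...   | 2               | _    | eq = ⊥-elim (<⇒≱ 5≤g (≤-reflexive eq))
...   | suc e@(suc (suc _)) | quot | eq = even-girth e (trans eq (*-comm (suc e) 2)) (s≤s (s≤s z≤n)) isOdd≡ dOf≡
  where
  isOdd≡ : isOdd g ≡ false
  isOdd≡ rewrite rem = refl
  dOf≡ : dOf g ≡ e
  dOf≡ rewrite rem = cong (_∸ 1) quot

module Order {n : ℕ} (A : Fin n → Fin n → Bool) (A-sym : ∀ i j → A i j ≡ A j i) (A-irrefl : ∀ i → A i i ≡ false)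
             (S : Fin n → Bool) (A⊆S : ∀ {i j} → A i j ≡ true → S i ≡ true)
             (g : ℕ) (girth : (C : Cycle n A) → g ≤ len C)
             (2≤deg : ∀ x → S x ≡ true → 2 ≤ sum (λ y → b2n (A x y)))
             (a′ : ℕ) (δ : Fin n → ℕ) (deg+δ : ∀ x → sum (λ y → b2n (A x y)) + δ x ≡ suc (suc (suc a′)) * b2n (S x)) where

  open Growth A A-sym A-irrefl S A⊆S g girth 2≤deg (suc (suc a′)) δ deg+δ public

  private
    a b k : ℕ
    a = suc a′
    b = suc a
    k = suc b

  excess+cut : c + s ≡ a * h
  excess+cut = +-cancelˡ-≡ (2 * h) _ _ (trans (sym (+-assoc (2 * h) c s)) (trans (cong (_+ s) (sym sum-deg)) (trans sum-deg+cut (split a h))))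
    where
    split : ∀ a h → suc (suc a) * h ≡ 2 * h + a * h
    split = solve-∀

  Φ₀+cut : Φ 0 + s ≡ (a + 2) * h
  Φ₀+cut = trans (cong (_+ s) (trans Φ₀≡ (sym sum-deg))) (trans sum-deg+cut (cong (_* h) (+-comm 2 a)))

  -- With d = f + 2, twice the ball bound is at least 2 h + 2 d Φ 0 + 3 d (d - 1) c. As Φ 0 = 2 h +
  -- c, the coefficient of h is 2 (2 d + 1) = 2 g, and that of c is 2 d + 3 d (d - 1) = d (3 d - 1):
  -- this is the origin of L.
  odd-lower : ∀ f → 2 * (f + 2) < g → 2 * ((f * 2 + 5) * h) + c * ((f + 2) * (f * 3 + 5)) ≤ 2 * (h * h)
  odd-lower f short = begin
    2 * ((f * 2 + 5) * h) + c * ((f + 2) * (f * 3 + 5))                          ≡⟨ rearrange f h c ⟩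
    2 * h + (2 * (suc (f + 1) * (2 * h + c)) + suc (f + 1) * (f + 1) * (3 * c))  ≤⟨ +-monoʳ-≤ (2 * h) (+-mono-≤ (≤-reflexive (cong (λ x → 2 * (suc (f + 1) * x)) (sym Φ₀≡))) (*-monoʳ-≤ (suc (f + 1) * (f + 1)) 3c≤E)) ⟩
    2 * h + (2 * (suc (f + 1) * Φ 0) + suc (f + 1) * (f + 1) * E)                ≤⟨ +-monoʳ-≤ (2 * h) (Θ-lower (f + 1)) ⟩
    2 * h + 2 * Θ (f + 1)                                                        ≡⟨ sym (*-distribˡ-+ 2 h (Θ (f + 1))) ⟩
    2 * (h + Θ (f + 1))                                                          ≤⟨ *-monoʳ-≤ 2 (vertex-ball-bound (f + 1) (subst (λ i → 2 * i < g) (+-suc f 1) short)) ⟩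
    2 * (h * h)                                                                  ∎
    where
    open ≤-Reasoning
    rearrange : ∀ f h c → 2 * ((f * 2 + 5) * h) + c * ((f + 2) * (f * 3 + 5)) ≡ 2 * h + (2 * (suc (f + 1) * (2 * h + c)) + suc (f + 1) * (f + 1) * (3 * c))
    rearrange = solve-∀

  -- Replacing k h by Φ 0 + s costs s σ, which combines with the loss s ρ along the walks to s κ.
  odd-upper : ∀ f → 2 * (f + 2) < g → (1 + (a + 2) * σ b (f + 2)) * h ≤ h * h + s * κ b (f + 2)
  odd-upper f short = subst (λ d → (1 + (a + 2) * σ b d) * h ≤ h * h + s * κ b d) (sym (+-suc f 1)) (begin
    (1 + (a + 2) * σ b d) * h                        ≡⟨ r₁ a (σ b d) h ⟩
    h + σ b d * ((a + 2) * h)                        ≡⟨ cong (λ x → h + σ b d * x) (sym Φ₀+cut) ⟩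
    h + σ b d * (Φ 0 + s)                            ≡⟨ r₂ h (σ b d) (Φ 0) s ⟩
    h + σ b d * Φ 0 + s * σ b d                      ≤⟨ +-monoˡ-≤ (s * σ b d) (+-monoʳ-≤ h (Θ-upper (f + 1))) ⟩
    h + (Θ (f + 1) + s * ρ b d) + s * σ b d          ≡⟨ r₃ h (Θ (f + 1)) s (ρ b d) (σ b d) ⟩
    h + Θ (f + 1) + s * (σ b d + ρ b d)              ≤⟨ +-mono-≤ (vertex-ball-bound (f + 1) (subst (λ i → 2 * i < g) (+-suc f 1) short)) (≤-reflexive (cong (s *_) (sym (κ≡σ+ρ b d)))) ⟩
    h * h + s * κ b d                                ∎)
    where
    open ≤-Reasoning
    d = suc (f + 1)
    r₁ : ∀ a S h → (1 + (a + 2) * S) * h ≡ h + S * ((a + 2) * h)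
    r₁ = solve-∀
    r₂ : ∀ h S F s → h + S * (F + s) ≡ h + S * F + s * S
    r₂ = solve-∀
    r₃ : ∀ h T s R S → h + (T + s * R) + s * S ≡ h + T + s * (S + R)
    r₃ = solve-∀

  -- With D = e + 1, the same sum 2 D Φ 0 + 3 D (D - 1) c is compared with Φ 0 h; the extra c h
  -- appears because the edge bound is proportional to the number of arcs.
  even-lower : ∀ e → suc (2 * e) < g → 2 * (2 * suc e * h) + c * (suc e * (e * 3 + 2)) ≤ 2 * (h * h) + c * h
  even-lower e short = begin
    2 * (2 * suc e * h) + c * (suc e * (e * 3 + 2))                ≡⟨ r₁ e h c ⟩
    2 * (suc e * (2 * h + c)) + suc e * e * (3 * c)                ≤⟨ +-mono-≤ (≤-reflexive (cong (λ x → 2 * (suc e * x)) (sym Φ₀≡))) (*-monoʳ-≤ (suc e * e) 3c≤E) ⟩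
    2 * (suc e * Φ 0) + suc e * e * E                              ≤⟨ Θ-lower e ⟩
    2 * Θ e                                                        ≤⟨ edge-ball-bound e short ⟩
    Φ 0 * h                                                        ≡⟨ cong (_* h) Φ₀≡ ⟩
    (2 * h + c) * h                                                ≡⟨ r₂ h c ⟩
    2 * (h * h) + c * h                                            ∎
    where
    open ≤-Reasoning
    r₁ : ∀ e h c → 2 * (2 * suc e * h) + c * (suc e * (e * 3 + 2)) ≡ 2 * (suc e * (2 * h + c)) + suc e * e * (3 * c)
    r₁ = solve-∀
    r₂ : ∀ h c → (2 * h + c) * h ≡ 2 * (h * h) + c * h
    r₂ = solve-∀

  -- The cut size enters through the ρ term and through c. Only the former is raised to t here; the
  -- latter is left to `pad-cut`.
  even-upper : ∀ e t → suc (2 * e) < g → s ≤ t → 2 * (σ b (suc e) * (2 * h + c)) ≤ (2 * h + c) * h + 2 * (t * ρ b (suc e))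
  even-upper e t short s≤t = begin
    2 * (σ b (suc e) * (2 * h + c))          ≡⟨ cong (λ x → 2 * (σ b (suc e) * x)) (sym Φ₀≡) ⟩
    2 * (σ b (suc e) * Φ 0)                  ≤⟨ *-monoʳ-≤ 2 (≤-trans (Θ-upper e) (+-monoʳ-≤ (Θ e) (*-monoˡ-≤ (ρ b (suc e)) s≤t))) ⟩
    2 * (Θ e + t * ρ b (suc e))              ≡⟨ *-distribˡ-+ 2 (Θ e) (t * ρ b (suc e)) ⟩
    2 * Θ e + 2 * (t * ρ b (suc e))          ≤⟨ +-monoˡ-≤ (2 * (t * ρ b (suc e))) (edge-ball-bound e short) ⟩
    Φ 0 * h + 2 * (t * ρ b (suc e))          ≡⟨ cong (λ x → x * h + 2 * (t * ρ b (suc e))) Φ₀≡ ⟩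
    (2 * h + c) * h + 2 * (t * ρ b (suc e))  ∎
    where open ≤-Reasoning

  -- Order 12 would force S to induce a cubic graph of girth 6, which has at least 14 vertices.
  order≢12 : g ≡ 6 → a ≡ 2 → s ≤ a * g → h ≢ 12
  order≢12 g≡6 refl s≤ h≡12 = <⇒≱ (*-monoˡ-< (Φ 0) {{>-nonZero Φ₀>0}} (m≤m+n 13 1)) 14Φ≤12Φ
    where
    open ≤-Reasoning
    5<g : 5 < g
    5<g = ≤-reflexive (sym g≡6)
    Φ₀≡24+c : Φ 0 ≡ 24 + c
    Φ₀≡24+c = trans Φ₀≡ (cong (λ h → 2 * h + c) h≡12)
    Φ₀>0 : 0 < Φ 0
    Φ₀>0 = subst (0 <_) (sym Φ₀≡24+c) z<s
    bound : 2 * Θ 2 ≤ 12 * Φ 0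
    bound = ≤-trans (edge-ball-bound 2 5<g) (≤-reflexive (trans (cong (Φ 0 *_) h≡12) (*-comm (Φ 0) 12)))
    12≤c : 12 ≤ c
    12≤c = excess-bound 2 6 6 c s (trans excess+cut (cong (2 *_) h≡12)) (subst (λ g → s ≤ 2 * g) g≡6 s≤)
    E≤ : E ≤ Φ 0
    E≤ = *-cancelˡ-≤ 6 (+-cancelˡ-≤ (6 * Φ 0) _ _ (begin
      6 * Φ 0 + 6 * E             ≡⟨ r₁ (Φ 0) E ⟩
      2 * (3 * Φ 0) + 3 * 2 * E   ≤⟨ Θ-lower 2 ⟩
      2 * Θ 2                     ≤⟨ bound ⟩
      12 * Φ 0                    ≡⟨ r₂ (Φ 0) ⟩
      6 * Φ 0 + 6 * Φ 0           ∎))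
      where
      r₁ : ∀ x e → 6 * x + 6 * e ≡ 2 * (3 * x) + 3 * 2 * e
      r₁ = solve-∀
      r₂ : ∀ x → 12 * x ≡ 6 * x + 6 * x
      r₂ = solve-∀
    -- On S, with x the excess, the difference of the two sides is (x - 1)^2. Since E + h ≤ 36 + c ≤
    -- 4 c, equality holds everywhere and every x is 1.
    convex : ∀ y → 4 * excess y ≤ excess y * deg y + χ y
    convex y with S y in eq
    ... | false = subst (λ d → 4 * (d ∸ 2) ≤ (d ∸ 2) * d + 0) (sym (outside-deg eq)) z≤n
    ... | true  = subst (λ d → 4 * excess y ≤ excess y * d + 1) (m+[n∸m]≡n (2≤deg y eq)) (square (excess y))
      where
      r : ∀ x → suc x * (2 + suc x) + 1 ≡ 4 * suc x + x * x
      r = solve-∀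
      square : ∀ e → 4 * e ≤ e * (2 + e) + 1
      square zero    = z≤n
      square (suc x) = ≤-from-≡ _ (r x)
    total : sum (λ y → excess y * deg y + χ y) ≤ sum (λ y → 4 * excess y)
    total = begin
      sum (λ y → excess y * deg y + χ y) ≡⟨ ∑-distrib-+ (λ y → excess y * deg y) χ ⟩
      E + h                              ≤⟨ +-mono-≤ (≤-trans E≤ (≤-reflexive Φ₀≡24+c)) (≤-reflexive h≡12) ⟩
      24 + c + 12                        ≡⟨ r₁ c ⟩
      36 + c                             ≤⟨ +-monoˡ-≤ c (*-monoʳ-≤ 3 12≤c) ⟩
      3 * c + c                          ≡⟨ r₂ c ⟩
      4 * c                              ≡⟨ *-distribˡ-sum 4 excess ⟩
      sum (λ y → 4 * excess y)           ∎
      where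
      r₁ : ∀ c → 24 + c + 12 ≡ 36 + c
      r₁ = solve-∀
      r₂ : ∀ c → 3 * c + c ≡ 4 * c
      r₂ = solve-∀
    only-one : ∀ e → 4 * e ≡ e * (2 + e) + 1 → e ≡ 1
    only-one 1 _ = refl
    only-one (suc (suc x)) eq = ⊥-elim (<-irrefl eq (<-from-≡ _ (r x)))
      where
      r : ∀ x → suc (suc x) * (2 + suc (suc x)) + 1 ≡ 4 * suc (suc x) + (2 * x + x * x + 1)
      r = solve-∀
    cubic : ∀ y → S y ≡ true → deg y ≡ 3
    cubic y y∈S = trans (sym (m+[n∸m]≡n (2≤deg y y∈S))) (cong (2 +_) (only-one (excess y) (begin-equality
      4 * excess y                      ≡⟨ sum-≡⇒≗ convex total y ⟩
      excess y * deg y + χ y            ≡⟨ cong₂ (λ d q → excess y * d + b2n q) (sym (m+[n∸m]≡n (2≤deg y y∈S))) y∈S ⟩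
      excess y * (2 + excess y) + 1     ∎)))
    14Φ≤12Φ : 14 * Φ 0 ≤ 12 * Φ 0
    14Φ≤12Φ = begin
      14 * Φ 0                                     ≡⟨ r (Φ 0) ⟩
      2 * (Φ 0 + 2 * Φ 0 + 2 * (2 * Φ 0))          ≡⟨ cong (λ x → 2 * (Φ 0 + x + 2 * x)) (sym (Φ-cubic cubic 0)) ⟩
      2 * (Φ 0 + Φ 1 + 2 * Φ 1)                    ≡⟨ cong (λ x → 2 * (Φ 0 + Φ 1 + x)) (sym (Φ-cubic cubic 1)) ⟩
      2 * (Φ 0 + Φ 1 + Φ 2)                        ≡⟨ cong (λ x → 2 * (x + Φ 2)) (sym (Θ-suc 0)) ⟩
      2 * (Θ 1 + Φ 2)                              ≡⟨ cong (2 *_) (sym (Θ-suc 1)) ⟩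
      2 * Θ 2                                      ≤⟨ bound ⟩
      12 * Φ 0                                     ∎
      where
      r : ∀ x → 14 * x ≡ 2 * (x + 2 * x + 2 * (2 * x))
      r = solve-∀

  order≡girth : 5 ≤ g → 0 < h → s ≤ a * g → 2 * h ≤ n → LtB₂ k g (a * g) (ℤ.+ n ℚ./ 2) → h ≡ g × c ≡ 0
  order≡girth 5≤g 0<h s≤ 2h≤n below with girth-parity g 5≤g
  ... | odd-girth f refl odd d≡ = odd-order a f h n c s (s≤s z≤n) 0<h excess+cut s≤ (odd-lower f short) (odd-upper f short)
          (subst (λ k → BelowLargerRoot 1 (1 + k * σ b (f + 2)) (a * (f * 2 + 5) * κ b (f + 2)) n) (+-comm 2 a)
            (subst (λ d → BelowLargerRoot 1 (1 + k * σ b d) (a * (f * 2 + 5) * κ b d) n) d≡ (odd-below a′ (f * 2 + 5) (a * (f * 2 + 5)) n odd below))) 2h≤n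
    where
    r : ∀ f → f * 2 + 5 ≡ suc (2 * (f + 2))
    r = solve-∀
    short : 2 * (f + 2) < f * 2 + 5
    short = ≤-reflexive (sym (r f))
  ... | even-girth e refl 2≤e even d≡ = even-order a e h n c s (ρ b (suc e)) (s≤s z≤n) 2≤e 0<h excess+cut s≤ (κ≡σ+ρ b (suc e)) (even-lower e short) (even-upper e (a * (2 * suc e)) short s≤)
          (λ { a≡2 refl → order≢12 refl a≡2 s≤ })
          (subst (λ k → BelowLargerRoot k (2 * (k * σ b (suc e)) + a * (2 * suc e)) (2 * (a * (2 * suc e) * κ b (suc e))) n) (+-comm 2 a)
            (subst (λ d → BelowLargerRoot k (2 * (k * σ b (suc d)) + a * (2 * suc e)) (2 * (a * (2 * suc e) * κ b (suc d))) n) d≡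
              (even-below a′ (2 * suc e) (a * (2 * suc e)) n even below))) 2h≤n
    where
    r : ∀ e → 2 * suc e ≡ suc (suc (2 * e))
    r = solve-∀
    short : suc (2 * e) < 2 * suc e
    short = ≤-reflexive (sym (r e))

-- Components and cyclic successors

∧-true : ∀ {p q} → p ∧ q ≡ true → p ≡ true × q ≡ true
∧-true {true} {true} _ = refl , refl

∧-intro : ∀ {p q} → p ≡ true → q ≡ true → p ∧ q ≡ true
∧-intro refl refl = refl

not-true : ∀ {p} → not p ≡ true → p ≡ false
not-true {false} _ = refl

true≢false : ∀ {p} → p ≡ true → p ≡ false → ⊥
true≢false {true} _ ()

list-sum : ∀ {n} (f : Fin n → ℕ) → List.sum (map f (allFin n)) ≡ sum f
list-sum f = trans (cong List.sum (map-tabulate (λ i → i) f)) (tabulated f)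
  where
  tabulated : ∀ {n} (f : Fin n → ℕ) → List.sum (tabulate f) ≡ sum f
  tabulated {zero}  f = refl
  tabulated {suc n} f = cong (f zero +_) (tabulated (f ∘ suc))

sum-mono-< : ∀ {n} {f g : Fin n → ℕ} → (∀ i → f i ≤ g i) → ∀ i → f i < g i → sum f < sum g
sum-mono-< f≤g i f<g = ≰⇒> λ sum≥ → <-irrefl (sum-≡⇒≗ f≤g sum≥ i) f<g

two-terms : ∀ {n} (f : Fin n → ℕ) {x y} → x ≢ y → 0 < f x → 0 < f y → 2 ≤ sum f
two-terms f {zero}  {zero}  x≢y _  _  = ⊥-elim (x≢y refl)
two-terms f {zero}  {suc y} _   fx fy = +-mono-≤ fx (≤-trans fy (term-≤-sum (f ∘ suc) y))
two-terms f {suc x} {zero}  _   fx fy = +-mono-≤ fy (≤-trans fx (term-≤-sum (f ∘ suc) x))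
two-terms f {suc x} {suc y} x≢y fx fy = ≤-trans (two-terms (f ∘ suc) (x≢y ∘ cong suc) fx fy) (m≤n+m _ (f zero))

three-terms : ∀ {n} (f : Fin n → ℕ) {x y z} → x ≢ y → x ≢ z → y ≢ z → 0 < f x → 0 < f y → 0 < f z → 3 ≤ sum f
three-terms f {zero}  {zero}  {z}     x≢y _   _   _  _  _  = ⊥-elim (x≢y refl)
three-terms f {zero}  {suc y} {zero}  _   x≢z _   _  _  _  = ⊥-elim (x≢z refl)
three-terms f {suc x} {zero}  {zero}  _   _   y≢z _  _  _  = ⊥-elim (y≢z refl)
three-terms f {zero}  {suc y} {suc z} _   _   y≢z fx fy fz = +-mono-≤ fx (two-terms (f ∘ suc) (y≢z ∘ cong suc) fy fz)
three-terms f {suc x} {zero}  {suc z} _   x≢z _   fx fy fz = +-mono-≤ fy (two-terms (f ∘ suc) (x≢z ∘ cong suc) fx fz)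
three-terms f {suc x} {suc y} {zero}  x≢y _   _   fx fy fz = +-mono-≤ fz (two-terms (f ∘ suc) (x≢y ∘ cong suc) fx fy)
three-terms f {suc x} {suc y} {suc z} x≢y x≢z y≢z fx fy fz =
  ≤-trans (three-terms (f ∘ suc) (x≢y ∘ cong suc) (x≢z ∘ cong suc) (y≢z ∘ cong suc) fx fy fz) (m≤n+m _ (f zero))

sum₂-cong : ∀ {n} {f g : Fin n → Fin n → ℕ} → (∀ i j → f i j ≡ g i j) → sum (λ i → sum (f i)) ≡ sum (λ i → sum (g i))
sum₂-cong f≗g = sum-cong-≗ (λ i → sum-cong-≗ (f≗g i))

sum₂-+ : ∀ {n} (f g : Fin n → Fin n → ℕ) → sum (λ i → sum (λ j → f i j + g i j)) ≡ sum (λ i → sum (f i)) + sum (λ i → sum (g i))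
sum₂-+ f g = trans (sum-cong-≗ (λ i → ∑-distrib-+ (f i) (g i))) (∑-distrib-+ (λ i → sum (f i)) (λ i → sum (g i)))

prev : ∀ {m} → Fin (suc m) → Fin (suc m)
prev {m} zero = Fin.fromℕ m
prev (suc i)  = Fin.inject₁ i

next-prev : ∀ {m} (i : Fin (suc m)) → next (prev i) ≡ i
next-prev {m} zero with toℕ-next (Fin.fromℕ m)
... | inj₁ (lt , _) = ⊥-elim (<-irrefl (cong suc (Fin.toℕ-fromℕ m)) lt)
... | inj₂ (_ , eq) = toℕ-injective eq
next-prev {suc m} (suc i) with toℕ-next (Fin.inject₁ i)
... | inj₁ (_ , eq) = toℕ-injective (trans eq (cong suc (Fin.toℕ-inject₁ i)))
... | inj₂ (eq , _) = ⊥-elim (<-irrefl (suc-injective (trans (cong suc (sym (Fin.toℕ-inject₁ i))) eq)) (toℕ<n i))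

-- This is where length at least 3 matters: it keeps the two neighbours of a vertex on a cycle
-- apart.
next²≢id : ∀ {m} (i : Fin (suc (suc (suc m)))) → next (next i) ≢ i
next²≢id i eq with toℕ-next i | toℕ-next (next i)
... | inj₁ (_ , e) | inj₁ (_ , e′) = m≢1+m+n (toℕ i) (trans (cong toℕ (sym eq)) (trans e′ (trans (cong suc e) (cong suc (+-comm 1 (toℕ i))))))
... | inj₁ (_ , e) | inj₂ (l , e′) = impossible (trans (sym (cong suc e)) l) (trans (sym (cong toℕ eq)) e′)
  where
  impossible : ∀ {t m : ℕ} → 2 + t ≡ 3 + m → t ≡ 0 → ⊥
  impossible refl ()
... | inj₂ (l , e) | inj₁ (_ , e′) with () ← trans (sym (cong suc (trans (cong toℕ (sym eq)) (trans e′ (cong suc e))))) l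
... | inj₂ (_ , e) | inj₂ (l , _) with () ← trans (sym (cong suc e)) l

cycle-closure : ∀ {n} {A : Fin n → Fin n → Bool} (C : Cycle n A) (Q : Fin n → Set) → Q (vtx C zero) →
                (∀ {x y} → A x y ≡ true → Q x → Q y) → ∀ i → Q (vtx C i)
cycle-closure C Q start closed = <-weakInduction (λ i → Q (vtx C i)) start λ i q →
  subst (λ j → Q (vtx C j)) (next-prev (suc i)) (closed (edge C (Fin.inject₁ i)) q)

record Component {n : ℕ} (A : Fin n → Fin n → Bool) (u : Fin n) : Set where
  field
    member    : Fin n → Bool
    source    : member u ≡ true
    reachable : ∀ x → member x ≡ true → Reach A u x
    closed    : ∀ {x y} → A x y ≡ true → member x ≡ true → member y ≡ true

module _ {n : ℕ} (A : Fin n → Fin n → Bool) where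

  reach-snoc : ∀ {u x y} → Reach A u x → A x y ≡ true → Reach A u y
  reach-snoc Reach.here       xy = step xy Reach.here
  reach-snoc (step uw r) xy = step uw (reach-snoc r xy)

  -- Counting needs Boolean vertex sets, whereas `Reach` is an inductive predicate. Starting from u
  -- alone, the far end of some leaving edge is added until no edge leaves; the number of vertices
  -- outside bounds the rounds.
  component : ∀ u → Component A u
  component u = saturate (suc (sum (λ x → b2n (not (does (x Fin.≟ u)))))) _ ≤-refl (dec-true (u Fin.≟ u) refl)
                  (λ x → from x (x Fin.≟ u))
    where
    from : ∀ x (d : Dec (x ≡ u)) → does d ≡ true → Reach A u x
    from x (yes refl) _ = Reach.here
    saturate : ∀ fuel (S : Fin n → Bool) → sum (λ x → b2n (not (S x))) < fuel → S u ≡ true → (∀ x → S x ≡ true → Reach A u x) → Component A u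
    saturate (suc fuel) S (s≤s small) u∈S reachable with Fin.any? (λ x → Fin.any? (λ y → (S x Bool.≟ true) ×-dec (S y Bool.≟ false) ×-dec (A x y Bool.≟ true)))
    ... | no none = record { member = S ; source = u∈S ; reachable = reachable ; closed = closed }
      where
      closed : ∀ {x y} → A x y ≡ true → S x ≡ true → S y ≡ true
      closed {x} {y} xy x∈S with S y in eq
      ... | true  = refl
      ... | false = ⊥-elim (none (x , y , x∈S , eq , xy))
    ... | yes (x , y , x∈S , y∉S , xy) = saturate fuel S′ (<-≤-trans (sum-mono-< shrink y shrink-y) small) (cong (_∨ does (u Fin.≟ y)) u∈S) reachable′
      where
      S′ : Fin n → Bool
      S′ z = S z ∨ does (z Fin.≟ y)
      shrink : ∀ z → b2n (not (S′ z)) ≤ b2n (not (S z))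
      shrink z with S z
      ... | true  = z≤n
      ... | false = b2n-≤1 _
      shrink-y : b2n (not (S′ y)) < b2n (not (S y))
      shrink-y rewrite y∉S | dec-true (y Fin.≟ y) refl = s≤s z≤n
      reachable′ : ∀ z → S′ z ≡ true → Reach A u z
      reachable′ z z∈ with S z in eq | z Fin.≟ y
      ... | true  | _        = reachable z eq
      ... | false | yes refl = reach-snoc (reachable x x∈S) xy

-- Edge cuts

does⇒ : ∀ {Q : Set} (d : Dec Q) → does d ≡ true → Q
does⇒ (yes q) _ = q

b2n-mono : ∀ {p q} → (p ≡ true → q ≡ true) → b2n p ≤ b2n q
b2n-mono {p} p⇒q = ≤-b2n (b2n-≤1 p) (p⇒q ∘ b2n-positive)

positive-b2n : ∀ {p} → p ≡ true → 0 < b2n p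
positive-b2n refl = z<s

sum-ones : ∀ n → sum {n} (λ _ → 1) ≡ n
sum-ones zero    = refl
sum-ones (suc n) = cong suc (sum-ones n)

module Cuts {n : ℕ} (G : Graph n) (a′ g : ℕ) (5≤g : 5 ≤ g) (regular : Regular (suc (suc (suc a′))) G)
            (girth : (C : Cycle n (adj G)) → g ≤ len C)
            (below : LtB₂ (suc (suc (suc a′))) g (suc a′ * g) (ℤ.+ n ℚ./ 2)) where

  private
    a k : ℕ
    a = suc a′
    k = suc (suc a)

  compl : (Fin n → Bool) → Fin n → Bool
  compl S i = not (S i)

  inside across : (Fin n → Bool) → Fin n → Fin n → Bool
  inside S i j = S i ∧ (S j ∧ adj G i j)
  across S i j = S i ∧ (not (S j) ∧ adj G i j)

  deg cutdeg : (Fin n → Bool) → Fin n → ℕ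
  deg S i    = sum (λ j → b2n (inside S i j))
  cutdeg S i = sum (λ j → b2n (across S i j))

  card cut : (Fin n → Bool) → ℕ
  card S = sum (λ i → b2n (S i))
  cut S  = sum (cutdeg S)

  deg+cutdeg : ∀ S i → deg S i + cutdeg S i ≡ k * b2n (S i)
  deg+cutdeg S i = begin
    deg S i + cutdeg S i                                       ≡⟨ sym (∑-distrib-+ (λ j → b2n (inside S i j)) (λ j → b2n (across S i j))) ⟩
    sum (λ j → b2n (inside S i j) + b2n (across S i j))        ≡⟨ sum-cong-≗ split ⟩
    sum (λ j → b2n (adj G i j) * b2n (S i))                    ≡⟨ sym (*-distribʳ-sum (b2n (S i)) (λ j → b2n (adj G i j))) ⟩
    sum (λ j → b2n (adj G i j)) * b2n (S i)                    ≡⟨ cong (_* b2n (S i)) (trans (sym (list-sum (λ j → b2n (adj G i j)))) (regular i)) ⟩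
    k * b2n (S i)                                              ∎
    where
    open ≡-Reasoning
    split : ∀ j → b2n (inside S i j) + b2n (across S i j) ≡ b2n (adj G i j) * b2n (S i)
    split j with S i | S j | adj G i j
    ... | true  | true  | true  = refl
    ... | true  | true  | false = refl
    ... | true  | false | true  = refl
    ... | true  | false | false = refl
    ... | false | _     | true  = refl
    ... | false | _     | false = refl

  TwoRegular : (Fin n → Bool) → Set
  TwoRegular S = ∀ x → S x ≡ true → deg S x ≡ 2

  -- `Order` for the induced subgraph, with the cut degrees as `δ`. From c = 0 the cut is a h = a g,
  -- and no vertex of S has an excess.
  small-side : ∀ S → (∀ x → S x ≡ true → 2 ≤ deg S x) → 0 < card S → cut S ≤ a * g → 2 * card S ≤ n →
               card S ≡ g × cut S ≡ a * g × TwoRegular S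
  small-side S 2≤deg 0<card cut≤ small = card≡g , cut≡ , two-regular
    where
    inside-sym : ∀ i j → inside S i j ≡ inside S j i
    inside-sym i j rewrite Graph.sym G i j with S i | S j
    ... | true  | true  = refl
    ... | true  | false = refl
    ... | false | true  = refl
    ... | false | false = refl
    inside-irrefl : ∀ i → inside S i i ≡ false
    inside-irrefl i rewrite irrefl G i with S i
    ... | true  = refl
    ... | false = refl
    inside⊆S : ∀ {i j} → inside S i j ≡ true → S i ≡ true
    inside⊆S e = proj₁ (∧-true e)
    inside-girth : (C : Cycle n (inside S)) → g ≤ len C
    inside-girth C = girth (record { m = Cycle.m C ; vtx = vtx C ; inj = inj C ; edge = λ i → proj₂ (∧-true (proj₂ (∧-true {S (vtx C i)} (edge C i)))) })
    module O = Order (inside S) inside-sym inside-irrefl S inside⊆S g inside-girth 2≤deg a′ (cutdeg S) (deg+cutdeg S)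
    card≡g : card S ≡ g
    card≡g = proj₁ (O.order≡girth 5≤g 0<card cut≤ small below)
    c≡0 : O.c ≡ 0
    c≡0 = proj₂ (O.order≡girth 5≤g 0<card cut≤ small below)
    cut≡ : cut S ≡ a * g
    cut≡ = trans (cong (_+ cut S) (sym c≡0)) (trans O.excess+cut (cong (a *_) card≡g))
    two-regular : TwoRegular S
    two-regular x x∈S = trans (sym (O.deg≡ x)) (trans (cong (2 * b2n (S x) +_) (n≤0⇒n≡0 (subst (O.excess x ≤_) c≡0 (term-≤-sum O.excess x))))
                          (cong (λ p → 2 * b2n p + 0) x∈S))

  deg-mono : ∀ {K S} → (∀ x → K x ≡ true → S x ≡ true) → ∀ x → deg K x ≤ deg S x
  deg-mono {K} {S} K⊆S x = sum-mono-≤ λ y → b2n-mono λ e → let x∈K , rest = ∧-true e ; y∈K , xy = ∧-true rest in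
    ∧-intro (K⊆S x x∈K) (∧-intro (K⊆S y y∈K) xy)

  remove : (Fin n → Bool) → Fin n → Fin n → Bool
  remove S v i = S i ∧ not (does (i Fin.≟ v))

  -- When v leaves S, its edges to the complement leave the cut and its edges into S enter it;
  -- `exchange` balances this for each ordered pair.
  cut-remove : ∀ S v → S v ≡ true → cut (remove S v) + cutdeg S v ≤ cut S + deg S v
  cut-remove S v v∈S = begin
    cut S′ + cutdeg S v                                                             ≡⟨ cong (cut S′ +_) (sym (trans (sum-cong-≗ (λ i → sym (*-distribʳ-sum (𝟙 i v) (λ j → b2n (across S i j))))) (sum-𝟙 (cutdeg S) v))) ⟩
    cut S′ + sum (λ i → sum (λ j → b2n (across S i j) * 𝟙 i v))                     ≡⟨ sym (sum₂-+ (λ i j → b2n (across S′ i j)) (λ i j → b2n (across S i j) * 𝟙 i v)) ⟩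
    sum (λ i → sum (λ j → b2n (across S′ i j) + b2n (across S i j) * 𝟙 i v))        ≡⟨ sum₂-cong exchange ⟩
    sum (λ i → sum (λ j → b2n (across S i j) + b2n (S′ i ∧ adj G i j) * 𝟙 j v))     ≡⟨ sum₂-+ (λ i j → b2n (across S i j)) (λ i j → b2n (S′ i ∧ adj G i j) * 𝟙 j v) ⟩
    cut S + sum (λ i → sum (λ j → b2n (S′ i ∧ adj G i j) * 𝟙 j v))                  ≡⟨ cong (cut S +_) (sum-cong-≗ (λ i → sum-𝟙 (λ j → b2n (S′ i ∧ adj G i j)) v)) ⟩
    cut S + sum (λ i → b2n (S′ i ∧ adj G i v))                                      ≤⟨ +-monoʳ-≤ (cut S) (sum-mono-≤ neighbour) ⟩
    cut S + deg S v                                                                 ∎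
    where
    open ≤-Reasoning
    S′ = remove S v
    exchange : ∀ i j → b2n (across S′ i j) + b2n (across S i j) * 𝟙 i v ≡ b2n (across S i j) + b2n (S′ i ∧ adj G i j) * 𝟙 j v
    exchange i j with i Fin.≟ v | j Fin.≟ v
    exchange i j | yes refl | yes refl rewrite v∈S = refl
    exchange i j | yes refl | no _ rewrite v∈S with S j | adj G i j
    ... | true  | _     = refl
    ... | false | true  = refl
    ... | false | false = refl
    exchange i j | no _ | yes refl rewrite v∈S with S i | adj G i j
    ... | true  | true  = refl
    ... | true  | false = refl
    ... | false | _     = refl
    exchange i j | no _ | no _ with S i | S j | adj G i j
    ... | true  | true  | true  = refl
    ... | true  | true  | false = refl
    ... | true  | false | true  = refl
    ... | true  | false | false = refl
    ... | false | _     | _     = refl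
    neighbour : ∀ i → b2n (S′ i ∧ adj G i v) ≤ b2n (inside S v i)
    neighbour i = b2n-mono λ e → let i∈S′ , iv = ∧-true e in ∧-intro v∈S (∧-intro (proj₁ (∧-true i∈S′)) (trans (Graph.sym G v i) iv))

  -- At most one edge at v stays inside S, so at least k - 1 ≥ 2 of them lie in the cut.
  cut-drop : ∀ S v → S v ≡ true → deg S v ≤ 1 → cut (remove S v) < cut S
  cut-drop S v v∈S deg≤1 = +-cancelʳ-≤ 1 _ _ (begin
    suc (cut S′) + 1       ≡⟨ two (cut S′) ⟩
    cut S′ + 2             ≤⟨ +-monoʳ-≤ (cut S′) 2≤cutdeg ⟩
    cut S′ + cutdeg S v    ≤⟨ cut-remove S v v∈S ⟩
    cut S + deg S v        ≤⟨ +-monoʳ-≤ (cut S) deg≤1 ⟩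
    cut S + 1              ∎)
    where
    open ≤-Reasoning
    S′ = remove S v
    two : ∀ x → suc x + 1 ≡ x + 2
    two = solve-∀
    2≤cutdeg : 2 ≤ cutdeg S v
    2≤cutdeg = +-cancelˡ-≤ 1 2 (cutdeg S v) (begin
      3                      ≤⟨ s≤s (s≤s (s≤s z≤n)) ⟩
      k                      ≡⟨ sym (*-identityʳ k) ⟩
      k * 1                  ≡⟨ cong (λ p → k * b2n p) (sym v∈S) ⟩
      k * b2n (S v)          ≡⟨ sym (deg+cutdeg S v) ⟩
      deg S v + cutdeg S v   ≤⟨ +-monoˡ-≤ (cutdeg S v) deg≤1 ⟩
      1 + cutdeg S v         ∎)

  -- Deleting vertices of degree at most 1 strictly shrinks the cut and never touches a subgraph K of minimum degree 2.
  prune : ∀ fuel K S → card S < fuel → (∀ x → K x ≡ true → S x ≡ true) → (∀ x → K x ≡ true → 2 ≤ deg K x) →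
          ∃ λ S′ → (∀ x → K x ≡ true → S′ x ≡ true) × (∀ x → S′ x ≡ true → S x ≡ true) × (∀ x → S′ x ≡ true → 2 ≤ deg S′ x) ×
                   cut S′ ≤ cut S × (cut S ≤ cut S′ → ∀ x → S′ x ≡ S x)
  prune (suc fuel) K S (s≤s card≤) K⊆S 2≤degK with Fin.any? (λ x → (S x Bool.≟ true) ×-dec (deg S x ≤? 1))
  ... | no none = S , K⊆S , (λ _ e → e) , (λ x x∈S → ≰⇒> λ deg≤1 → none (x , x∈S , deg≤1)) , ≤-refl , λ _ _ → refl
  ... | yes (v , v∈S , deg≤1) =
    let S″ , K⊆S″ , S″⊆S′ , 2≤deg , cut≤ , _ = prune fuel K S′ (<-≤-trans (sum-mono-< smaller v smaller-v) card≤) K⊆S′ 2≤degK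
        cut< = ≤-<-trans cut≤ (cut-drop S v v∈S deg≤1)
    in S″ , K⊆S″ , (λ x e → proj₁ (∧-true (S″⊆S′ x e))) , 2≤deg , <⇒≤ cut< , λ cut≥ → ⊥-elim (<⇒≱ cut< cut≥)
    where
    S′ = remove S v
    smaller : ∀ x → b2n (S′ x) ≤ b2n (S x)
    smaller x = b2n-mono λ e → proj₁ (∧-true e)
    smaller-v : b2n (S′ v) < b2n (S v)
    smaller-v rewrite v∈S | dec-true (v Fin.≟ v) refl = s≤s z≤n
    K⊆S′ : ∀ x → K x ≡ true → S′ x ≡ true
    K⊆S′ x x∈K with x Fin.≟ v
    ... | yes refl = ⊥-elim (<⇒≱ (2≤degK x x∈K) (≤-trans (deg-mono K⊆S x) deg≤1))
    ... | no _     = ∧-intro (K⊆S x x∈K) refl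

  image : Cycle n (adj G) → Fin n → Bool
  image C x = does (Fin.any? (λ i → vtx C i Fin.≟ x))

  image-vtx : ∀ C i → image C (vtx C i) ≡ true
  image-vtx C i = dec-true (Fin.any? (λ j → vtx C j Fin.≟ vtx C i)) (i , refl)

  image-degree : ∀ C x → image C x ≡ true → 2 ≤ deg (image C) x
  image-degree C x x∈C with does⇒ (Fin.any? (λ i → vtx C i Fin.≟ x)) x∈C
  ... | i , refl = two-terms (λ y → b2n (inside (image C) (vtx C i) y)) distinct
                     (positive-b2n (∧-intro x∈C (∧-intro (image-vtx C (next i)) (edge C i))))
                     (positive-b2n (∧-intro x∈C (∧-intro (image-vtx C (prev i)) back)))
    where
    distinct : vtx C (next i) ≢ vtx C (prev i)
    distinct e = next²≢id (prev i) (trans (cong next (next-prev i)) (inj C e))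
    back : adj G (vtx C i) (vtx C (prev i)) ≡ true
    back = trans (Graph.sym G _ _) (subst (λ j → adj G (vtx C (prev i)) (vtx C j) ≡ true) (next-prev i) (edge C (prev i)))

  -- The pruned set contains the cycle, hence is nonempty, and has a cut of a g edges. As the cut of
  -- S is no larger, pruning did not shrink it and therefore deleted nothing.
  cyclic-small-side : ∀ S (C : Cycle n (adj G)) → (∀ i → S (vtx C i) ≡ true) → cut S ≤ a * g → 2 * card S ≤ n →
                      card S ≡ g × cut S ≡ a * g × TwoRegular S
  cyclic-small-side S C C⊆S cut≤ small with prune (suc (card S)) (image C) S ≤-refl image⊆S (image-degree C)
    where
    image⊆S : ∀ x → image C x ≡ true → S x ≡ true
    image⊆S x x∈C with does⇒ (Fin.any? (λ i → vtx C i Fin.≟ x)) x∈C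
    ... | i , refl = C⊆S i
  ... | S′ , C⊆S′ , S′⊆S , 2≤deg , cut′≤ , same with small-side S′ 2≤deg
            (≤-trans (positive-b2n (C⊆S′ _ (image-vtx C zero))) (term-≤-sum (λ x → b2n (S′ x)) (vtx C zero)))
            (≤-trans cut′≤ cut≤) (≤-trans (*-monoʳ-≤ 2 (sum-mono-≤ (λ x → b2n-mono (S′⊆S x)))) small)
  ...   | card≡ , cut≡ , two-regular = trans (sum-cong-≗ (λ x → cong b2n (sym (S′≗S x)))) card≡ , ≤-antisym cut≤ (≤-trans (≤-reflexive (sym cut≡)) cut′≤) ,
            λ x x∈S → trans (sum-cong-≗ (λ y → cong b2n (cong₂ (λ p q → p ∧ (q ∧ adj G x y)) (sym (S′≗S x)) (sym (S′≗S y))))) (two-regular x (trans (S′≗S x) x∈S))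
    where
    S′≗S : ∀ x → S′ x ≡ S x
    S′≗S = same (≤-trans cut≤ (≤-reflexive (sym cut≡)))

  card-compl : ∀ S → card S + card (compl S) ≡ n
  card-compl S = trans (sym (∑-distrib-+ (λ x → b2n (S x)) (λ x → b2n (not (S x))))) (trans (sum-cong-≗ one) (sum-ones n))
    where
    one : ∀ x → b2n (S x) + b2n (not (S x)) ≡ 1
    one x with S x
    ... | true  = refl
    ... | false = refl

  cut-compl : ∀ S → cut (compl S) ≡ cut S
  cut-compl S = trans (sum₂-cong flip) (∑-comm (λ i j → b2n (across S j i)))
    where
    flip : ∀ i j → b2n (across (compl S) i j) ≡ b2n (across S j i)
    flip i j rewrite Graph.sym G i j with S i | S j
    ... | true  | true  = refl
    ... | true  | false = refl
    ... | false | true  = refl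
    ... | false | false = refl

  half : ∀ S → 2 * card S ≤ n ⊎ 2 * card (compl S) ≤ n
  half S with ≤-total (card S) (card (compl S))
  ... | inj₁ le = inj₁ (≤-trans (+-monoʳ-≤ (card S) (≤-trans (≤-reflexive (+-identityʳ (card S))) le)) (≤-reflexive (card-compl S)))
  ... | inj₂ le = inj₂ (≤-trans (+-mono-≤ le (≤-reflexive (+-identityʳ (card (compl S))))) (≤-reflexive (card-compl S)))

  Tight : (Fin n → Bool) → Set
  Tight S = card S ≡ g × TwoRegular S

  separating : ∀ S (C C′ : Cycle n (adj G)) → (∀ i → S (vtx C i) ≡ true) → (∀ i → compl S (vtx C′ i) ≡ true) → cut S ≤ a * g →
               cut S ≡ a * g × (Tight S ⊎ Tight (compl S))
  separating S C C′ C⊆S C′⊆S cut≤ with half S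
  ... | inj₁ small = let card≡ , cut≡ , two = cyclic-small-side S C C⊆S cut≤ small in cut≡ , inj₁ (card≡ , two)
  ... | inj₂ small = let card≡ , cut≡ , two = cyclic-small-side (compl S) C′ C′⊆S (≤-trans (≤-reflexive (cut-compl S)) cut≤) small
                     in trans (sym (cut-compl S)) cut≡ , inj₂ (card≡ , two)

  a*g>0 : 0 < a * g
  a*g>0 = ≤-trans (≤-trans (s≤s z≤n) 5≤g) (m≤m+n g (a′ * g))

  -- With an empty cut S induces a k-regular graph, so `small-side` applies directly and produces a
  -- cut of a g > 0 edges.
  empty-cut-small : ∀ S x → S x ≡ true → cut S ≡ 0 → 2 * card S ≤ n → ⊥
  empty-cut-small S x x∈S cut≡0 small with small-side S full
      (≤-trans (positive-b2n x∈S) (term-≤-sum (λ x → b2n (S x)) x)) (≤-trans (≤-reflexive cut≡0) z≤n) small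
    where
    full : ∀ y → S y ≡ true → 2 ≤ deg S y
    full y y∈S = begin
      2                       ≤⟨ s≤s (s≤s z≤n) ⟩
      k                       ≡⟨ sym (*-identityʳ k) ⟩
      k * 1                   ≡⟨ cong (λ p → k * b2n p) (sym y∈S) ⟩
      k * b2n (S y)           ≡⟨ sym (deg+cutdeg S y) ⟩
      deg S y + cutdeg S y    ≡⟨ cong (deg S y +_) (n≤0⇒n≡0 (subst (cutdeg S y ≤_) cut≡0 (term-≤-sum (cutdeg S) y))) ⟩
      deg S y + 0             ≡⟨ +-identityʳ (deg S y) ⟩
      deg S y                 ∎
      where open ≤-Reasoning
  ... | _ , cut≡ , _ = <-irrefl (trans (sym cut≡0) cut≡) a*g>0

  -- Connectedness of G: S and its complement have the same cut, and one of them has at most n / 2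
  -- vertices.
  nonempty-cut : ∀ S {x y} → S x ≡ true → compl S y ≡ true → cut S ≢ 0
  nonempty-cut S {x} {y} x∈S y∉S cut≡0 with half S
  ... | inj₁ small = empty-cut-small S x x∈S cut≡0 small
  ... | inj₂ small = empty-cut-small (compl S) y y∉S (trans (cut-compl S) cut≡0) small

-- From edge sets to vertex cuts

size-double : ∀ {n} {G : Graph n} (F : EdgeSet G) → sum (λ i → sum (λ j → b2n (mem F i j))) ≡ size F + size F
size-double {n} {G} F = begin
  sum (λ i → sum (λ j → b2n (mem F i j)))                                            ≡⟨ sum₂-cong split ⟩
  sum (λ i → sum (λ j → up i j + up j i))                                            ≡⟨ sum₂-+ up (λ i j → up j i) ⟩
  sum (λ i → sum (up i)) + sum (λ i → sum (λ j → up j i))                            ≡⟨ cong (sum (λ i → sum (up i)) +_) (∑-comm (λ i j → up j i)) ⟩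
  sum (λ i → sum (up i)) + sum (λ i → sum (up i))                                    ≡⟨ cong₂ _+_ size≡ size≡ ⟩
  size F + size F                                                                    ∎
  where
  open ≡-Reasoning
  up : Fin n → Fin n → ℕ
  up i j = b2n (mem F i j ∧ (toℕ i <ᵇ toℕ j))
  size≡ : sum (λ i → sum (up i)) ≡ size F
  size≡ = sym (trans (list-sum (λ i → List.sum (map (up i) (allFin n)))) (sum-cong-≗ (λ i → list-sum (up i))))
  no-loop : ∀ i → mem F i i ≡ false
  no-loop i with mem F i i in eq
  ... | false = refl
  ... | true  = ⊥-elim (true≢false (EdgeSet.sub F i i eq) (irrefl G i))
  below? : ∀ x y → x < y → (x <ᵇ y) ≡ true × (y <ᵇ x) ≡ false
  below? x y x<y = dec-true (x <? y) x<y , dec-false (y <? x) (<-asym x<y)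
  split : ∀ i j → b2n (mem F i j) ≡ up i j + up j i
  split i j with <-cmp (toℕ i) (toℕ j)
  ... | tri< lt _ _ rewrite proj₁ (below? (toℕ i) (toℕ j) lt) | proj₂ (below? (toℕ i) (toℕ j) lt) with mem F i j | mem F j i
  ...   | true  | true  = refl
  ...   | true  | false = refl
  ...   | false | true  = refl
  ...   | false | false = refl
  split i j | tri> _ _ gt rewrite proj₁ (below? (toℕ j) (toℕ i) gt) | proj₂ (below? (toℕ j) (toℕ i) gt) | EdgeSet.sym F j i with mem F i j
  ...   | true  = refl
  ...   | false = refl
  split i j | tri≈ _ eq _ rewrite toℕ-injective eq | no-loop j = refl

module EdgeCut {n : ℕ} (G : Graph n) (a′ g : ℕ) (5≤g : 5 ≤ g) (regular : Regular (suc (suc (suc a′))) G)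
               (girth : (C : Cycle n (adj G)) → g ≤ len C)
               (below : LtB₂ (suc (suc (suc a′))) g (suc a′ * g) (ℤ.+ n ℚ./ 2)) (F : EdgeSet G) where

  open Cuts G a′ g 5≤g regular girth below

  private
    a : ℕ
    a = suc a′

    R : Fin n → Fin n → Bool
    R = minus G F

  R-sym : ∀ {x y} → R x y ≡ true → R y x ≡ true
  R-sym {x} {y} xy = trans (cong₂ (λ p q → p ∧ not q) (Graph.sym G y x) (EdgeSet.sym F y x)) xy

  R⊆adj : ∀ {x y} → R x y ≡ true → adj G x y ≡ true
  R⊆adj xy = proj₁ (∧-true xy)

  Closed : (Fin n → Bool) → Set
  Closed S = ∀ {x y} → R x y ≡ true → S x ≡ true → S y ≡ true

  compl-closed : ∀ {S} → Closed S → Closed (compl S)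
  compl-closed {S} closed {x} {y} xy x∉S with S y in eq
  ... | false = refl
  ... | true  = ⊥-elim (true≢false (closed (R-sym xy) eq) (not-true x∉S))

  forget : Cycle n R → Cycle n (adj G)
  forget C = record { m = Cycle.m C ; vtx = vtx C ; inj = inj C ; edge = λ i → R⊆adj (edge C i) }

  -- Both orientations of a cut edge are counted, to match the symmetric `mem F` entry by entry.
  both : (Fin n → Bool) → Fin n → Fin n → ℕ
  both S i j = b2n (across S i j) + b2n (across (compl S) i j)

  sum-both : ∀ S → sum (λ i → sum (both S i)) ≡ cut S + cut S
  sum-both S = trans (sum₂-+ (λ i j → b2n (across S i j)) (λ i j → b2n (across (compl S) i j))) (cong (cut S +_) (cut-compl S))

  across-mem : ∀ {S} → Closed S → ∀ i j → across S i j ≡ true → mem F i j ≡ true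
  across-mem {S} closed i j e with mem F i j in eq
  ... | true  = refl
  ... | false = let i∈S , rest = ∧-true e ; j∉S , ij = ∧-true rest in
                ⊥-elim (true≢false (closed (∧-intro ij (cong not eq)) i∈S) (not-true j∉S))

  both-≤ : ∀ {S} → Closed S → ∀ i j → both S i j ≤ b2n (mem F i j)
  both-≤ {S} closed i j = ≤-b2n at-most-one in-F
    where
    at-most-one : both S i j ≤ 1
    at-most-one with S i
    ... | true  = subst (_≤ 1) (sym (+-identityʳ _)) (b2n-≤1 (not (S j) ∧ adj G i j))
    ... | false = b2n-≤1 (not (not (S j)) ∧ adj G i j)
    in-F : 0 < both S i j → mem F i j ≡ true
    in-F pos with across S i j in eq
    ... | true  = across-mem closed i j eq
    ... | false = across-mem (compl-closed closed) i j (b2n-positive pos)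

  cut≤size : ∀ {S} → Closed S → cut S ≤ size F
  cut≤size {S} closed = ≮⇒≥ λ size<cut → <⇒≱ (+-mono-< size<cut size<cut)
    (≤-trans (≤-reflexive (sym (sum-both S))) (≤-trans (sum-mono-≤ (λ i → sum-mono-≤ (both-≤ closed i))) (≤-reflexive (size-double F))))

  -- Equality of the totals forces `both S` and F to agree at every pair, so F has no edge inside S
  -- or inside its complement.
  tight-cut : ∀ {S} → Closed S → size F ≤ cut S → ∀ {x y} → adj G x y ≡ true → S x ≡ S y → R x y ≡ true
  tight-cut {S} closed size≤cut {x} {y} xy same = ∧-intro xy (cong not (mem≡false (trans (sym pointwise) none)))
    where
    rows : ∀ i → sum (both S i) ≡ sum (λ j → b2n (mem F i j))
    rows = sum-≡⇒≗ (λ i → sum-mono-≤ (both-≤ closed i))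
             (≤-trans (≤-reflexive (size-double F)) (≤-trans (+-mono-≤ size≤cut size≤cut) (≤-reflexive (sym (sum-both S)))))
    pointwise : both S x y ≡ b2n (mem F x y)
    pointwise = sum-≡⇒≗ (both-≤ closed x) (≤-reflexive (sym (rows x))) y
    none : both S x y ≡ 0
    none rewrite same with S y
    ... | true  = refl
    ... | false = refl
    mem≡false : ∀ {p} → b2n p ≡ 0 → p ≡ false
    mem≡false {false} _ = refl

  reach-back : ∀ {S x v} → Closed S → Reach R x v → S v ≡ true → S x ≡ true
  reach-back closed Reach.here   v∈S = v∈S
  reach-back closed (step xw r) v∈S = closed (R-sym xw) (reach-back closed r v∈S)

  reach-sym : ∀ {x y} → Reach R x y → Reach R y x
  reach-sym Reach.here  = Reach.here
  reach-sym (step xw r) = reach-snoc R (reach-sym r) (R-sym xw)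

  -- C has at least g vertices by the girth and at most |S| = g, so it runs through all of S; a
  -- chord would be a third edge at a vertex of degree 2.
  tight-cycle : ∀ S (C : Cycle n R) → Closed S → (∀ i → S (vtx C i) ≡ true) → Tight S → HasCycleComponent G F g
  tight-cycle S C closed C⊆S (card≡g , two-regular) = C , len≡g , (λ x r → onto x (reach-back closed r (C⊆S zero))) , chordless
    where
    hits : Fin n → ℕ
    hits x = sum (λ i → 𝟙 (vtx C i) x)
    𝟙-positive : ∀ {x y : Fin n} → 0 < 𝟙 x y → x ≡ y
    𝟙-positive {x} {y} pos = does⇒ (x Fin.≟ y) (b2n-positive pos)
    hits≤ : ∀ x → hits x ≤ b2n (S x)
    hits≤ x = ≤-b2n (sum-≤1 _ (λ i → b2n-≤1 (does (vtx C i Fin.≟ x))) (λ i j pi pj → inj C (trans (𝟙-positive pi) (sym (𝟙-positive pj)))))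
                    (λ pos → let i , pi = sum-positive (λ i → 𝟙 (vtx C i) x) pos in subst (λ x → S x ≡ true) (𝟙-positive pi) (C⊆S i))
    sum-hits : sum hits ≡ len C
    sum-hits = trans (∑-comm (λ x i → 𝟙 (vtx C i) x)) (trans (sum-cong-≗ (λ i → trans (sum-cong-≗ (λ x → trans (𝟙-sym (vtx C i) x) (sym (*-identityˡ (𝟙 x (vtx C i)))))) (sum-𝟙 (λ _ → 1) (vtx C i)))) (sum-ones (len C)))
    len≡g : len C ≡ g
    len≡g = ≤-antisym (≤-trans (≤-reflexive (sym sum-hits)) (≤-trans (sum-mono-≤ hits≤) (≤-reflexive card≡g))) (girth (forget C))
    onto : ∀ x → S x ≡ true → ∃ λ i → vtx C i ≡ x
    onto x x∈S = let i , pi = sum-positive (λ i → 𝟙 (vtx C i) x) (subst (0 <_) (sym (sum-≡⇒≗ hits≤ (≤-reflexive (trans card≡g (trans (sym len≡g) (sym sum-hits)))) x)) (positive-b2n x∈S))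
                 in i , 𝟙-positive pi
    chordless : ∀ i j → R (vtx C i) (vtx C j) ≡ true → (j ≡ next i) ⊎ (i ≡ next j)
    chordless i j ij with j Fin.≟ next i | j Fin.≟ prev i
    ... | yes e | _     = inj₁ e
    ... | no _  | yes e = inj₂ (trans (sym (next-prev i)) (cong next (sym e)))
    ... | no ≢next | no ≢prev = ⊥-elim (<-irrefl (sym (two-regular (vtx C i) (C⊆S i)))
            (three-terms (λ y → b2n (inside S (vtx C i) y)) (≢next ∘ inj C) (≢prev ∘ inj C) distinct
              (neighbour j ij) (neighbour (next i) (edge C i)) (neighbour (prev i) back)))
      where
      neighbour : ∀ l → R (vtx C i) (vtx C l) ≡ true → 0 < b2n (inside S (vtx C i) (vtx C l))
      neighbour l il = positive-b2n (∧-intro (C⊆S i) (∧-intro (C⊆S l) (R⊆adj il)))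
      distinct : vtx C (next i) ≢ vtx C (prev i)
      distinct e = next²≢id (prev i) (trans (cong next (next-prev i)) (inj C e))
      back : R (vtx C i) (vtx C (prev i)) ≡ true
      back = R-sym (subst (λ j → R (vtx C (prev i)) (vtx C j) ≡ true) (next-prev i) (edge C (prev i)))

  module _ (C₁ C₂ : Cycle n R) (apart : ¬ Reach R (vtx C₁ zero) (vtx C₂ zero)) where

    open Component (component R (vtx C₁ zero)) renaming (member to A₁; source to source₁; reachable to reachable₁; closed to closed₁)
    open Component (component R (vtx C₂ zero)) renaming (member to A₂; source to source₂; reachable to reachable₂; closed to closed₂)

    disjoint : ∀ {x} → A₁ x ≡ true → compl A₂ x ≡ true
    disjoint {x} x∈A₁ with A₂ x in eq
    ... | false = refl
    ... | true  = ⊥-elim (apart (trans-reach (reachable₁ x x∈A₁) (reach-sym (reachable₂ x eq))))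
      where
      trans-reach : ∀ {x y z} → Reach R x y → Reach R y z → Reach R x z
      trans-reach Reach.here  r = r
      trans-reach (step e r′) r = step e (trans-reach r′ r)

    C₁⊆A₁ : ∀ i → A₁ (vtx C₁ i) ≡ true
    C₁⊆A₁ = cycle-closure C₁ (λ x → A₁ x ≡ true) source₁ closed₁

    C₂⊆A₂ : ∀ i → A₂ (vtx C₂ i) ≡ true
    C₂⊆A₂ = cycle-closure C₂ (λ x → A₂ x ≡ true) source₂ closed₂

    C₂⊈A₁ : ∀ i → compl A₁ (vtx C₂ i) ≡ true
    C₂⊈A₁ = cycle-closure C₂ (λ x → compl A₁ x ≡ true) start (compl-closed closed₁)
      where
      start : compl A₁ (vtx C₂ zero) ≡ true
      start with A₁ (vtx C₂ zero) in eq
      ... | false = refl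
      ... | true  = ⊥-elim (true≢false (disjoint eq) (cong not source₂))

    split : size F ≤ a * g → cut A₁ ≡ a * g × (Tight A₁ ⊎ Tight (compl A₁))
    split size≤ = separating A₁ (forget C₁) (forget C₂) C₁⊆A₁ C₂⊈A₁ (≤-trans (cut≤size closed₁) size≤)

    -- If F has at most a g edges, the component of C₁ has a cut of exactly a g edges, and all of
    -- them lie in F.
    large : a * g ≤ size F
    large with ≤-total (size F) (a * g)
    ... | inj₁ size≤ = ≤-trans (≤-reflexive (sym (proj₁ (split size≤)))) (cut≤size closed₁)
    ... | inj₂ size≥ = size≥

    module _ (size≡ : size F ≡ a * g) where

      private
        cut-A₁ : cut A₁ ≡ a * g
        cut-A₁ = proj₁ (split (≤-reflexive size≡))

      cycle-component : HasCycleComponent G F g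
      cycle-component with proj₂ (split (≤-reflexive size≡))
      ... | inj₁ tight = tight-cycle A₁ C₁ closed₁ C₁⊆A₁ tight
      ... | inj₂ tight = tight-cycle (compl A₁) C₂ (compl-closed closed₁) C₂⊈A₁ tight

      rest : Fin n → Bool
      rest x = not (A₁ x) ∧ not (A₂ x)

      -- No edge joins A₂ to the rest, since F only contains edges between A₁ and its complement.
      cut-splits : cut A₁ ≡ cut A₂ + cut rest
      cut-splits = trans (sym (cut-compl A₁)) (trans (sum₂-cong pointwise) (sum₂-+ (λ i j → b2n (across A₂ i j)) (λ i j → b2n (across rest i j))))
        where
        unjoined : ∀ {i j} → compl A₁ i ≡ true → A₂ j ≡ true → adj G i j ≡ true → A₂ i ≡ true
        unjoined {i} {j} i∉A₁ j∈A₂ ij = closed₂ (R-sym (tight-cut closed₁ (≤-reflexive (trans size≡ (sym cut-A₁))) ij (trans (not-true i∉A₁) (sym (not-true j∉A₁))))) j∈A₂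
          where
          j∉A₁ : compl A₁ j ≡ true
          j∉A₁ with A₁ j in eq
          ... | false = refl
          ... | true  = ⊥-elim (true≢false (disjoint eq) (cong not j∈A₂))
        pointwise : ∀ i j → b2n (across (compl A₁) i j) ≡ b2n (across A₂ i j) + b2n (across rest i j)
        pointwise i j with adj G i j in ij
        ... | false = lemma (A₁ i) (A₁ j) (A₂ i) (A₂ j)
          where
          lemma : ∀ p p′ q q′ → b2n (not p ∧ (not (not p′) ∧ false)) ≡ b2n (q ∧ (not q′ ∧ false)) + b2n ((not p ∧ not q) ∧ (not (not p′ ∧ not q′) ∧ false))
          lemma true  true  true  true  = refl
          lemma true  true  true  false = refl
          lemma true  true  false _     = refl
          lemma true  false true  true  = refl
          lemma true  false true  false = refl
          lemma true  false false _     = refl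
          lemma false true  true  true  = refl
          lemma false true  true  false = refl
          lemma false true  false _     = refl
          lemma false false true  true  = refl
          lemma false false true  false = refl
          lemma false false false true  = refl
          lemma false false false false = refl
        ... | true with A₁ i in i₁ | A₁ j in j₁ | A₂ i in i₂ | A₂ j in j₂
        ...   | true  | _     | true  | _     = ⊥-elim (true≢false (disjoint i₁) (cong not i₂))
        ...   | true  | _     | false | _     = refl
        ...   | false | true  | _     | true  = ⊥-elim (true≢false (disjoint j₁) (cong not j₂))
        ...   | false | true  | true  | false = refl
        ...   | false | true  | false | false = refl
        ...   | false | false | true  | true  = refl
        ...   | false | false | true  | false = ⊥-elim (true≢false (unjoined (cong not j₁) i₂ (trans (Graph.sym G j i) ij)) j₂)
        ...   | false | false | false | true  = ⊥-elim (true≢false (unjoined (cong not i₁) j₂ ij) i₂)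
        ...   | false | false | false | false = refl

      -- The components of C₁ and C₂ both have cuts of a g edges, so by `cut-splits` the remaining
      -- vertices have an empty cut. They miss C₁, so connectedness of G leaves none of them.
      rest-empty : ∀ x → rest x ≡ false
      rest-empty x with rest x in x∈rest
      ... | false = refl
      ... | true  = ⊥-elim (nonempty-cut rest {x} {vtx C₁ zero} x∈rest (cong (λ p → not (not p ∧ not (A₂ (vtx C₁ zero)))) source₁) cut-rest)
        where
        cut-A₂ : cut A₂ ≡ a * g
        cut-A₂ = proj₁ (separating A₂ (forget C₂) (forget C₁) C₂⊆A₂ (λ i → disjoint (C₁⊆A₁ i)) (≤-trans (cut≤size closed₂) (≤-reflexive size≡)))
        cut-rest : cut rest ≡ 0
        cut-rest = +-cancelˡ-≡ (cut A₂) _ _ (trans (sym cut-splits) (trans cut-A₁ (trans (sym cut-A₂) (sym (+-identityʳ (cut A₂))))))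

      two-components : TwoComponents G F
      two-components = vtx C₁ zero , vtx C₂ zero , apart , reaches
        where
        reaches : ∀ x → Reach R x (vtx C₁ zero) ⊎ Reach R x (vtx C₂ zero)
        reaches x with A₁ x in e₁ | A₂ x in e₂ | rest-empty x
        ... | true  | _     | _ = inj₁ (reach-sym (reachable₁ x e₁))
        ... | false | true  | _ = inj₂ (reach-sym (reachable₂ x e₂))
        ... | false | false | ()

open import Data.Integer using (+_)
open import Data.Rational using (_/_)

theorem2 : ∀ (k g n : ℕ) → 3 ≤ k → 5 ≤ g → (G : Graph n) → Regular k G → Girth g G →
    LtB₂ k g ((k ∸ 2) * g) ((+ n) / 2) →
    CyclicallyEdgeConnected ((k ∸ 2) * g) G
    × (∀ (F : EdgeSet G) → CycleSeparating G F → size F ≡ (k ∸ 2) * g →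
    TwoComponents G F × HasCycleComponent G F g)
theorem2 (suc (suc (suc a′))) g n (s≤s (s≤s (s≤s z≤n))) 5≤g G regular (_ , girth) below =
  (λ F (C₁ , C₂ , apart) → large F C₁ C₂ apart) ,
  λ F (C₁ , C₂ , apart) size≡ → two-components F C₁ C₂ apart size≡ , cycle-component F C₁ C₂ apart size≡
  where open EdgeCut G a′ g 5≤g regular girth below
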